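{- For every $\varepsilon > 0$ there exists a constant $C$ such that the following holds. Let $p = p(n) \in [0,1]$ satisfy $p > C/n$, and let $m := \binom{n}{\lfloor n/2 \rfloor}$. Then, with high probability, the largest antichain contained in the random family $\mathcal{P}(n,p)$ has size at most $(1+\varepsilon) p m$.
   Context: For a positive integer $n$, $[n] = \{1,\dots,n\}$ and $\mathcal{P}(n)$ denotes the power set of $[n]$. A family $\mathcal{A} \subseteq \mathcal{P}(n)$ is an antichain if for any $A, B \in \mathcal{A}$ with $A \subseteq B$ we have $A = B$. For $p \in [0,1]$, $\mathcal{P}(n,p)$ is the random subset of $\mathcal{P}(n)$ obtained by selecting each element of $\mathcal{P}(n)$ with probability $p$, independently of all other choices. "With high probability" means with probability tending to $1$ as $n \to \infty$. -}

module Defs where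

open import Data.Bool using (Bool; true; if_then_else_)
import Data.Bool.Properties as Boolₚ
open import Data.Fin using (Fin; funToFin)
open import Data.Fin.Properties using (2↔Bool)
open import Data.Fin.Subset using (Subset; inside; outside; ∣_∣; _∈_; _⊆_)
open import Data.Fin.Subset.Properties using (_∈?_; _⊆?_; anySubset?)
open import Data.Integer using (+_)
open import Data.List using (List; []; _∷_; _++_; map; filter; filterᵇ; foldr)
open import Data.List.Extrema.Nat using (max)
open import Data.Nat as ℕ using (ℕ; zero; suc; NonZero)
open import Data.Nat.Properties as ℕₚ using ()
open import Data.Product using (∃; _×_; _,_; proj₁; proj₂)
open import Data.Rational as ℚ using (ℚ; 0ℚ; 1ℚ; ½)
open import Data.Rational.Properties as ℚₚ using ()
open import Data.Rational.Solver using (module +-*-Solver)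
open import Data.Vec as Vec using ([]; _∷_; lookup)
import Data.Vec.Properties as Vecₚ
open import Function using (_∘_; Inverse)
open import Relation.Binary.PropositionalEquality
  using (_≡_; refl; sym; trans; cong; cong₂; subst)
open import Relation.Nullary using (Dec; yes; no)
open import Relation.Nullary.Decidable using (_×-dec_; _→-dec_; ¬?; decidable-stable)

------------------------------------------------------------------------
-- Real numbers, as Cauchy sequences of rationals.  Two sequences denote
-- the same real when each is ≤ᴿ the other; since the operations below are
-- pointwise, they respect this equality, as do ≤ᴿ and <ᴿ.

IsCauchy : (ℕ → ℚ) → Set
IsCauchy x = ∀ η → 0ℚ ℚ.< η →
  ∃ λ N → ∀ m n → N ℕ.≤ m → N ℕ.≤ n → ℚ.∣ x m ℚ.- x n ∣ ℚ.≤ η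

record ℝ : Set where
  constructor mkℝ
  field
    seq    : ℕ → ℚ
    cauchy : IsCauchy seq

open ℝ public

infix  4 _≤ᴿ_ _<ᴿ_
infixl 6 _+ᴿ_ _-ᴿ_
infixl 7 _*ᴿ_ _/ᴿ_

_≤ᴿ_ : ℝ → ℝ → Set
x ≤ᴿ y = ∀ η → 0ℚ ℚ.< η →
  ∃ λ N → ∀ n → N ℕ.≤ n → seq x n ℚ.≤ seq y n ℚ.+ η

_<ᴿ_ : ℝ → ℝ → Set
x <ᴿ y = ∃ λ η → 0ℚ ℚ.< η ×
  ∃ λ N → ∀ n → N ℕ.≤ n → seq x n ℚ.+ η ℚ.≤ seq y n

half-pos : ∀ {η} → 0ℚ ℚ.< η → 0ℚ ℚ.< ½ ℚ.* η
half-pos {η} η>0 = ℚₚ.positive⁻¹ (½ ℚ.* η) {{ℚₚ.pos*pos⇒pos ½ η {{ℚ.positive η>0}}}}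

halves : ∀ η → ½ ℚ.* η ℚ.+ ½ ℚ.* η ≡ η
halves η = trans (sym (ℚₚ.*-distribʳ-+ η ½ ½)) (ℚₚ.*-identityˡ η)

-- |a| ≤ B, |d| ≤ B, |b - d| ≤ θ and |a - c| ≤ θ give |ab - cd| ≤ Bθ + Bθ.
product-bound : ∀ a b c d B θ .{{_ : ℚ.NonNegative B}} .{{_ : ℚ.NonNegative θ}} →
  ℚ.∣ a ∣ ℚ.≤ B → ℚ.∣ d ∣ ℚ.≤ B → ℚ.∣ b ℚ.- d ∣ ℚ.≤ θ → ℚ.∣ a ℚ.- c ∣ ℚ.≤ θ →
  ℚ.∣ a ℚ.* b ℚ.- c ℚ.* d ∣ ℚ.≤ B ℚ.* θ ℚ.+ B ℚ.* θ
product-bound a b c d B θ a≤B d≤B bd ac = begin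
  ℚ.∣ a ℚ.* b ℚ.- c ℚ.* d ∣
    ≡⟨ cong ℚ.∣_∣ (solve 4 (λ a b c d → a :* b :- c :* d := a :* (b :- d) :+ d :* (a :- c)) refl a b c d) ⟩
  ℚ.∣ a ℚ.* (b ℚ.- d) ℚ.+ d ℚ.* (a ℚ.- c) ∣
    ≤⟨ ℚₚ.∣p+q∣≤∣p∣+∣q∣ (a ℚ.* (b ℚ.- d)) (d ℚ.* (a ℚ.- c)) ⟩
  ℚ.∣ a ℚ.* (b ℚ.- d) ∣ ℚ.+ ℚ.∣ d ℚ.* (a ℚ.- c) ∣
    ≤⟨ ℚₚ.+-mono-≤ (mul a (b ℚ.- d) a≤B bd) (mul d (a ℚ.- c) d≤B ac) ⟩
  B ℚ.* θ ℚ.+ B ℚ.* θ ∎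
  where
  open ℚₚ.≤-Reasoning
  open +-*-Solver
  mul : ∀ u v → ℚ.∣ u ∣ ℚ.≤ B → ℚ.∣ v ∣ ℚ.≤ θ → ℚ.∣ u ℚ.* v ∣ ℚ.≤ B ℚ.* θ
  mul u v u≤ v≤ = begin
    ℚ.∣ u ℚ.* v ∣          ≡⟨ ℚₚ.∣p*q∣≡∣p∣*∣q∣ u v ⟩
    ℚ.∣ u ∣ ℚ.* ℚ.∣ v ∣    ≤⟨ ℚₚ.*-monoˡ-≤-nonNeg ℚ.∣ u ∣ {{ℚ.nonNegative (ℚₚ.0≤∣p∣ u)}} v≤ ⟩
    ℚ.∣ u ∣ ℚ.* θ          ≤⟨ ℚₚ.*-monoʳ-≤-nonNeg θ u≤ ⟩
    B ℚ.* θ                ∎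

eventually-bounded : (x : ℝ) →
  ∃ λ N → ∀ n → N ℕ.≤ n → ℚ.∣ seq x n ∣ ℚ.≤ ℚ.∣ seq x N ∣ ℚ.+ 1ℚ
eventually-bounded x with cauchy x 1ℚ (ℚₚ.positive⁻¹ 1ℚ)
... | N , close = N , λ n N≤n → begin
  ℚ.∣ seq x n ∣
    ≡⟨ cong ℚ.∣_∣ (solve 2 (λ a b → a := b :+ (a :- b)) refl (seq x n) (seq x N)) ⟩
  ℚ.∣ seq x N ℚ.+ (seq x n ℚ.- seq x N) ∣
    ≤⟨ ℚₚ.∣p+q∣≤∣p∣+∣q∣ (seq x N) (seq x n ℚ.- seq x N) ⟩
  ℚ.∣ seq x N ∣ ℚ.+ ℚ.∣ seq x n ℚ.- seq x N ∣
    ≤⟨ ℚₚ.+-monoʳ-≤ ℚ.∣ seq x N ∣ (close n N N≤n ℕₚ.≤-refl) ⟩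
  ℚ.∣ seq x N ∣ ℚ.+ 1ℚ ∎
  where
  open ℚₚ.≤-Reasoning
  open +-*-Solver

fromℚ : ℚ → ℝ
fromℚ q = mkℝ (λ _ → q) λ η η>0 → 0 , λ _ _ _ _ →
  subst (λ d → ℚ.∣ d ∣ ℚ.≤ η) (sym (ℚₚ.+-inverseʳ q)) (ℚₚ.<⇒≤ η>0)

fromℕ : ℕ → ℝ
fromℕ n = fromℚ (+ n ℚ./ 1)

0ᴿ 1ᴿ : ℝ
0ᴿ = fromℚ 0ℚ
1ᴿ = fromℚ 1ℚ

-ᴿ_ : ℝ → ℝ
-ᴿ x = mkℝ (λ n → ℚ.- seq x n) λ η η>0 →
  let N , close = cauchy x η η>0 in
  N , λ m n N≤m N≤n → subst (ℚ._≤ η)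
    (trans (sym (ℚₚ.∣-p∣≡∣p∣ (seq x m ℚ.- seq x n)))
           (cong ℚ.∣_∣ (ℚₚ.neg-distrib-+ (seq x m) (ℚ.- seq x n))))
    (close m n N≤m N≤n)

_+ᴿ_ : ℝ → ℝ → ℝ
x +ᴿ y = mkℝ (λ n → seq x n ℚ.+ seq y n) λ η η>0 →
  let N₁ , close₁ = cauchy x (½ ℚ.* η) (half-pos η>0)
      N₂ , close₂ = cauchy y (½ ℚ.* η) (half-pos η>0)
  in N₁ ℕ.⊔ N₂ , λ m n N≤m N≤n → begin
    ℚ.∣ (seq x m ℚ.+ seq y m) ℚ.- (seq x n ℚ.+ seq y n) ∣
      ≡⟨ cong ℚ.∣_∣ (solve 4 (λ a b c d → (a :+ b) :- (c :+ d) := (a :- c) :+ (b :- d)) refl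
           (seq x m) (seq y m) (seq x n) (seq y n)) ⟩
    ℚ.∣ (seq x m ℚ.- seq x n) ℚ.+ (seq y m ℚ.- seq y n) ∣
      ≤⟨ ℚₚ.∣p+q∣≤∣p∣+∣q∣ (seq x m ℚ.- seq x n) (seq y m ℚ.- seq y n) ⟩
    ℚ.∣ seq x m ℚ.- seq x n ∣ ℚ.+ ℚ.∣ seq y m ℚ.- seq y n ∣
      ≤⟨ ℚₚ.+-mono-≤
           (close₁ m n (ℕₚ.m⊔n≤o⇒m≤o N₁ N₂ N≤m) (ℕₚ.m⊔n≤o⇒m≤o N₁ N₂ N≤n))
           (close₂ m n (ℕₚ.m⊔n≤o⇒n≤o N₁ N₂ N≤m) (ℕₚ.m⊔n≤o⇒n≤o N₁ N₂ N≤n)) ⟩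
    ½ ℚ.* η ℚ.+ ½ ℚ.* η
      ≡⟨ halves η ⟩
    η ∎
  where
  open ℚₚ.≤-Reasoning
  open +-*-Solver

_-ᴿ_ : ℝ → ℝ → ℝ
x -ᴿ y = x +ᴿ (-ᴿ y)

*-cauchy : (x y : ℝ) → IsCauchy (λ n → seq x n ℚ.* seq y n)
*-cauchy x y η η>0 = N , λ m n N≤m N≤n → begin
  ℚ.∣ seq x m ℚ.* seq y m ℚ.- seq x n ℚ.* seq y n ∣
    ≤⟨ product-bound (seq x m) (seq y m) (seq x n) (seq y n) B θ
         (ℚₚ.≤-trans (bound₁ m (≤₁ N≤m)) x≤B) (ℚₚ.≤-trans (bound₂ n (≤₂ N≤n)) y≤B)
         (close₂ m n (≤₄ N≤m) (≤₄ N≤n)) (close₁ m n (≤₃ N≤m) (≤₃ N≤n)) ⟩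
  B ℚ.* θ ℚ.+ B ℚ.* θ
    ≡⟨ cong₂ ℚ._+_ Bθ Bθ ⟩
  ½ ℚ.* η ℚ.+ ½ ℚ.* η
    ≡⟨ halves η ⟩
  η ∎
  where
  open ℚₚ.≤-Reasoning
  K₁ = proj₁ (eventually-bounded x)
  K₂ = proj₁ (eventually-bounded y)
  bound₁ = proj₂ (eventually-bounded x)
  bound₂ = proj₂ (eventually-bounded y)
  bx = ℚ.∣ seq x K₁ ∣ ℚ.+ 1ℚ
  by = ℚ.∣ seq y K₂ ∣ ℚ.+ 1ℚ
  instance
    bx>0 : ℚ.Positive bx
    bx>0 = ℚₚ.nonNeg+pos⇒pos ℚ.∣ seq x K₁ ∣ {{ℚ.nonNegative (ℚₚ.0≤∣p∣ (seq x K₁))}} 1ℚ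
    by>0 : ℚ.Positive by
    by>0 = ℚₚ.nonNeg+pos⇒pos ℚ.∣ seq y K₂ ∣ {{ℚ.nonNegative (ℚₚ.0≤∣p∣ (seq y K₂))}} 1ℚ
  B = bx ℚ.+ by
  x≤B : bx ℚ.≤ B
  x≤B = subst (ℚ._≤ B) (ℚₚ.+-identityʳ bx) (ℚₚ.+-monoʳ-≤ bx (ℚₚ.<⇒≤ (ℚₚ.positive⁻¹ by)))
  y≤B : by ℚ.≤ B
  y≤B = subst (ℚ._≤ B) (ℚₚ.+-identityˡ by) (ℚₚ.+-monoˡ-≤ by (ℚₚ.<⇒≤ (ℚₚ.positive⁻¹ bx)))
  instance
    B>0 : ℚ.Positive B
    B>0 = ℚₚ.pos+pos⇒pos bx by
    B≢0 : ℚ.NonZero B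
    B≢0 = ℚₚ.pos⇒nonZero B
    B≥0 : ℚ.NonNegative B
    B≥0 = ℚₚ.pos⇒nonNeg B
    B⁻¹>0 : ℚ.Positive (ℚ.1/ B)
    B⁻¹>0 = ℚₚ.1/pos⇒pos B
    ½η>0 : ℚ.Positive (½ ℚ.* η)
    ½η>0 = ℚ.positive (half-pos η>0)
  θ = ℚ.1/ B ℚ.* (½ ℚ.* η)
  instance
    θ>0 : ℚ.Positive θ
    θ>0 = ℚₚ.pos*pos⇒pos (ℚ.1/ B) (½ ℚ.* η)
    θ≥0 : ℚ.NonNegative θ
    θ≥0 = ℚₚ.pos⇒nonNeg θ
  Bθ : B ℚ.* θ ≡ ½ ℚ.* η
  Bθ = trans (sym (ℚₚ.*-assoc B (ℚ.1/ B) (½ ℚ.* η)))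
             (trans (cong (ℚ._* (½ ℚ.* η)) (ℚₚ.*-inverseʳ B)) (ℚₚ.*-identityˡ (½ ℚ.* η)))
  K₃ = proj₁ (cauchy x θ (ℚₚ.positive⁻¹ θ))
  K₄ = proj₁ (cauchy y θ (ℚₚ.positive⁻¹ θ))
  close₁ = proj₂ (cauchy x θ (ℚₚ.positive⁻¹ θ))
  close₂ = proj₂ (cauchy y θ (ℚₚ.positive⁻¹ θ))
  N = (K₁ ℕ.⊔ K₂) ℕ.⊔ (K₃ ℕ.⊔ K₄)
  ≤₁ : ∀ {n} → N ℕ.≤ n → K₁ ℕ.≤ n
  ≤₁ = ℕₚ.m⊔n≤o⇒m≤o K₁ K₂ ∘ ℕₚ.m⊔n≤o⇒m≤o (K₁ ℕ.⊔ K₂) (K₃ ℕ.⊔ K₄)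
  ≤₂ : ∀ {n} → N ℕ.≤ n → K₂ ℕ.≤ n
  ≤₂ = ℕₚ.m⊔n≤o⇒n≤o K₁ K₂ ∘ ℕₚ.m⊔n≤o⇒m≤o (K₁ ℕ.⊔ K₂) (K₃ ℕ.⊔ K₄)
  ≤₃ : ∀ {n} → N ℕ.≤ n → K₃ ℕ.≤ n
  ≤₃ = ℕₚ.m⊔n≤o⇒m≤o K₃ K₄ ∘ ℕₚ.m⊔n≤o⇒n≤o (K₁ ℕ.⊔ K₂) (K₃ ℕ.⊔ K₄)
  ≤₄ : ∀ {n} → N ℕ.≤ n → K₄ ℕ.≤ n
  ≤₄ = ℕₚ.m⊔n≤o⇒n≤o K₃ K₄ ∘ ℕₚ.m⊔n≤o⇒n≤o (K₁ ℕ.⊔ K₂) (K₃ ℕ.⊔ K₄)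

_*ᴿ_ : ℝ → ℝ → ℝ
x *ᴿ y = mkℝ (λ n → seq x n ℚ.* seq y n) (*-cauchy x y)

_/ᴿ_ : ℝ → (n : ℕ) .{{_ : NonZero n}} → ℝ
x /ᴿ n = x *ᴿ fromℚ (+ 1 ℚ./ n)

Σᴿ : {A : Set} → (A → ℝ) → List A → ℝ
Σᴿ f = foldr (λ a s → f a +ᴿ s) 0ᴿ

------------------------------------------------------------------------
-- Families of subsets of [n] = Fin n

-- Every subset of Fin N, once each.
subsets : ∀ N → List (Subset N)
subsets zero    = [] ∷ []
subsets (suc N) = map (inside ∷_) (subsets N) ++ map (outside ∷_) (subsets N)

-- A family is a set of indices, where A ⊆ [n] has as index the image of its
-- characteristic function under the library's bijection
-- (Fin n → Fin 2) ≅ Fin (2 ^ n).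
Family : ℕ → Set
Family n = Subset (2 ℕ.^ n)

index : ∀ {n} → Subset n → Fin (2 ℕ.^ n)
index A = funToFin (Inverse.from 2↔Bool ∘ lookup A)

infix 4 _∈ᶠ_

_∈ᶠ_ : ∀ {n} → Subset n → Family n → Set
A ∈ᶠ 𝒜 = index A ∈ 𝒜

IsAntichain : ∀ n → Family n → Set
IsAntichain n 𝒜 = ∀ (A B : Subset n) → A ∈ᶠ 𝒜 → B ∈ᶠ 𝒜 → A ⊆ B → A ≡ B

allSubsets? : ∀ {n} {P : Subset n → Set} → (∀ A → Dec (P A)) → Dec (∀ A → P A)
allSubsets? P? with anySubset? (λ A → ¬? (P? A))
... | yes (A , ¬PA) = no λ all → ¬PA (all A)
... | no ¬∃         = yes λ A → decidable-stable (P? A) λ ¬PA → ¬∃ (A , ¬PA)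

isAntichain? : ∀ n (𝒜 : Family n) → Dec (IsAntichain n 𝒜)
isAntichain? n 𝒜 = allSubsets? {n} λ A → allSubsets? λ B →
  (index A ∈? 𝒜) →-dec ((index B ∈? 𝒜) →-dec
    ((A ⊆? B) →-dec Vecₚ.≡-dec Boolₚ._≟_ A B))

-- The base value 0 never matters, the empty family being an antichain.
largestAntichain : ∀ n → Family n → ℕ
largestAntichain n ℱ =
  max 0 (map ∣_∣ (filter (λ 𝒜 → isAntichain? n 𝒜 ×-dec 𝒜 ⊆? ℱ) (subsets (2 ℕ.^ n))))

------------------------------------------------------------------------
-- The binomial random subset

-- Probability that the random subset of Fin N, containing each element
-- independently with probability p, equals S.
mass : ∀ {N} → ℝ → Subset N → ℝ
mass p = Vec.foldr (λ _ → ℝ) (λ b r → (if b then p else 1ᴿ -ᴿ p) *ᴿ r) 1ᴿ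

Pr : ∀ {N} → ℝ → (Subset N → Bool) → ℝ
Pr {N} p D = Σᴿ (mass p) (filterᵇ D (subsets N))

-- "E has probability at least q".  Membership in E may be undecidable, as it
-- can involve comparing reals, so E is approximated from inside by decidable
-- events.  When E itself is decidable this says exactly that its probability
-- is ≥ q, since Pr is monotone for p in [0,1].
ProbAtLeast : ∀ {N} → ℝ → (Subset N → Set) → ℝ → Set
ProbAtLeast {N} p E q =
  ∃ λ (D : Subset N → Bool) → (∀ S → D S ≡ true → E S) × q ≤ᴿ Pr p D

-- With high probability, the random family 𝒫(n, p n) satisfies E n.
WithHighProbability : (ℕ → ℝ) → (∀ n → Family n → Set) → Set
WithHighProbability p E =
  ∀ δ → 0ᴿ <ᴿ δ → ∃ λ N → ∀ n → N ℕ.≤ n → ProbAtLeast (p n) (E n) (1ᴿ -ᴿ δ)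

-- "p(n) > C/n" is an assumption for all large n: demanded at every n ≥ 1 it
-- would contradict p ≤ 1 as soon as C ≥ 1.
EventuallyAbove : ℝ → (ℕ → ℝ) → Set
EventuallyAbove C p =
  ∃ λ n₀ → ∀ n .{{_ : NonZero n}} → n₀ ℕ.≤ n → C /ᴿ n <ᴿ p n

{-# OPTIONS --safe #-}

-- If w(ℱ) is the largest size of an antichain in ℱ, then (1 + μ) ^ w(ℱ) is at most the
-- sum of μ ^ |I| over the antichains I ⊆ ℱ.  For random ℱ the expectation of this sum is
-- Z(μp), where Z(λ) is the sum of λ ^ |I| over all antichains I of P(n), so by Markov's
-- inequality it suffices to bound Z(λ) by about exp(λ(1 + ε′)m) when λn is large.
-- Write Z(B) for the sum over the antichains in B.  If v ∈ B is comparable to the d other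
-- members of N(v) in B, then Z(B) ≤ Z(B - v) + λ Z(B - v - N(v)); when δ²λd ≥ 1, the
-- first term dominates so much that v costs a factor of only 1 + λδ instead of 1 + λ.
-- Large degrees come from a random maximal chain: if it meets B in X sets, then it
-- contains X - r pairs of them at distance at least r.  If all degrees in B are small
-- compared to n ^ r, this forces E X ≤ r(1 + o(1)), whence |B| ≤ r(1 + o(1))m.
-- The case r = 1 is used for |B| between (1 + ε′)m and 7m, and r = 3 beyond.
module Submission where

open import Defs
open import Data.Nat using (ℕ; ⌊_/2⌋)
open import Data.Nat.Combinatorics using (_C_)
open import Data.Product using (∃; _×_)

-- The last regime is forced by small `p`. When `p` is of order `1 / n`, so is `λ`, and degrees of
-- order `n` give only a constant saving `δ`. That is enough for the sets up to `7 m`. But the whole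
-- cube is bounded here by `(n + 1) m` sets, so each of the remaining ones may cost no more than a
-- factor `1 + O(λ / n)`. By the condition `δ² λ d ≥ 1` this takes degrees of order `n ^ 3`, hence
-- pairs at distance 3. The parameter `μ = 1 / J` is a compromise: `log (1 + μ)` falls short of `μ`
-- by a relative error of order `μ`, so `μ` must be small compared to `ε`; but it must not depend on
-- `n`, since `λ n = μ p n` has to be large. No exponential function occurs. The bounds are powers
-- of a single base `1 + 1 / T` with natural exponents, compared by Bernoulli's inequality in both
-- directions, so that the main estimates become inequalities between natural numbers. For the same
-- reason the real number `p` is enclosed by an integer `u` with `u ≤ n p ≤ u + 2`.

module Combinatorics where

  open import Data.Bool using (Bool)
  open import Data.Fin using (Fin; zero; suc; toℕ)
  import Data.Fin as Fin
  open import Data.Fin.Properties using (any?; toℕ<n; toℕ-injective)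
  open import Data.Fin.Subset using (Subset; inside; outside; ∣_∣; _⊆_; _∩_; ∁)
  open import Data.Fin.Subset.Properties
  open import Data.Nat
  open import Data.Nat.Combinatorics
  open import Data.Nat.DivMod using (m/n*n≡m)
  open import Data.Nat.Properties
  open import Data.Nat.Solver using (module +-*-Solver)
  open import Data.Product using (∃; _×_; _,_; proj₁; proj₂)
  open import Data.Sum as Sum using (_⊎_; inj₁; inj₂)
  open import Data.Unit using (⊤; tt)
  open import Data.Vec using ([]; _∷_; here)
  open import Function using (_∘_)
  open import Relation.Binary.PropositionalEquality hiding (J)
  open import Relation.Nullary using (Dec; yes; no; ¬_; contradiction)
  open import Relation.Nullary.Decidable using (_×-dec_; _⊎-dec_; ¬?)
  open import Algebra.Properties.Semiring.Sum +-*-semiring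
    using (sum; sum-cong-≗; ∑-distrib-+; ∑-comm; *-distribˡ-sum; *-distribʳ-sum)

  -- Counting in finite types by sums of indicators.

  𝟙 : {P : Set} → Dec P → ℕ
  𝟙 (yes _) = 1
  𝟙 (no _)  = 0

  𝟙-mono : {P Q : Set} → (P → Q) → (P? : Dec P) (Q? : Dec Q) → 𝟙 P? ≤ 𝟙 Q?
  𝟙-mono f (no _)  Q?      = z≤n
  𝟙-mono f (yes p) (yes _) = ≤-refl
  𝟙-mono f (yes p) (no ¬q) = contradiction (f p) ¬q

  𝟙-× : {P Q : Set} (P? : Dec P) (Q? : Dec Q) → 𝟙 (P? ×-dec Q?) ≡ 𝟙 P? * 𝟙 Q?
  𝟙-× (yes _) (yes _) = refl
  𝟙-× (yes _) (no _)  = refl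
  𝟙-× (no _)  _       = refl

  𝟙-true : {P : Set} → P → (P? : Dec P) → 𝟙 P? ≡ 1
  𝟙-true p (yes _) = refl
  𝟙-true p (no ¬p) = contradiction p ¬p

  𝟙-false : {P : Set} → ¬ P → (P? : Dec P) → 𝟙 P? ≡ 0
  𝟙-false ¬p (yes p) = contradiction p ¬p
  𝟙-false ¬p (no _)  = refl

  𝟙-cover : {P Q R : Set} → (P → Q ⊎ R) → (P? : Dec P) (Q? : Dec Q) (R? : Dec R) → 𝟙 P? ≤ 𝟙 Q? + 𝟙 R?
  𝟙-cover f (no _)  _       _  = z≤n
  𝟙-cover f (yes p) Q? R? with f p
  ... | inj₁ q = ≤-trans (≤-reflexive (sym (𝟙-true q Q?))) (m≤m+n _ _)
  ... | inj₂ r = ≤-trans (≤-reflexive (sym (𝟙-true r R?))) (m≤n+m _ _)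

  sum-mono : ∀ {N} {f g : Fin N → ℕ} → (∀ i → f i ≤ g i) → sum f ≤ sum g
  sum-mono {zero}  f≤g = z≤n
  sum-mono {suc N} f≤g = +-mono-≤ (f≤g zero) (sum-mono (f≤g ∘ suc))

  term≤sum : ∀ {N} (f : Fin N → ℕ) i → f i ≤ sum f
  term≤sum f zero    = m≤m+n _ _
  term≤sum f (suc i) = ≤-trans (term≤sum (f ∘ suc) i) (m≤n+m _ _)

  sum-zero : ∀ {N} (f : Fin N → ℕ) → (∀ i → f i ≡ 0) → sum f ≡ 0
  sum-zero {zero}  f f≡0 = refl
  sum-zero {suc N} f f≡0 = cong₂ _+_ (f≡0 zero) (sum-zero (f ∘ suc) (f≡0 ∘ suc))

  count-unique : ∀ {N} {P : Fin N → Set} (P? : ∀ i → Dec (P i)) →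
    (∀ i j → P i → P j → i ≡ j) → sum (𝟙 ∘ P?) ≤ 1
  count-unique {zero}  P? u = z≤n
  count-unique {suc N} P? u with P? zero
  ... | yes p = ≤-reflexive (cong suc (sum-zero _ λ i → 𝟙-false (λ q → case (u zero (suc i) p q)) (P? (suc i))))
    where
    case : ∀ {i : Fin N} → zero ≡ suc i → _
    case ()
  ... | no _ = count-unique (P? ∘ suc) λ i j p q → suc-inj (u (suc i) (suc j) p q)
    where
    suc-inj : ∀ {i j : Fin N} → Fin.suc i ≡ suc j → i ≡ j
    suc-inj refl = refl

  Window : ℕ → ℕ → ℕ → Set
  Window a r k = a ≤ k × k < a + r

  window? : ∀ a r k → Dec (Window a r k)
  window? a r k = a ≤? k ×-dec k <? a + r

  window-split : ∀ a r {k} → Window a (suc r) k → k ≡ a ⊎ Window (suc a) r k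
  window-split a r {k} (a≤k , k<) with a ≟ k
  ... | yes a≡k = inj₁ (sym a≡k)
  ... | no  a≢k = inj₂ (≤∧≢⇒< a≤k a≢k , subst (k <_) (+-suc a r) k<)

  -- Each of the `r` values in the window is taken at most once. It is applied both to the sizes of
  -- sets on a chain and to the steps at which an element may enter one.
  count-window : ∀ {N} {P : Fin N → Set} (P? : ∀ i → Dec (P i)) (f : Fin N → ℕ) →
    (∀ i j → P i → P j → f i ≡ f j → i ≡ j) →
    ∀ a r → sum (λ i → 𝟙 (P? i ×-dec window? a r (f i))) ≤ r
  count-window P? f u a zero = ≤-reflexive (sum-zero _ λ i →
    𝟙-false (λ (_ , a≤ , <a) → <⇒≱ (subst (f i <_) (+-identityʳ a) <a) a≤) (P? i ×-dec window? a 0 (f i)))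
  count-window P? f u a (suc r) = begin
    sum (λ i → 𝟙 (P? i ×-dec window? a (suc r) (f i)))
      ≤⟨ sum-mono (λ i → 𝟙-cover (λ (p , w) → Sum.map (p ,_) (p ,_) (window-split a r w))
           (P? i ×-dec window? a (suc r) (f i)) (P? i ×-dec f i ≟ a) (P? i ×-dec window? (suc a) r (f i))) ⟩
    sum (λ i → 𝟙 (P? i ×-dec f i ≟ a) + 𝟙 (P? i ×-dec window? (suc a) r (f i)))
      ≡⟨ ∑-distrib-+ (λ i → 𝟙 (P? i ×-dec f i ≟ a)) _ ⟩
    sum (λ i → 𝟙 (P? i ×-dec f i ≟ a)) + sum (λ i → 𝟙 (P? i ×-dec window? (suc a) r (f i)))
      ≤⟨ +-mono-≤ (count-unique (λ i → P? i ×-dec f i ≟ a) (λ i j (p , e) (q , e′) → u i j p q (trans e (sym e′))))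
                  (count-window P? f u (suc a) r) ⟩
    suc r ∎
    where
    open ≤-Reasoning

  count-interval : ∀ {N} a r → a + r ≤ N → r ≤ sum {N} (λ i → 𝟙 (window? a r (toℕ i)))
  count-interval a zero _ = z≤n
  count-interval {suc N} zero (suc r) (s≤s r≤) =
    s≤s (≤-trans (count-interval 0 r r≤) (sum-mono {N} λ i →
      𝟙-mono (λ (_ , lt) → z≤n , s≤s lt) (window? 0 r (toℕ i)) (window? 0 (suc r) (suc (toℕ i)))))
  count-interval {suc N} (suc a) r (s≤s a+r≤) =
    ≤-trans (count-interval a r a+r≤) (≤-trans (sum-mono {N} λ i →
      𝟙-mono (λ (le , lt) → s≤s le , s≤s lt) (window? a r (toℕ i)) (window? (suc a) r (suc (toℕ i))))
      (m≤n+m _ _))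

  -- Maximal chains, and how many of them pass through given sets.

  -- A maximal chain of P(n+1) restricts to a maximal chain of P(n); the extra datum
  -- is the number of steps taken before the new element enters.
  Chain : ℕ → Set
  Chain zero    = ⊤
  Chain (suc n) = Chain n × Fin (suc n)

  infix 4 _∋_ _∋?_

  -- In `(c , i)` the new element enters when the restricted chain `c` has reached size `i`. The
  -- member of `c` of that size occurs twice, without and with the new element, which is why both
  -- inequalities are weak.
  _∋_ : ∀ {n} → Chain n → Subset n → Set
  _∋_ {zero}  _       _             = ⊤
  _∋_ {suc n} (c , i) (outside ∷ x) = c ∋ x × ∣ x ∣ ≤ toℕ i
  _∋_ {suc n} (c , i) (inside  ∷ x) = c ∋ x × toℕ i ≤ ∣ x ∣

  _∋?_ : ∀ {n} (c : Chain n) x → Dec (c ∋ x)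
  _∋?_ {zero}  _       _             = yes tt
  _∋?_ {suc n} (c , i) (outside ∷ x) = c ∋? x ×-dec ∣ x ∣ ≤? toℕ i
  _∋?_ {suc n} (c , i) (inside  ∷ x) = c ∋? x ×-dec toℕ i ≤? ∣ x ∣

  -- If only `y` has the first element, the entry step `i` lies between the sizes of the tails,
  -- which recovers the comparison lost by dropping that element. If only `x` has it, the entry step
  -- contradicts the comparison.
  ∋-ordered : ∀ {n} (c : Chain n) {x y} → c ∋ x → c ∋ y → ∣ x ∣ ≤ ∣ y ∣ → x ⊆ y
  ∋-ordered c {[]} {[]} _ _ _ ()
  ∋-ordered (c , i) {outside ∷ x} {outside ∷ y} (x∈ , _) (y∈ , _) le = out⊆ (∋-ordered c x∈ y∈ le)
  ∋-ordered (c , i) {outside ∷ x} {inside ∷ y} (x∈ , x≤i) (y∈ , i≤y) _ = out⊆ (∋-ordered c x∈ y∈ (≤-trans x≤i i≤y))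
  ∋-ordered (c , i) {inside ∷ x} {outside ∷ y} (x∈ , i≤x) (y∈ , y≤i) le =
    contradiction (≤-trans le (≤-trans y≤i i≤x)) 1+n≰n
  ∋-ordered (c , i) {inside ∷ x} {inside ∷ y} (x∈ , _) (y∈ , _) (s≤s le) = s⊆s (∋-ordered c x∈ y∈ le)

  ∋-unique : ∀ {n} (c : Chain n) {x y} → c ∋ x → c ∋ y → ∣ x ∣ ≡ ∣ y ∣ → x ≡ y
  ∋-unique c x∈ y∈ e =
    ⊆-antisym (∋-ordered c x∈ y∈ (≤-reflexive e)) (∋-ordered c y∈ x∈ (≤-reflexive (sym e)))

  ∑ᶜ : ∀ n → (Chain n → ℕ) → ℕ
  ∑ᶜ zero    f = f tt
  ∑ᶜ (suc n) f = ∑ᶜ n λ c → sum λ i → f (c , i)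

  ∑ᶜ-mono : ∀ n {f g : Chain n → ℕ} → (∀ c → f c ≤ g c) → ∑ᶜ n f ≤ ∑ᶜ n g
  ∑ᶜ-mono zero    f≤g = f≤g tt
  ∑ᶜ-mono (suc n) f≤g = ∑ᶜ-mono n λ c → sum-mono λ i → f≤g (c , i)

  ∑ᶜ-cong : ∀ n {f g : Chain n → ℕ} → (∀ c → f c ≡ g c) → ∑ᶜ n f ≡ ∑ᶜ n g
  ∑ᶜ-cong zero    f≡g = f≡g tt
  ∑ᶜ-cong (suc n) {f} {g} f≡g = ∑ᶜ-cong n λ c →
    sum-cong-≗ {suc n} {λ i → f (c , i)} {λ i → g (c , i)} λ i → f≡g (c , i)

  ∑ᶜ-+ : ∀ n (f g : Chain n → ℕ) → ∑ᶜ n (λ c → f c + g c) ≡ ∑ᶜ n f + ∑ᶜ n g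
  ∑ᶜ-+ zero    f g = refl
  ∑ᶜ-+ (suc n) f g = trans (∑ᶜ-cong n λ c → ∑-distrib-+ (λ i → f (c , i)) (λ i → g (c , i))) (∑ᶜ-+ n _ _)

  ∑ᶜ-*ˡ : ∀ n k (f : Chain n → ℕ) → ∑ᶜ n (λ c → k * f c) ≡ k * ∑ᶜ n f
  ∑ᶜ-*ˡ zero    k f = refl
  ∑ᶜ-*ˡ (suc n) k f = trans (∑ᶜ-cong n λ c → sym (*-distribˡ-sum k (λ i → f (c , i)))) (∑ᶜ-*ˡ n k _)

  ∑ᶜ-*ʳ : ∀ n k (f : Chain n → ℕ) → ∑ᶜ n (λ c → f c * k) ≡ ∑ᶜ n f * k
  ∑ᶜ-*ʳ n k f = trans (∑ᶜ-cong n λ c → *-comm (f c) k) (trans (∑ᶜ-*ˡ n k f) (*-comm k _))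

  ∑ᶜ-zero : ∀ n → ∑ᶜ n (λ _ → 0) ≡ 0
  ∑ᶜ-zero n = ∑ᶜ-*ˡ n 0 (λ _ → 0)

  ∑ᶜ-sum : ∀ n {N} (f : Fin N → Chain n → ℕ) → ∑ᶜ n (λ c → sum (λ i → f i c)) ≡ sum (λ i → ∑ᶜ n (f i))
  ∑ᶜ-sum n {zero}  f = ∑ᶜ-zero n
  ∑ᶜ-sum n {suc N} f = trans (∑ᶜ-+ n _ _) (cong (∑ᶜ n (f zero) +_) (∑ᶜ-sum n (f ∘ suc)))

  sum-one : ∀ n → sum {n} (λ _ → 1) ≡ n
  sum-one zero    = refl
  sum-one (suc n) = cong suc (sum-one n)

  ∑ᶜ-one : ∀ n → ∑ᶜ n (λ _ → 1) ≡ n !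
  ∑ᶜ-one zero    = refl
  ∑ᶜ-one (suc n) = begin
    ∑ᶜ n (λ _ → 1 + sum {n} (λ _ → 1)) ≡⟨ ∑ᶜ-cong n (λ _ → trans (cong suc (sum-one n)) (sym (*-identityʳ (suc n)))) ⟩
    ∑ᶜ n (λ _ → suc n * 1)             ≡⟨ ∑ᶜ-*ˡ n (suc n) _ ⟩
    suc n * ∑ᶜ n (λ _ → 1)             ≡⟨ cong (suc n *_) (∑ᶜ-one n) ⟩
    suc n * n !                        ∎
    where
    open ≡-Reasoning

  ∑ᶜ-const : ∀ n k → ∑ᶜ n (λ _ → k) ≡ k * n !
  ∑ᶜ-const n k = begin
    ∑ᶜ n (λ _ → k)     ≡⟨ ∑ᶜ-cong n (λ _ → sym (*-identityʳ k)) ⟩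
    ∑ᶜ n (λ _ → k * 1) ≡⟨ ∑ᶜ-*ˡ n k _ ⟩
    k * ∑ᶜ n (λ _ → 1) ≡⟨ cong (k *_) (∑ᶜ-one n) ⟩
    k * n !            ∎
    where
    open ≡-Reasoning

  ∣p∣+∣∁p∣ : ∀ {n} (p : Subset n) → ∣ p ∣ + ∣ ∁ p ∣ ≡ n
  ∣p∣+∣∁p∣ []            = refl
  ∣p∣+∣∁p∣ (inside  ∷ p) = cong suc (∣p∣+∣∁p∣ p)
  ∣p∣+∣∁p∣ (outside ∷ p) = trans (+-suc ∣ p ∣ ∣ ∁ p ∣) (cong suc (∣p∣+∣∁p∣ p))

  ∣p∣+∣q∖p∣ : ∀ {n} {p q : Subset n} → p ⊆ q → ∣ p ∣ + ∣ q ∩ ∁ p ∣ ≡ ∣ q ∣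
  ∣p∣+∣q∖p∣ {p = []} {[]} _ = refl
  ∣p∣+∣q∖p∣ {p = outside ∷ p} {outside ∷ q} s = ∣p∣+∣q∖p∣ (drop-∷-⊆ s)
  ∣p∣+∣q∖p∣ {p = outside ∷ p} {inside  ∷ q} s = trans (+-suc ∣ p ∣ _) (cong suc (∣p∣+∣q∖p∣ (drop-∷-⊆ s)))
  ∣p∣+∣q∖p∣ {p = inside  ∷ p} {inside  ∷ q} s = cong suc (∣p∣+∣q∖p∣ (drop-∷-⊆ s))
  ∣p∣+∣q∖p∣ {p = inside  ∷ p} {outside ∷ q} s with s here
  ... | ()

  -- The number of maximal chains containing `x`: its elements are added first, in any order, and
  -- then the others. Likewise `through₂ x y` counts the chains containing both sets when `x ⊆ y`.
  through : ∀ {n} → Subset n → ℕ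
  through x = ∣ x ∣ ! * ∣ ∁ x ∣ !

  through₂ : ∀ {n} → Subset n → Subset n → ℕ
  through₂ x y = ∣ x ∣ ! * (∣ y ∩ ∁ x ∣ ! * ∣ ∁ y ∣ !)

  -- With `x` the tail, an element left out may enter at any of the `|∁ x| + 1` steps from `|x|` on,
  -- an included one at any of the `|x| + 1` steps up to `|x|`. These numbers are the new factors of
  -- the factorials.
  through≤ : ∀ {n} (x : Subset n) → through x ≤ ∑ᶜ n (λ c → 𝟙 (c ∋? x))
  through≤ [] = ≤-refl
  through≤ {suc n} (outside ∷ x) = begin
    ∣ x ∣ ! * (suc ∣ ∁ x ∣ * ∣ ∁ x ∣ !)
      ≡⟨ solve 3 (λ a b c → a :* (b :* c) := a :* c :* b) refl (∣ x ∣ !) (suc ∣ ∁ x ∣) (∣ ∁ x ∣ !) ⟩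
    through x * suc ∣ ∁ x ∣
      ≤⟨ *-mono-≤ (through≤ x) (≤-trans
           (count-interval ∣ x ∣ (suc ∣ ∁ x ∣) (≤-reflexive (trans (+-suc ∣ x ∣ _) (cong suc (∣p∣+∣∁p∣ x)))))
           (sum-mono {suc n} λ i → 𝟙-mono proj₁ (window? ∣ x ∣ (suc ∣ ∁ x ∣) (toℕ i)) (∣ x ∣ ≤? toℕ i))) ⟩
    ∑ᶜ n (λ c → 𝟙 (c ∋? x)) * sum {suc n} (λ i → 𝟙 (∣ x ∣ ≤? toℕ i))
      ≡⟨ ∑ᶜ-*ʳ n (sum {suc n} (λ i → 𝟙 (∣ x ∣ ≤? toℕ i))) (λ c → 𝟙 (c ∋? x)) ⟨
    ∑ᶜ n (λ c → 𝟙 (c ∋? x) * sum {suc n} (λ i → 𝟙 (∣ x ∣ ≤? toℕ i)))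
      ≡⟨ ∑ᶜ-cong n (λ c → trans (*-distribˡ-sum {suc n} (𝟙 (c ∋? x)) (λ i → 𝟙 (∣ x ∣ ≤? toℕ i)))
           (sum-cong-≗ {suc n} λ i → sym (𝟙-× (c ∋? x) (∣ x ∣ ≤? toℕ i)))) ⟩
    ∑ᶜ (suc n) (λ c → 𝟙 (c ∋? outside ∷ x)) ∎
    where
    open ≤-Reasoning
    open +-*-Solver
  through≤ {suc n} (inside ∷ x) = begin
    suc ∣ x ∣ * ∣ x ∣ ! * ∣ ∁ x ∣ !
      ≡⟨ solve 3 (λ a b c → a :* b :* c := b :* c :* a) refl (suc ∣ x ∣) (∣ x ∣ !) (∣ ∁ x ∣ !) ⟩
    through x * suc ∣ x ∣
      ≤⟨ *-mono-≤ (through≤ x) (≤-trans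
           (count-interval 0 (suc ∣ x ∣) (s≤s (∣p∣≤n x)))
           (sum-mono {suc n} λ i → 𝟙-mono (s≤s⁻¹ ∘ proj₂) (window? 0 (suc ∣ x ∣) (toℕ i)) (toℕ i ≤? ∣ x ∣))) ⟩
    ∑ᶜ n (λ c → 𝟙 (c ∋? x)) * sum {suc n} (λ i → 𝟙 (toℕ i ≤? ∣ x ∣))
      ≡⟨ ∑ᶜ-*ʳ n (sum {suc n} (λ i → 𝟙 (toℕ i ≤? ∣ x ∣))) (λ c → 𝟙 (c ∋? x)) ⟨
    ∑ᶜ n (λ c → 𝟙 (c ∋? x) * sum {suc n} (λ i → 𝟙 (toℕ i ≤? ∣ x ∣)))
      ≡⟨ ∑ᶜ-cong n (λ c → trans (*-distribˡ-sum {suc n} (𝟙 (c ∋? x)) (λ i → 𝟙 (toℕ i ≤? ∣ x ∣)))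
           (sum-cong-≗ {suc n} λ i → sym (𝟙-× (c ∋? x) (toℕ i ≤? ∣ x ∣)))) ⟩
    ∑ᶜ (suc n) (λ c → 𝟙 (c ∋? inside ∷ x)) ∎
    where
    open ≤-Reasoning
    open +-*-Solver

  -- Adding an element to both sets multiplies the number of chains by the length
  -- of the interval of steps at which it may enter.
  through₂-step : ∀ {n} (x y : Subset n) (b b′ : Bool) a r →
    ∑ᶜ n (λ c → 𝟙 (c ∋? x ×-dec c ∋? y)) ≤ through₂ x y →
    (∀ c i → (c , i) ∋ b ∷ x → (c , i) ∋ b′ ∷ y → (c ∋ x × c ∋ y) × Window a r (toℕ i)) →
    ∑ᶜ (suc n) (λ c → 𝟙 (c ∋? b ∷ x ×-dec c ∋? b′ ∷ y)) ≤ through₂ x y * r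
  through₂-step {n} x y b b′ a r ih split = begin
    ∑ᶜ (suc n) (λ c → 𝟙 (c ∋? b ∷ x ×-dec c ∋? b′ ∷ y))
      ≤⟨ ∑ᶜ-mono n (λ c → sum-mono {suc n} λ i → ≤-trans
           (𝟙-mono (λ (p , q) → split c i p q) ((c , i) ∋? b ∷ x ×-dec (c , i) ∋? b′ ∷ y)
             ((c ∋? x ×-dec c ∋? y) ×-dec window? a r (toℕ i)))
           (≤-reflexive (𝟙-× (c ∋? x ×-dec c ∋? y) (window? a r (toℕ i))))) ⟩
    ∑ᶜ n (λ c → sum {suc n} λ i → 𝟙 (c ∋? x ×-dec c ∋? y) * 𝟙 (window? a r (toℕ i)))
      ≡⟨ ∑ᶜ-cong n (λ c → *-distribˡ-sum {suc n} (𝟙 (c ∋? x ×-dec c ∋? y)) (λ i → 𝟙 (window? a r (toℕ i)))) ⟨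
    ∑ᶜ n (λ c → 𝟙 (c ∋? x ×-dec c ∋? y) * sum {suc n} λ i → 𝟙 (window? a r (toℕ i)))
      ≡⟨ ∑ᶜ-*ʳ n _ (λ c → 𝟙 (c ∋? x ×-dec c ∋? y)) ⟩
    ∑ᶜ n (λ c → 𝟙 (c ∋? x ×-dec c ∋? y)) * sum {suc n} (λ i → 𝟙 (window? a r (toℕ i)))
      ≤⟨ *-mono-≤ ih (≤-trans
           (sum-mono {suc n} λ i → 𝟙-mono (tt ,_) (window? a r (toℕ i)) (yes tt ×-dec window? a r (toℕ i)))
           (count-window {suc n} (λ _ → yes tt) toℕ (λ i j _ _ → toℕ-injective) a r)) ⟩
    through₂ x y * r ∎
    where
    open ≤-Reasoning

  -- A new element in neither set enters from step `|y|` on, one in the upper set alone between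
  -- steps `|x|` and `|y|`, one in both up to step `|x|`. The lengths of these intervals extend the
  -- third, second and first factorial.
  ≤through₂ : ∀ {n} {x y : Subset n} → x ⊆ y → ∑ᶜ n (λ c → 𝟙 (c ∋? x ×-dec c ∋? y)) ≤ through₂ x y
  ≤through₂ {x = []} {[]} _ = ≤-refl
  ≤through₂ {suc n} {outside ∷ x} {outside ∷ y} s = ≤-trans
    (through₂-step x y outside outside ∣ y ∣ (suc ∣ ∁ y ∣) (≤through₂ (drop-∷-⊆ s))
      λ c i (x∈ , _) (y∈ , y≤i) → (x∈ , y∈) , y≤i , <-≤-trans (toℕ<n i)
        (≤-reflexive (sym (trans (+-suc ∣ y ∣ _) (cong suc (∣p∣+∣∁p∣ y))))))
    (≤-reflexive (solve 4 (λ a b c d → a :* (b :* c) :* d := a :* (b :* (d :* c))) refl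
      (∣ x ∣ !) (∣ y ∩ ∁ x ∣ !) (∣ ∁ y ∣ !) (suc ∣ ∁ y ∣)))
    where
    open +-*-Solver
  ≤through₂ {suc n} {outside ∷ x} {inside ∷ y} s = ≤-trans
    (through₂-step x y outside inside ∣ x ∣ (suc ∣ y ∩ ∁ x ∣) (≤through₂ (drop-∷-⊆ s))
      λ c i (x∈ , x≤i) (y∈ , i≤y) → (x∈ , y∈) , x≤i , ≤-trans (s≤s i≤y)
        (≤-reflexive (sym (trans (+-suc ∣ x ∣ _) (cong suc (∣p∣+∣q∖p∣ (drop-∷-⊆ s)))))))
    (≤-reflexive (solve 4 (λ a b c d → a :* (b :* c) :* d := a :* (d :* b :* c)) refl
      (∣ x ∣ !) (∣ y ∩ ∁ x ∣ !) (∣ ∁ y ∣ !) (suc ∣ y ∩ ∁ x ∣)))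
    where
    open +-*-Solver
  ≤through₂ {suc n} {inside ∷ x} {inside ∷ y} s = ≤-trans
    (through₂-step x y inside inside 0 (suc ∣ x ∣) (≤through₂ (drop-∷-⊆ s))
      λ c i (x∈ , i≤x) (y∈ , _) → (x∈ , y∈) , z≤n , s≤s i≤x)
    (≤-reflexive (solve 4 (λ a b c d → a :* (b :* c) :* d := d :* a :* (b :* c)) refl
      (∣ x ∣ !) (∣ y ∩ ∁ x ∣ !) (∣ ∁ y ∣ !) (suc ∣ x ∣)))
    where
    open +-*-Solver
  ≤through₂ {x = inside ∷ x} {outside ∷ y} s with s here
  ... | ()

  -- Binomial coefficients

  C*factorials : ∀ k l → ((k + l) C k) * (k ! * l !) ≡ (k + l) !
  C*factorials k l = begin
    ((k + l) C k) * (k ! * l !)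
      ≡⟨ cong (λ j → ((k + l) C k) * (k ! * j !)) (m+n∸m≡n k l) ⟨
    ((k + l) C k) * (k ! * (k + l ∸ k) !)
      ≡⟨ cong (_* (k ! * (k + l ∸ k) !)) (nCk≡n!/k![n-k]! (m≤m+n k l)) ⟩
    (k + l) ! / (k ! * (k + l ∸ k) !) * (k ! * (k + l ∸ k) !)
      ≡⟨ m/n*n≡m (k![n∸k]!∣n! (m≤m+n k l)) ⟩
    (k + l) ! ∎
    where
    open ≡-Reasoning
    instance
      nz = k !* (k + l ∸ k) !≢0

  nC0≡1 : ∀ n → n C 0 ≡ 1
  nC0≡1 n = trans (nCk≡nC[n∸k] {0} {n} z≤n) (nCn≡1 n)

  nCk≥1 : ∀ n k → k ≤ n → 1 ≤ n C k
  nCk≥1 n zero _ = ≤-reflexive (sym (nC0≡1 n))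
  nCk≥1 (suc n) (suc k) (s≤s k≤n) = ≤-trans (nCk≥1 n k k≤n)
    (≤-trans (m≤m+n _ _) (≤-reflexive (nCk+nC[k+1]≡[n+1]C[k+1] n k)))

  C-mono-top : ∀ r {K L} → K ≤ L → K C r ≤ L C r
  C-mono-top r {K} K≤L = go (≤⇒≤′ K≤L)
    where
    step : ∀ r M → M C r ≤ suc M C r
    step zero    M = ≤-reflexive (trans (nC0≡1 M) (sym (nC0≡1 (suc M))))
    step (suc r) M = ≤-trans (m≤n+m _ (M C r)) (≤-reflexive (nCk+nC[k+1]≡[n+1]C[k+1] M r))
    go : ∀ {L} → K ≤′ L → K C r ≤ L C r
    go ≤′-refl       = ≤-refl
    go (≤′-step K≤L) = ≤-trans (go K≤L) (step r _)

  -- Pascal's rule on both sides reduces the claim to two instances one row up. The second of them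
  -- needs `j + r < K`; the boundary case `j + r ≡ K` is the symmetry of the row.
  C-unimodal : ∀ K r j → r ≤ j → j + r ≤ K → K C r ≤ K C j
  C-unimodal K r j r≤j j+r≤K with r ≟ j
  ... | yes refl = ≤-refl
  C-unimodal zero    zero    zero    _ _  | no r≢j = contradiction refl r≢j
  C-unimodal (suc K) zero    j       _ j≤ | no r≢j =
    ≤-trans (≤-reflexive (nC0≡1 (suc K))) (nCk≥1 (suc K) j (subst (_≤ suc K) (+-identityʳ j) j≤))
  C-unimodal (suc K) (suc r) (suc j) (s≤s r≤j) (s≤s j+r≤K) | no r≢j with suc j + suc r ≟ suc K
  ... | yes e = ≤-reflexive (trans (cong (suc K C_) (sym (trans (cong (_∸ suc j) (sym e)) (m+n∸m≡n (suc j) (suc r)))))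
    (sym (nCk≡nC[n∸k] (≤-trans (m≤m+n (suc j) (suc r)) (≤-reflexive e)))))
  ... | no e≢ = begin
    suc K C suc r         ≡⟨ nCk+nC[k+1]≡[n+1]C[k+1] K r ⟨
    (K C r) + (K C suc r) ≤⟨ +-mono-≤ (C-unimodal K r j r≤j (≤-trans (+-monoʳ-≤ j (n≤1+n r)) j+r≤K))
                               (C-unimodal K (suc r) (suc j) (s≤s r≤j) (s≤s⁻¹ (≤∧≢⇒< (s≤s j+r≤K) e≢))) ⟩
    (K C j) + (K C suc j) ≡⟨ nCk+nC[k+1]≡[n+1]C[k+1] K j ⟩
    suc K C suc j         ∎
    where
    open ≤-Reasoning

  ⌊n/2⌋+⌊n/2⌋≤n : ∀ n → ⌊ n /2⌋ + ⌊ n /2⌋ ≤ n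
  ⌊n/2⌋+⌊n/2⌋≤n n = ≤-trans (+-monoʳ-≤ ⌊ n /2⌋ (⌊n/2⌋≤⌈n/2⌉ n)) (≤-reflexive (⌊n/2⌋+⌈n/2⌉≡n n))

  C≤central-low : ∀ n k → k ≤ ⌊ n /2⌋ → n C k ≤ n C ⌊ n /2⌋
  C≤central-low n k k≤ = C-unimodal n k ⌊ n /2⌋ k≤ (≤-trans (+-monoʳ-≤ ⌊ n /2⌋ k≤) (⌊n/2⌋+⌊n/2⌋≤n n))

  low-or-high : ∀ k l → k ≤ ⌊ k + l /2⌋ ⊎ l ≤ ⌊ k + l /2⌋
  low-or-high zero    l       = inj₁ z≤n
  low-or-high (suc k) zero    = inj₂ z≤n
  low-or-high (suc k) (suc l) rewrite +-suc k l = Sum.map s≤s s≤s (low-or-high k l)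

  factorial≤central : ∀ k l → (k + l) ! ≤ ((k + l) C ⌊ k + l /2⌋) * (k ! * l !)
  factorial≤central k l with low-or-high k l
  ... | inj₁ k≤ = ≤-trans (≤-reflexive (sym (C*factorials k l))) (*-monoˡ-≤ (k ! * l !) (C≤central-low (k + l) k k≤))
  ... | inj₂ l≤ = ≤-trans (≤-reflexive (sym (C*factorials k l))) (*-monoˡ-≤ (k ! * l !)
    (≤-trans (≤-reflexive (trans (nCk≡nC[n∸k] (m≤m+n k l)) (cong ((k + l) C_) (m+n∸m≡n k l)))) (C≤central-low (k + l) l l≤)))

  -- A uniform maximal chain meets the layer of `x` in one set, each equally likely, and no layer is
  -- larger than the middle one. This is the estimate behind the LYM inequality.
  factorial≤through : ∀ {n} (x : Subset n) → n ! ≤ (n C ⌊ n /2⌋) * through x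
  factorial≤through x = subst (λ n → n ! ≤ (n C ⌊ n /2⌋) * through x) (∣p∣+∣∁p∣ x)
    (factorial≤central (∣ x ∣) (∣ ∁ x ∣))

  -- The quotient of `(g + h) !` by `g ! * h !` is `(g + h) C g`, where `g` is at distance at least
  -- `r` from both ends of its row, and that row does not come before row `K`.
  C-factorials≤ : ∀ r g h K → r ≤ g → r ≤ h → K ≤ g + h → (K C r) * (g ! * h !) ≤ (g + h) !
  C-factorials≤ r g h K r≤g r≤h K≤ = ≤-trans
    (*-monoˡ-≤ (g ! * h !) (≤-trans (C-mono-top r K≤) (C-unimodal (g + h) r g r≤g (+-monoʳ-≤ g r≤h))))
    (≤-reflexive (C*factorials g h))

  ∣∁∣-split : ∀ {n} {x y : Subset n} → x ⊆ y → ∣ y ∩ ∁ x ∣ + ∣ ∁ y ∣ ≡ ∣ ∁ x ∣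
  ∣∁∣-split {n} {x} {y} x⊆y = +-cancelˡ-≡ ∣ x ∣ _ _ (begin
    ∣ x ∣ + (∣ y ∩ ∁ x ∣ + ∣ ∁ y ∣) ≡⟨ +-assoc ∣ x ∣ _ _ ⟨
    ∣ x ∣ + ∣ y ∩ ∁ x ∣ + ∣ ∁ y ∣   ≡⟨ cong (_+ ∣ ∁ y ∣) (∣p∣+∣q∖p∣ x⊆y) ⟩
    ∣ y ∣ + ∣ ∁ y ∣                 ≡⟨ ∣p∣+∣∁p∣ y ⟩
    n                               ≡⟨ ∣p∣+∣∁p∣ x ⟨
    ∣ x ∣ + ∣ ∁ x ∣                 ∎)
    where
    open ≡-Reasoning

  gap : ∀ {n} {x y : Subset n} {r} → x ⊆ y → ∣ x ∣ + r ≤ ∣ y ∣ → r ≤ ∣ y ∩ ∁ x ∣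
  gap {x = x} x⊆y le = +-cancelˡ-≤ ∣ x ∣ _ _ (≤-trans le (≤-reflexive (sym (∣p∣+∣q∖p∣ x⊆y))))

  ⌈n/2⌉≤ : ∀ k l → l ≤ k → ⌈ k + l /2⌉ ≤ k
  ⌈n/2⌉≤ k l l≤k = +-cancelˡ-≤ ⌊ k + l /2⌋ _ _ (≤-trans (≤-reflexive (⌊n/2⌋+⌈n/2⌉≡n (k + l)))
    (≤-trans (≤-reflexive (+-comm k l)) (+-monoˡ-≤ k l≤half)))
    where
    l≤half : l ≤ ⌊ k + l /2⌋
    l≤half with low-or-high k l
    ... | inj₁ k≤ = ≤-trans l≤k k≤
    ... | inj₂ l≤ = l≤

  module _ {n} (r : ℕ) {x y : Subset n} (x⊆y : x ⊆ y) (far : ∣ x ∣ + r ≤ ∣ y ∣) where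
    open ≤-Reasoning
    open +-*-Solver

    -- Among the chains through `x`, the fraction that also contains `y` is the inverse of the
    -- binomial coefficient `|∁ x|` over `|y ∩ ∁ x|`. Below the middle, `∁ x` has at least half the
    -- elements, so this coefficient is at least `⌈ n /2⌉ C r`.
    through₂-low : r ≤ ∣ ∁ y ∣ → ∣ x ∣ ≤ ∣ ∁ x ∣ → (⌈ n /2⌉ C r) * through₂ x y ≤ through x
    through₂-low r≤ low = begin
      (⌈ n /2⌉ C r) * (∣ x ∣ ! * (∣ y ∩ ∁ x ∣ ! * ∣ ∁ y ∣ !))
        ≡⟨ solve 3 (λ a b c → a :* (b :* c) := b :* (a :* c)) refl (⌈ n /2⌉ C r) (∣ x ∣ !) _ ⟩
      ∣ x ∣ ! * ((⌈ n /2⌉ C r) * (∣ y ∩ ∁ x ∣ ! * ∣ ∁ y ∣ !))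
        ≤⟨ *-monoʳ-≤ (∣ x ∣ !) (C-factorials≤ r (∣ y ∩ ∁ x ∣) (∣ ∁ y ∣) ⌈ n /2⌉ (gap x⊆y far) r≤
             (≤-trans half (≤-reflexive (sym (∣∁∣-split x⊆y))))) ⟩
      ∣ x ∣ ! * (∣ y ∩ ∁ x ∣ + ∣ ∁ y ∣) !
        ≡⟨ cong (λ k → ∣ x ∣ ! * k !) (∣∁∣-split x⊆y) ⟩
      through x ∎
      where
      half : ⌈ n /2⌉ ≤ ∣ ∁ x ∣
      half = subst (λ k → ⌈ k /2⌉ ≤ ∣ ∁ x ∣) (trans (+-comm (∣ ∁ x ∣) (∣ x ∣)) (∣p∣+∣∁p∣ x)) (⌈n/2⌉≤ (∣ ∁ x ∣) (∣ x ∣) low)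

    -- The mirror image, counted among the chains through `y`: above the middle, `x` alone already
    -- has half the elements.
    through₂-high : r ≤ ∣ x ∣ → ∣ ∁ x ∣ ≤ ∣ x ∣ → (⌈ n /2⌉ C r) * through₂ x y ≤ through y
    through₂-high r≤ high = begin
      (⌈ n /2⌉ C r) * (∣ x ∣ ! * (∣ y ∩ ∁ x ∣ ! * ∣ ∁ y ∣ !))
        ≡⟨ solve 4 (λ a b c d → a :* (b :* (c :* d)) := a :* (b :* c) :* d) refl (⌈ n /2⌉ C r) (∣ x ∣ !) _ _ ⟩
      (⌈ n /2⌉ C r) * (∣ x ∣ ! * ∣ y ∩ ∁ x ∣ !) * ∣ ∁ y ∣ !
        ≤⟨ *-monoˡ-≤ (∣ ∁ y ∣ !) (C-factorials≤ r (∣ x ∣) (∣ y ∩ ∁ x ∣) ⌈ n /2⌉ r≤ (gap x⊆y far)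
             (≤-trans half (m≤m+n ∣ x ∣ _))) ⟩
      (∣ x ∣ + ∣ y ∩ ∁ x ∣) ! * ∣ ∁ y ∣ !
        ≡⟨ cong (λ k → k ! * ∣ ∁ y ∣ !) (∣p∣+∣q∖p∣ x⊆y) ⟩
      through y ∎
      where
      half : ⌈ n /2⌉ ≤ ∣ x ∣
      half = subst (λ k → ⌈ k /2⌉ ≤ ∣ x ∣) (∣p∣+∣∁p∣ x) (⌈n/2⌉≤ (∣ x ∣) (∣ ∁ x ∣) high)

  -- Supersaturation: large families have sets comparable to many others.

  module Supersaturation {n N : ℕ} (X : Fin N → Subset n) (X-injective : ∀ {i j} → X i ≡ X j → i ≡ j) where

    Comparable : Fin N → Fin N → Set
    Comparable i j = i ≢ j × (X i ⊆ X j ⊎ X j ⊆ X i)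

    comparable? : ∀ i j → Dec (Comparable i j)
    comparable? i j = ¬? (i Fin.≟ j) ×-dec (X i ⊆? X j ⊎-dec X j ⊆? X i)

    Far : ℕ → Fin N → Fin N → Set
    Far r i j = X i ⊆ X j × ∣ X i ∣ + r ≤ ∣ X j ∣

    far? : ∀ r i j → Dec (Far r i j)
    far? r i j = X i ⊆? X j ×-dec ∣ X i ∣ + r ≤? ∣ X j ∣

    module _ {P : Fin N → Set} (P? : ∀ i → Dec (P i)) where

      count-sizes : ∀ (c : Chain n) a r → sum (λ i → 𝟙 ((P? i ×-dec c ∋? X i) ×-dec window? a r ∣ X i ∣)) ≤ r
      count-sizes c a r = count-window (λ i → P? i ×-dec c ∋? X i) (λ i → ∣ X i ∣)
        (λ i j (_ , x∈) (_ , y∈) e → X-injective (∋-unique c x∈ y∈ e)) a r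

      -- Double counting of incidences: every chain contains at most `R` members, while every member
      -- lies on at least `n ! / K` of the `n !` chains.
      count-bounded : ∀ R K → (∀ c → sum (λ i → 𝟙 (P? i ×-dec c ∋? X i)) ≤ R) →
        (∀ i → P i → n ! ≤ K * through (X i)) → sum (𝟙 ∘ P?) ≤ K * R
      count-bounded R K chain layer = *-cancelʳ-≤ _ _ (n !) {{n !≢0}} (begin
        sum (𝟙 ∘ P?) * n !
          ≡⟨ *-distribʳ-sum (n !) (𝟙 ∘ P?) ⟩
        sum (λ i → 𝟙 (P? i) * n !)
          ≤⟨ sum-mono bound ⟩
        sum (λ i → K * (𝟙 (P? i) * ∑ᶜ n (λ c → 𝟙 (c ∋? X i))))
          ≡⟨ *-distribˡ-sum K (λ i → 𝟙 (P? i) * ∑ᶜ n (λ c → 𝟙 (c ∋? X i))) ⟨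
        K * sum (λ i → 𝟙 (P? i) * ∑ᶜ n (λ c → 𝟙 (c ∋? X i)))
          ≡⟨ cong (K *_) (sum-cong-≗ (λ i → trans (sym (∑ᶜ-*ˡ n (𝟙 (P? i)) (λ c → 𝟙 (c ∋? X i))))
               (∑ᶜ-cong n λ c → sym (𝟙-× (P? i) (c ∋? X i))))) ⟩
        K * sum (λ i → ∑ᶜ n (λ c → 𝟙 (P? i ×-dec c ∋? X i)))
          ≡⟨ cong (K *_) (∑ᶜ-sum n (λ i c → 𝟙 (P? i ×-dec c ∋? X i))) ⟨
        K * ∑ᶜ n (λ c → sum (λ i → 𝟙 (P? i ×-dec c ∋? X i)))
          ≤⟨ *-monoʳ-≤ K (∑ᶜ-mono n chain) ⟩
        K * ∑ᶜ n (λ _ → R)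
          ≡⟨ trans (cong (K *_) (∑ᶜ-const n R)) (sym (*-assoc K R (n !))) ⟩
        K * R * n ! ∎)
        where
        open ≤-Reasoning
        bound : ∀ i → 𝟙 (P? i) * n ! ≤ K * (𝟙 (P? i) * ∑ᶜ n (λ c → 𝟙 (c ∋? X i)))
        bound i with P? i
        ... | no _  = z≤n
        ... | yes p = begin
          n ! + 0                                       ≡⟨ +-identityʳ (n !) ⟩
          n !                                           ≤⟨ layer i p ⟩
          K * through (X i)                             ≤⟨ *-monoʳ-≤ K (through≤ (X i)) ⟩
          K * ∑ᶜ n (λ c → 𝟙 (c ∋? X i))                 ≡⟨ cong (K *_) (sym (+-identityʳ _)) ⟩
          K * (∑ᶜ n (λ c → 𝟙 (c ∋? X i)) + 0)           ∎

      module _ (r : ℕ) where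

        -- The smallest member of the family on the chain is far from all but r members.
        chain-pairs : (c : Chain n) → sum (λ i → 𝟙 (P? i ×-dec c ∋? X i)) ≤
          r + sum (λ i → sum λ j → 𝟙 ((P? i ×-dec P? j ×-dec far? r i j) ×-dec (c ∋? X i ×-dec c ∋? X j)))
        chain-pairs c = from (suc n) 0 (λ _ _ → z≤n) (≤-reflexive (sym (+-identityʳ (suc n))))
          where
          open ≤-Reasoning
          member? : ∀ i → Dec (P i × c ∋ X i)
          member? i = P? i ×-dec c ∋? X i
          row : Fin N → ℕ
          row i = sum λ j → 𝟙 ((P? i ×-dec P? j ×-dec far? r i j) ×-dec (c ∋? X i ×-dec c ∋? X j))
          from : ∀ fuel s → (∀ i → P i × c ∋ X i → s ≤ ∣ X i ∣) → n < fuel + s →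
            sum (𝟙 ∘ member?) ≤ r + sum row
          from zero s above n<s = ≤-trans (≤-reflexive (sum-zero _ λ i →
            𝟙-false (λ m → <⇒≱ n<s (≤-trans (above i m) (∣p∣≤n (X i)))) (member? i))) z≤n
          from (suc fuel) s above n< with any? (λ i → member? i ×-dec ∣ X i ∣ ≟ s)
          ... | no none = from fuel (suc s) (λ i m → ≤∧≢⇒< (above i m) λ e → none (i , m , sym e))
            (subst (n <_) (sym (+-suc fuel s)) n<)
          ... | yes (i₀ , (p₀ , x₀) , refl) = begin
            sum (𝟙 ∘ member?)
              ≤⟨ sum-mono (λ j → 𝟙-cover (near-or-far j) (member? j) (member? j ×-dec window? (∣ X i₀ ∣) r (∣ X j ∣))
                   ((P? i₀ ×-dec P? j ×-dec far? r i₀ j) ×-dec (c ∋? X i₀ ×-dec c ∋? X j))) ⟩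
            sum (λ j → 𝟙 (member? j ×-dec window? (∣ X i₀ ∣) r (∣ X j ∣))
                     + 𝟙 ((P? i₀ ×-dec P? j ×-dec far? r i₀ j) ×-dec (c ∋? X i₀ ×-dec c ∋? X j)))
              ≡⟨ ∑-distrib-+ (λ j → 𝟙 (member? j ×-dec window? (∣ X i₀ ∣) r (∣ X j ∣))) _ ⟩
            sum (λ j → 𝟙 (member? j ×-dec window? (∣ X i₀ ∣) r (∣ X j ∣))) + row i₀
              ≤⟨ +-mono-≤ (count-sizes c (∣ X i₀ ∣) r) (term≤sum row i₀) ⟩
            r + sum row ∎
            where
            near-or-far : ∀ j → P j × c ∋ X j →
              ((P j × c ∋ X j) × Window (∣ X i₀ ∣) r (∣ X j ∣)) ⊎ ((P i₀ × P j × Far r i₀ j) × (c ∋ X i₀ × c ∋ X j))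
            near-or-far j (p , x∈) with ∣ X j ∣ <? ∣ X i₀ ∣ + r
            ... | yes lt = inj₁ ((p , x∈) , above j (p , x∈) , lt)
            ... | no ≮   = inj₂ ((p₀ , p , ∋-ordered c x₀ x∈ (above j (p , x∈)) , ≮⇒≥ ≮) , x₀ , x∈)

        -- Equal to `n !` times the expected number of members on a uniform maximal chain.
        chainWeight : ℕ
        chainWeight = sum λ i → 𝟙 (P? i) * through (X i)

        weight≤pairs : chainWeight ≤ r * n ! + sum (λ i → sum λ j → 𝟙 (P? i ×-dec P? j ×-dec far? r i j) * through₂ (X i) (X j))
        weight≤pairs = begin
          sum (λ i → 𝟙 (P? i) * through (X i))
            ≤⟨ sum-mono (λ i → *-monoʳ-≤ (𝟙 (P? i)) (through≤ (X i))) ⟩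
          sum (λ i → 𝟙 (P? i) * ∑ᶜ n (λ c → 𝟙 (c ∋? X i)))
            ≡⟨ sum-cong-≗ (λ i → trans (sym (∑ᶜ-*ˡ n (𝟙 (P? i)) (λ c → 𝟙 (c ∋? X i))))
                 (∑ᶜ-cong n λ c → sym (𝟙-× (P? i) (c ∋? X i)))) ⟩
          sum (λ i → ∑ᶜ n (λ c → 𝟙 (P? i ×-dec c ∋? X i)))
            ≡⟨ ∑ᶜ-sum n (λ i c → 𝟙 (P? i ×-dec c ∋? X i)) ⟨
          ∑ᶜ n (λ c → sum (λ i → 𝟙 (P? i ×-dec c ∋? X i)))
            ≤⟨ ∑ᶜ-mono n chain-pairs ⟩
          ∑ᶜ n (λ c → r + sum (λ i → sum λ j → 𝟙 (pair i j ×-dec both i j c)))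
            ≡⟨ ∑ᶜ-+ n (λ _ → r) _ ⟩
          ∑ᶜ n (λ _ → r) + ∑ᶜ n (λ c → sum (λ i → sum λ j → 𝟙 (pair i j ×-dec both i j c)))
            ≡⟨ cong₂ _+_ (∑ᶜ-const n r) (trans (∑ᶜ-sum n (λ i c → sum λ j → 𝟙 (pair i j ×-dec both i j c)))
                 (sum-cong-≗ λ i → trans (∑ᶜ-sum n (λ j c → 𝟙 (pair i j ×-dec both i j c)))
                   (sum-cong-≗ λ j → trans (∑ᶜ-cong n (λ c → 𝟙-× (pair i j) (both i j c)))
                     (∑ᶜ-*ˡ n (𝟙 (pair i j)) (λ c → 𝟙 (both i j c)))))) ⟩
          r * n ! + sum (λ i → sum λ j → 𝟙 (pair i j) * ∑ᶜ n (λ c → 𝟙 (both i j c)))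
            ≤⟨ +-monoʳ-≤ (r * n !) (sum-mono λ i → sum-mono λ j → bound i j) ⟩
          r * n ! + sum (λ i → sum λ j → 𝟙 (pair i j) * through₂ (X i) (X j)) ∎
          where
          open ≤-Reasoning
          pair : ∀ i j → Dec (P i × P j × Far r i j)
          pair i j = P? i ×-dec P? j ×-dec far? r i j
          both : ∀ i j c → Dec (c ∋ X i × c ∋ X j)
          both i j c = c ∋? X i ×-dec c ∋? X j
          bound : ∀ i j → 𝟙 (pair i j) * ∑ᶜ n (λ c → 𝟙 (both i j c)) ≤ 𝟙 (pair i j) * through₂ (X i) (X j)
          bound i j with pair i j
          ... | no _                = z≤n
          ... | yes (_ , _ , sub , _) = *-monoʳ-≤ 1 (≤through₂ sub)

        degree : Fin N → ℕ
        degree i = sum λ j → 𝟙 (P? j ×-dec comparable? i j)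

        -- A pair is charged to its lower member if that is in the lower half of
        -- the cube, and to its upper member otherwise.
        module _ (1≤r : 1 ≤ r) (inner : ∀ i → P i → r ≤ ∣ X i ∣ × r ≤ ∣ ∁ (X i) ∣) where
          private
            D = ⌈ n /2⌉ C r

            low? : ∀ i → Dec (∣ X i ∣ ≤ ∣ ∁ (X i) ∣)
            low? i = ∣ X i ∣ ≤? ∣ ∁ (X i) ∣

            Up Down : Fin N → Fin N → Set
            Up i j   = (P i × P j × Far r i j) × ∣ X i ∣ ≤ ∣ ∁ (X i) ∣
            Down i j = (P i × P j × Far r i j) × ¬ (∣ X i ∣ ≤ ∣ ∁ (X i) ∣)

            up? : ∀ i j → Dec (Up i j)
            up? i j = (P? i ×-dec P? j ×-dec far? r i j) ×-dec low? i

            down? : ∀ i j → Dec (Down i j)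
            down? i j = (P? i ×-dec P? j ×-dec far? r i j) ×-dec ¬? (low? i)

          charge : ∀ i j → D * (𝟙 (P? i ×-dec P? j ×-dec far? r i j) * through₂ (X i) (X j)) ≤
            𝟙 (up? i j) * through (X i) + 𝟙 (down? i j) * through (X j)
          charge i j with P? i ×-dec P? j ×-dec far? r i j | low? i
          ... | no _                        | _        = ≤-trans (≤-reflexive (*-zeroʳ D)) z≤n
          ... | yes (pi , pj , sub , far)     | yes low  = begin
            D * (1 * through₂ (X i) (X j)) ≡⟨ cong (D *_) (*-identityˡ _) ⟩
            D * through₂ (X i) (X j)       ≤⟨ through₂-low r sub far (proj₂ (inner j pj)) low ⟩
            through (X i)                  ≡⟨ trans (+-identityʳ _) (*-identityˡ _) ⟨
            1 * through (X i) + 0          ∎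
            where
            open ≤-Reasoning
          ... | yes (pi , pj , sub , far)     | no high  = begin
            D * (1 * through₂ (X i) (X j)) ≡⟨ cong (D *_) (*-identityˡ _) ⟩
            D * through₂ (X i) (X j)       ≤⟨ through₂-high r sub far (proj₁ (inner i pi)) (<⇒≤ (≰⇒> high)) ⟩
            through (X j)                  ≡⟨ *-identityˡ _ ⟨
            1 * through (X j)              ∎
            where
            open ≤-Reasoning

          Far⇒≢ : ∀ {i j} → Far r i j → i ≢ j
          Far⇒≢ {i} (_ , le) refl = <⇒≱ (<-≤-trans (n<1+n _) (≤-trans (≤-reflexive (+-comm 1 _)) (≤-trans (+-monoʳ-≤ ∣ X i ∣ 1≤r) le))) ≤-refl

          Far-asym : ∀ {i j} → Far r i j → ¬ Far r j i
          Far-asym f (sub , _) = Far⇒≢ f (X-injective (⊆-antisym (proj₁ f) sub))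

          -- The first indicator charges `i` as a lower member, the second as an upper member; by
          -- `Far-asym` a pair cannot do both.
          charged : ∀ i j → 𝟙 (up? i j) + 𝟙 (down? j i) ≤ 𝟙 (P? i) * 𝟙 (P? j ×-dec comparable? i j)
          charged i j = subst (𝟙 (up? i j) + 𝟙 (down? j i) ≤_) (𝟙-× (P? i) (P? j ×-dec comparable? i j)) (go (up? i j) (down? j i))
            where
            T? = P? i ×-dec P? j ×-dec comparable? i j
            go : (u : Dec (Up i j)) (d : Dec (Down j i)) → 𝟙 u + 𝟙 d ≤ 𝟙 T?
            go (no _) d = 𝟙-mono (λ ((pj , pi , f) , _) → pi , pj , Far⇒≢ f ∘ sym , inj₂ (λ {_} → proj₁ f)) d T?
            go u (no _) = ≤-trans (≤-reflexive (+-identityʳ (𝟙 u)))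
              (𝟙-mono (λ ((pi , pj , f) , _) → pi , pj , Far⇒≢ f , inj₁ (λ {_} → proj₁ f)) u T?)
            go (yes ((_ , _ , f) , _)) (yes ((_ , _ , g) , _)) = contradiction g (Far-asym f)

          weight≤degrees : D * chainWeight ≤ D * (r * n !) + sum (λ i → 𝟙 (P? i) * through (X i) * degree i)
          weight≤degrees = begin
            D * chainWeight
              ≤⟨ *-monoʳ-≤ D weight≤pairs ⟩
            D * (r * n ! + sum (λ i → sum λ j → E i j))
              ≡⟨ *-distribˡ-+ D (r * n !) _ ⟩
            D * (r * n !) + D * sum (λ i → sum λ j → E i j)
              ≡⟨ cong (D * (r * n !) +_) (trans (*-distribˡ-sum D (λ i → sum (E i))) (sum-cong-≗ λ i → *-distribˡ-sum D (E i))) ⟩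
            D * (r * n !) + sum (λ i → sum λ j → D * E i j)
              ≤⟨ +-monoʳ-≤ (D * (r * n !)) (sum-mono λ i → sum-mono λ j → charge i j) ⟩
            D * (r * n !) + sum (λ i → sum λ j → U i j + V i j)
              ≡⟨ cong (D * (r * n !) +_) (trans (sum-cong-≗ λ i → ∑-distrib-+ (U i) (V i)) (∑-distrib-+ (λ i → sum (U i)) (λ i → sum (V i)))) ⟩
            D * (r * n !) + (sum (λ i → sum (U i)) + sum (λ i → sum (V i)))
              -- Exchanging the summations in the second part gathers at `i` also what it is charged
              -- as an upper member.
              ≡⟨ cong (λ s → D * (r * n !) + (sum (λ i → sum (U i)) + s)) (∑-comm V) ⟩
            D * (r * n !) + (sum (λ i → sum (U i)) + sum (λ i → sum λ j → V j i))
              ≡⟨ cong (D * (r * n !) +_) (trans (sym (∑-distrib-+ (λ i → sum (U i)) (λ i → sum λ j → V j i)))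
                   (sum-cong-≗ λ i → sym (∑-distrib-+ (U i) (λ j → V j i)))) ⟩
            D * (r * n !) + sum (λ i → sum λ j → U i j + V j i)
              ≤⟨ +-monoʳ-≤ (D * (r * n !)) (sum-mono λ i → ≤-trans (sum-mono λ j → collect i j)
                   (≤-reflexive (sym (*-distribˡ-sum (𝟙 (P? i) * through (X i)) (λ j → 𝟙 (P? j ×-dec comparable? i j)))))) ⟩
            D * (r * n !) + sum (λ i → 𝟙 (P? i) * through (X i) * degree i) ∎
            where
            open ≤-Reasoning
            E U V : Fin N → Fin N → ℕ
            E i j = 𝟙 (P? i ×-dec P? j ×-dec far? r i j) * through₂ (X i) (X j)
            U i j = 𝟙 (up? i j) * through (X i)
            V i j = 𝟙 (down? i j) * through (X j)
            collect : ∀ i j → U i j + V j i ≤ 𝟙 (P? i) * through (X i) * 𝟙 (P? j ×-dec comparable? i j)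
            collect i j = begin
              𝟙 (up? i j) * through (X i) + 𝟙 (down? j i) * through (X i)
                ≡⟨ *-distribʳ-+ (through (X i)) (𝟙 (up? i j)) (𝟙 (down? j i)) ⟨
              (𝟙 (up? i j) + 𝟙 (down? j i)) * through (X i)
                ≤⟨ *-monoˡ-≤ (through (X i)) (charged i j) ⟩
              𝟙 (P? i) * 𝟙 (P? j ×-dec comparable? i j) * through (X i)
                ≡⟨ solve 3 (λ a b c → a :* b :* c := a :* c :* b) refl (𝟙 (P? i)) (𝟙 (P? j ×-dec comparable? i j)) (through (X i)) ⟩
              𝟙 (P? i) * through (X i) * 𝟙 (P? j ×-dec comparable? i j) ∎
              where
              open +-*-Solver

          -- Under the degree bound the last sum of `weight≤degrees` is at most
          -- `D * chainWeight / (J + 1)` and is absorbed on the left. What remains bounds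
          -- `chainWeight` by `(1 + 1 / J) r n !`, and every member contributes at least `n ! / m`
          -- to it.
          sparse⇒small : ∀ J → 1 ≤ D → (∀ i → P i → suc J * degree i ≤ D) →
            J * sum (𝟙 ∘ P?) ≤ suc J * r * (n C ⌊ n /2⌋)
          sparse⇒small J 1≤D sparse = *-cancelʳ-≤ _ _ (n !) {{n !≢0}} (begin
            J * sum (𝟙 ∘ P?) * n !
              ≡⟨ trans (*-assoc J _ (n !)) (cong (J *_) (*-distribʳ-sum (n !) (𝟙 ∘ P?))) ⟩
            J * sum (λ i → 𝟙 (P? i) * n !)
              ≤⟨ *-monoʳ-≤ J (sum-mono λ i → *-monoʳ-≤ (𝟙 (P? i)) (factorial≤through (X i))) ⟩
            J * sum (λ i → 𝟙 (P? i) * (m * through (X i)))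
              ≡⟨ cong (J *_) (trans (sum-cong-≗ λ i → solve 3 (λ a b c → a :* (b :* c) := b :* (a :* c)) refl (𝟙 (P? i)) m (through (X i)))
                   (sym (*-distribˡ-sum m (λ i → 𝟙 (P? i) * through (X i))))) ⟩
            J * (m * chainWeight)
              ≡⟨ solve 3 (λ a b c → a :* (b :* c) := b :* (a :* c)) refl J m chainWeight ⟩
            m * (J * chainWeight)
              ≤⟨ *-monoʳ-≤ m J*weight≤ ⟩
            m * (suc J * (r * n !))
              ≡⟨ solve 4 (λ m j r f → m :* (j :* (r :* f)) := j :* r :* m :* f) refl m (suc J) r (n !) ⟩
            suc J * r * m * n ! ∎)
            where
            open ≤-Reasoning
            open +-*-Solver
            m = n C ⌊ n /2⌋
            degrees≤ : suc J * sum (λ i → 𝟙 (P? i) * through (X i) * degree i) ≤ D * chainWeight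
            degrees≤ = begin
              suc J * sum (λ i → 𝟙 (P? i) * through (X i) * degree i)
                ≡⟨ *-distribˡ-sum (suc J) (λ i → 𝟙 (P? i) * through (X i) * degree i) ⟩
              sum (λ i → suc J * (𝟙 (P? i) * through (X i) * degree i))
                ≤⟨ sum-mono bound ⟩
              sum (λ i → D * (𝟙 (P? i) * through (X i)))
                ≡⟨ *-distribˡ-sum D (λ i → 𝟙 (P? i) * through (X i)) ⟨
              D * chainWeight ∎
              where
              bound : ∀ i → suc J * (𝟙 (P? i) * through (X i) * degree i) ≤ D * (𝟙 (P? i) * through (X i))
              bound i with P? i
              ... | no _  = ≤-trans (≤-reflexive (*-zeroʳ (suc J))) z≤n
              ... | yes p = begin
                suc J * (1 * through (X i) * degree i)
                  ≡⟨ solve 3 (λ a b c → a :* (con 1 :* b :* c) := a :* c :* (con 1 :* b)) refl (suc J) (through (X i)) (degree i) ⟩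
                suc J * degree i * (1 * through (X i))
                  ≤⟨ *-monoˡ-≤ (1 * through (X i)) (sparse i p) ⟩
                D * (1 * through (X i)) ∎
            J*weight≤ : J * chainWeight ≤ suc J * (r * n !)
            J*weight≤ = *-cancelˡ-≤ D {{>-nonZero 1≤D}} (+-cancelˡ-≤ (D * chainWeight) _ _ (begin
              D * chainWeight + D * (J * chainWeight)
                ≡⟨ solve 3 (λ d w j → d :* w :+ d :* (j :* w) := (con 1 :+ j) :* (d :* w)) refl D chainWeight J ⟩
              suc J * (D * chainWeight)
                ≤⟨ *-monoʳ-≤ (suc J) weight≤degrees ⟩
              suc J * (D * (r * n !) + sum (λ i → 𝟙 (P? i) * through (X i) * degree i))
                ≡⟨ *-distribˡ-+ (suc J) (D * (r * n !)) _ ⟩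
              suc J * (D * (r * n !)) + suc J * sum (λ i → 𝟙 (P? i) * through (X i) * degree i)
                ≤⟨ +-monoʳ-≤ (suc J * (D * (r * n !))) degrees≤ ⟩
              suc J * (D * (r * n !)) + D * chainWeight
                ≡⟨ solve 4 (λ j d f w → j :* (d :* f) :+ d :* w := d :* w :+ d :* (j :* f)) refl (suc J) D (r * n !) chainWeight ⟩
              D * chainWeight + D * (suc J * (r * n !)) ∎))

  -- The outer layers, and vertices of large degree in dense families.

  module Layers {n N : ℕ} (X : Fin N → Subset n) (X-injective : ∀ {i j} → X i ≡ X j → i ≡ j) where
    open Supersaturation X X-injective

    m : ℕ
    m = n C ⌊ n /2⌋

    N≤[1+n]m : N ≤ m * suc n
    N≤[1+n]m = subst (_≤ m * suc n) (sum-one N)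
      (count-bounded {P = λ _ → ⊤} (λ _ → yes tt) (suc n) m chain (λ i _ → factorial≤through (X i)))
      where
      chain : ∀ c → sum (λ i → 𝟙 (yes tt ×-dec c ∋? X i)) ≤ suc n
      chain c = ≤-trans
        (sum-mono λ i → 𝟙-mono (λ p → p , z≤n , s≤s (∣p∣≤n (X i))) (yes tt ×-dec c ∋? X i)
          ((yes tt ×-dec c ∋? X i) ×-dec window? 0 (suc n) (∣ X i ∣)))
        (count-sizes (λ _ → yes tt) c 0 (suc n))

    -- Charging a pair at distance 3 needs room for three elements below and above, so the layers
    -- within distance 2 of the ends are set aside.
    Outer : Fin N → Set
    Outer i = ∣ X i ∣ ≤ 2 ⊎ ∣ ∁ (X i) ∣ ≤ 2

    outer? : ∀ i → Dec (Outer i)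
    outer? i = ∣ X i ∣ ≤? 2 ⊎-dec ∣ ∁ (X i) ∣ ≤? 2

    -- There are at most six outer layers, a chain meets each of them in at most one set, and none
    -- is larger than layer 2.
    count-outer : 4 ≤ n → sum (𝟙 ∘ outer?) ≤ (n C 2) * 6
    count-outer 4≤n = count-bounded outer? 6 (n C 2) chain layer
      where
      open ≤-Reasoning
      chain : ∀ c → sum (λ i → 𝟙 (outer? i ×-dec c ∋? X i)) ≤ 6
      chain c = begin
        sum (λ i → 𝟙 (outer? i ×-dec c ∋? X i))
          ≤⟨ sum-mono (λ i → 𝟙-cover (split i) (outer? i ×-dec c ∋? X i) (bottom? i) (top? i)) ⟩
        sum (λ i → 𝟙 (bottom? i) + 𝟙 (top? i))
          ≡⟨ ∑-distrib-+ (𝟙 ∘ bottom?) (𝟙 ∘ top?) ⟩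
        sum (𝟙 ∘ bottom?) + sum (𝟙 ∘ top?)
          ≤⟨ +-mono-≤ (count-sizes outer? c 0 3) (count-sizes outer? c (n ∸ 2) 3) ⟩
        6 ∎
        where
        bottom? : ∀ i → Dec ((Outer i × c ∋ X i) × Window 0 3 (∣ X i ∣))
        bottom? i = (outer? i ×-dec c ∋? X i) ×-dec window? 0 3 (∣ X i ∣)
        top? : ∀ i → Dec ((Outer i × c ∋ X i) × Window (n ∸ 2) 3 (∣ X i ∣))
        top? i = (outer? i ×-dec c ∋? X i) ×-dec window? (n ∸ 2) 3 (∣ X i ∣)
        split : ∀ i → Outer i × c ∋ X i → ((Outer i × c ∋ X i) × Window 0 3 (∣ X i ∣)) ⊎ ((Outer i × c ∋ X i) × Window (n ∸ 2) 3 (∣ X i ∣))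
        split i o@(inj₁ le , _) = inj₁ (o , z≤n , s≤s le)
        split i o@(inj₂ le , _) = inj₂ (o ,
          m≤n+o⇒m∸n≤o n 2 (subst (_≤ 2 + ∣ X i ∣) (∣p∣+∣∁p∣ (X i)) (≤-trans (+-monoʳ-≤ (∣ X i ∣) le) (≤-reflexive (+-comm (∣ X i ∣) 2)))) ,
          ≤-<-trans (∣p∣≤n (X i)) (subst (n <_) (sym (trans (+-suc (n ∸ 2) 2) (cong suc (m∸n+n≡m (≤-trans (s≤s (s≤s z≤n)) 4≤n))))) (n<1+n n)))
      other : ∀ k l → 4 ≤ k + l → k ≤ 2 → 2 ≤ l
      other k l 4≤ k≤2 = +-cancelˡ-≤ 2 _ _ (≤-trans 4≤ (+-monoˡ-≤ l k≤2))
      bound : ∀ k l → 4 ≤ k + l → k ≤ 2 ⊎ l ≤ 2 → (k + l) ! ≤ ((k + l) C 2) * (k ! * l !)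
      bound k l 4≤ (inj₁ k≤2) = ≤-trans (≤-reflexive (sym (C*factorials k l))) (*-monoˡ-≤ (k ! * l !)
        (C-unimodal (k + l) k 2 k≤2 (≤-trans (≤-reflexive (+-comm 2 k)) (+-monoʳ-≤ k (other k l 4≤ k≤2)))))
      bound k l 4≤ (inj₂ l≤2) = ≤-trans (≤-reflexive (sym (C*factorials k l))) (*-monoˡ-≤ (k ! * l !)
        (≤-trans (≤-reflexive (trans (nCk≡nC[n∸k] (m≤m+n k l)) (cong ((k + l) C_) (m+n∸m≡n k l))))
          (C-unimodal (k + l) l 2 l≤2 (+-monoˡ-≤ l (other l k (subst (4 ≤_) (+-comm k l) 4≤) l≤2)))))
      layer : ∀ i → Outer i → n ! ≤ (n C 2) * through (X i)
      layer i o = subst (λ n → n ! ≤ (n C 2) * through (X i)) (∣p∣+∣∁p∣ (X i))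
        (bound (∣ X i ∣) (∣ ∁ (X i) ∣) (subst (4 ≤_) (sym (∣p∣+∣∁p∣ (X i))) 4≤n) o)

    module _ {P : Fin N → Set} (P? : ∀ i → Dec (P i)) where

      -- The contrapositive of `sparse⇒small` for the members that are not outer; their degrees can
      -- only grow when the outer members are restored.
      dense⇒degree : ∀ r J → 1 ≤ r → r ≤ 3 → 1 ≤ ⌈ n /2⌉ C r →
        suc J * r * m + J * sum (𝟙 ∘ outer?) < J * sum (𝟙 ∘ P?) →
        ∃ λ i → P i × ⌈ n /2⌉ C r < suc J * degree P? r i
      dense⇒degree r J 1≤r r≤3 1≤D dense with any? (λ i → P? i ×-dec ⌈ n /2⌉ C r <? suc J * degree P? r i)
      ... | yes found = found
      ... | no none = contradiction dense (≤⇒≯ (begin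
        J * sum (𝟙 ∘ P?)
          ≤⟨ *-monoʳ-≤ J (≤-trans (sum-mono λ i → 𝟙-cover (split i) (P? i) (inner? i) (outer? i))
               (≤-reflexive (∑-distrib-+ (𝟙 ∘ inner?) (𝟙 ∘ outer?)))) ⟩
        J * (sum (𝟙 ∘ inner?) + sum (𝟙 ∘ outer?))
          ≡⟨ *-distribˡ-+ J (sum (𝟙 ∘ inner?)) _ ⟩
        J * sum (𝟙 ∘ inner?) + J * sum (𝟙 ∘ outer?)
          ≤⟨ +-monoˡ-≤ _ (sparse⇒small inner? r 1≤r
               (λ i (_ , ¬o) → ≤-trans r≤3 (≰⇒> (¬o ∘ inj₁)) , ≤-trans r≤3 (≰⇒> (¬o ∘ inj₂))) J 1≤D sparse) ⟩
        suc J * r * m + J * sum (𝟙 ∘ outer?) ∎))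
        where
        open ≤-Reasoning
        inner? : ∀ i → Dec (P i × ¬ Outer i)
        inner? i = P? i ×-dec ¬? (outer? i)
        split : ∀ i → P i → (P i × ¬ Outer i) ⊎ Outer i
        split i p with outer? i
        ... | yes o = inj₂ o
        ... | no ¬o = inj₁ (p , ¬o)
        sparse : ∀ i → P i × ¬ Outer i → suc J * degree inner? r i ≤ ⌈ n /2⌉ C r
        sparse i (p , _) = ≤-trans
          (*-monoʳ-≤ (suc J) (sum-mono λ j → 𝟙-mono (λ ((q , _) , k) → q , k) (inner? j ×-dec comparable? i j) (P? j ×-dec comparable? i j)))
          (≮⇒≥ λ lt → none (i , p , lt))

  -- Binomial estimates, and the constants of the three regimes.

  C2-double : ∀ l → ((2 + l) C 2) * 2 ≡ (2 + l) * (1 + l)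
  C2-double l = *-cancelʳ-≡ _ _ (l !) {{l !≢0}} (begin
    ((2 + l) C 2) * 2 * l !         ≡⟨ *-assoc ((2 + l) C 2) 2 (l !) ⟩
    ((2 + l) C 2) * (2 ! * l !)     ≡⟨ C*factorials 2 l ⟩
    (2 + l) * ((1 + l) * l !)       ≡⟨ *-assoc (2 + l) (1 + l) (l !) ⟨
    (2 + l) * (1 + l) * l !         ∎)
    where
    open ≡-Reasoning

  C3-sextuple : ∀ l → ((3 + l) C 3) * 6 ≡ (3 + l) * (2 + l) * (1 + l)
  C3-sextuple l = *-cancelʳ-≡ _ _ (l !) {{l !≢0}} (begin
    ((3 + l) C 3) * 6 * l !                 ≡⟨ *-assoc ((3 + l) C 3) 6 (l !) ⟩
    ((3 + l) C 3) * (3 ! * l !)             ≡⟨ C*factorials 3 l ⟩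
    (3 + l) * ((2 + l) * ((1 + l) * l !))   ≡⟨ solve 4 (λ a b c d → a :* (b :* (c :* d)) := a :* b :* c :* d) refl (3 + l) (2 + l) (1 + l) (l !) ⟩
    (3 + l) * (2 + l) * (1 + l) * l !       ∎)
    where
    open ≡-Reasoning
    open +-*-Solver

  C3≡C2 : ∀ l → ((3 + l) C 2) * (1 + l) ≡ 3 * ((3 + l) C 3)
  C3≡C2 l = *-cancelʳ-≡ _ _ 2 (begin
    ((3 + l) C 2) * (1 + l) * 2            ≡⟨ solve 2 (λ a b → a :* b :* con 2 := a :* con 2 :* b) refl ((3 + l) C 2) (1 + l) ⟩
    ((3 + l) C 2) * 2 * (1 + l)            ≡⟨ cong (_* (1 + l)) (C2-double (1 + l)) ⟩
    (3 + l) * (2 + l) * (1 + l)            ≡⟨ C3-sextuple l ⟨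
    ((3 + l) C 3) * 6                      ≡⟨ solve 1 (λ a → a :* con 6 := con 3 :* a :* con 2) refl ((3 + l) C 3) ⟩
    3 * ((3 + l) C 3) * 2                  ∎)
    where
    open ≡-Reasoning
    open +-*-Solver

  -- The constant is attained at `K = 4`. With `K = 4 + l`, six times the difference of the two
  -- sides is a polynomial in `l` with nonnegative coefficients.
  cube≤C3 : ∀ K → 4 ≤ K → K * (K * K) ≤ 16 * (K C 3)
  cube≤C3 1 (s≤s ())
  cube≤C3 2 (s≤s (s≤s ()))
  cube≤C3 3 (s≤s (s≤s (s≤s ())))
  cube≤C3 (suc (suc (suc (suc l)))) _ = *-cancelʳ-≤ _ _ 6 (begin
    (4 + l) * ((4 + l) * (4 + l)) * 6
      ≤⟨ m≤m+n _ ((4 + l) * (l * (32 + 10 * l))) ⟩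
    (4 + l) * ((4 + l) * (4 + l)) * 6 + (4 + l) * (l * (32 + 10 * l))
      ≡⟨ solve 1 (λ l → (con 4 :+ l) :* ((con 4 :+ l) :* (con 4 :+ l)) :* con 6 :+ (con 4 :+ l) :* (l :* (con 32 :+ con 10 :* l))
           := con 16 :* ((con 4 :+ l) :* (con 3 :+ l) :* (con 2 :+ l))) refl l ⟩
    16 * ((4 + l) * (3 + l) * (2 + l))
      ≡⟨ cong (16 *_) (C3-sextuple (1 + l)) ⟨
    16 * (((4 + l) C 3) * 6)
      ≡⟨ *-assoc 16 ((4 + l) C 3) 6 ⟨
    16 * ((4 + l) C 3) * 6 ∎)
    where
    open ≤-Reasoning
    open +-*-Solver

  C≤central : ∀ n k → k ≤ n → n C k ≤ n C ⌊ n /2⌋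
  C≤central n k k≤n = subst (λ n → n C k ≤ n C ⌊ n /2⌋) (m+[n∸m]≡n k≤n)
    (*-cancelʳ-≤ _ _ (k ! * (n ∸ k) !) {{k !* (n ∸ k) !≢0}}
      (≤-trans (≤-reflexive (C*factorials k (n ∸ k))) (factorial≤central k (n ∸ k))))

  -- Since `n C 3` is `(n - 2) / 3` times `n C 2`, it is at least `6 J` times `n C 2` as soon as
  -- `n - 2` reaches `18 J`.
  outer-negligible : ∀ n J c → 18 * J + 2 ≤ n → c ≤ (n C 2) * 6 → 1 ≤ J → J * c ≤ n C ⌊ n /2⌋
  outer-negligible zero J c n≥ _ _ = contradiction n≥ (λ le → <⇒≱ (s≤s z≤n) (≤-trans (m≤n+m 2 (18 * J)) le))
  outer-negligible (suc zero) J c n≥ _ _ = contradiction (≤-trans (m≤n+m 2 (18 * J)) n≥) λ { (s≤s ()) }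
  outer-negligible (suc (suc zero)) J@(suc _) c n≥ _ _ = contradiction (+-cancelʳ-≤ 2 (18 * J) 0 n≥) λ ()
  outer-negligible (suc (suc (suc l))) J c n≥ c≤ 1≤J = *-cancelˡ-≤ 18 (begin
    18 * (J * c)                        ≡⟨ *-assoc 18 J c ⟨
    18 * J * c                          ≤⟨ *-mono-≤ (+-cancelʳ-≤ 2 (18 * J) (1 + l) (≤-trans n≥ (≤-reflexive (+-comm 2 (1 + l))))) c≤ ⟩
    (1 + l) * (((3 + l) C 2) * 6)       ≡⟨ solve 2 (λ a b → a :* (b :* con 6) := con 6 :* (b :* a)) refl (1 + l) ((3 + l) C 2) ⟩
    6 * (((3 + l) C 2) * (1 + l))       ≡⟨ cong (6 *_) (C3≡C2 l) ⟩
    6 * (3 * ((3 + l) C 3))             ≡⟨ *-assoc 6 3 ((3 + l) C 3) ⟨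
    18 * ((3 + l) C 3)                  ≤⟨ *-monoʳ-≤ 18 (C≤central (3 + l) 3 (s≤s (s≤s (s≤s z≤n)))) ⟩
    18 * ((3 + l) C ⌊ 3 + l /2⌋)        ∎)
    where
    open ≤-Reasoning
    open +-*-Solver

  central-large : ∀ n c → 2 * c + 1 ≤ n → 2 ≤ n → n * c ≤ n C ⌊ n /2⌋
  central-large (suc zero) c n≥ (s≤s ())
  central-large (suc (suc l)) c n≥ 2≤n = *-cancelʳ-≤ _ _ 2 (begin
    (2 + l) * c * 2              ≡⟨ solve 2 (λ n c → n :* c :* con 2 := n :* (con 2 :* c)) refl (2 + l) c ⟩
    (2 + l) * (2 * c)            ≤⟨ *-monoʳ-≤ (2 + l) (+-cancelʳ-≤ 1 (2 * c) (1 + l) (≤-trans n≥ (≤-reflexive (+-comm 1 (1 + l))))) ⟩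
    (2 + l) * (1 + l)            ≡⟨ C2-double l ⟨
    ((2 + l) C 2) * 2            ≤⟨ *-monoˡ-≤ 2 (C≤central (2 + l) 2 2≤n) ⟩
    ((2 + l) C ⌊ 2 + l /2⌋) * 2  ∎)
    where
    open ≤-Reasoning
    open +-*-Solver

  n≤2⌈n/2⌉ : ∀ n → n ≤ 2 * ⌈ n /2⌉
  n≤2⌈n/2⌉ n = begin
    n                          ≡⟨ ⌊n/2⌋+⌈n/2⌉≡n n ⟨
    ⌊ n /2⌋ + ⌈ n /2⌉          ≤⟨ +-monoˡ-≤ ⌈ n /2⌉ (⌊n/2⌋≤⌈n/2⌉ n) ⟩
    ⌈ n /2⌉ + ⌈ n /2⌉          ≡⟨ cong (⌈ n /2⌉ +_) (+-identityʳ ⌈ n /2⌉) ⟨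
    2 * ⌈ n /2⌉                ∎
    where
    open ≤-Reasoning

  -- With λ = (u + 2) / (n J) and T = n² J² (J + 1), the potential grows by w₀ = λ T
  -- per vertex up to (1 + 2 / J) m vertices, by w₁ = λ T / J up to 7 m, and by
  -- w₂ = λ T / (n J) beyond.
  module Constants (n J u : ℕ) .{{_ : NonZero J}} where

    T w₀ w₁ w₂ f : ℕ
    T  = n * n * (J * J) * suc J
    w₀ = (u + 2) * n * J * suc J
    w₁ = (u + 2) * n * suc J
    w₂ = (u + 2) * suc J
    f  = n * n * (J * J)

    w₁≤w₀ : w₁ ≤ w₀
    w₁≤w₀ = *-monoˡ-≤ (suc J) (m≤m*n ((u + 2) * n) J)

    w₂≤w₁ : 1 ≤ n → w₂ ≤ w₁
    w₂≤w₁ 1≤n = *-monoˡ-≤ (suc J) (m≤m*n (u + 2) n {{>-nonZero 1≤n}})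

    module _ (u≥ : 256 * (J * (J * J) * suc J) ≤ u) where

      2≤256 : 2 ≤ 256
      2≤256 = s≤s (s≤s z≤n)

      J³≤ : 256 * (J * (J * J)) ≤ u + 2
      J³≤ = ≤-trans (*-monoʳ-≤ 256 (m≤m*n (J * (J * J)) (suc J))) (≤-trans u≥ (m≤m+n u 2))

      2J≤u : 2 * J ≤ u
      2J≤u = begin
        2 * J                          ≤⟨ *-monoˡ-≤ J 2≤256 ⟩
        256 * J                        ≤⟨ *-monoʳ-≤ 256 (m≤m*n J (J * J) {{m*n≢0 J J}}) ⟩
        256 * (J * (J * J))            ≤⟨ *-monoʳ-≤ 256 (m≤m*n (J * (J * J)) (suc J)) ⟩
        256 * (J * (J * J) * suc J)    ≤⟨ u≥ ⟩
        u                              ∎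
        where
        open ≤-Reasoning

      -- Divided by `T²`, this is `λ ≤ λδ (1 + λδ d)` with `δ = 1 / J`, a consequence of
      -- `δ² λ d ≥ 1`. As `d` exceeds `n / (2 (J + 1))`, it is enough that `u + 2` is at least
      -- `2 J³ (J + 1)`.
      middle-step : ∀ d → ⌈ n /2⌉ < suc J * d → w₀ * T ≤ w₁ * (T + w₁ * d)
      middle-step d d> = begin
        w₀ * T
          ≡⟨ solve 4 (λ v n J s → v :* n :* J :* s :* (n :* n :* (J :* J) :* s)
               := v :* n :* s :* (n :* s) :* (J :* (J :* J) :* n)) refl (u + 2) n J (suc J) ⟩
        w₁ * (n * suc J) * (J * (J * J) * n)
          ≤⟨ *-monoʳ-≤ (w₁ * (n * suc J)) bound ⟩
        w₁ * (n * suc J) * ((u + 2) * d)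
          ≡⟨ solve 4 (λ v n s d → v :* n :* s :* (n :* s) :* (v :* d) := v :* n :* s :* (v :* n :* s :* d)) refl (u + 2) n (suc J) d ⟩
        w₁ * (w₁ * d)
          ≤⟨ *-monoʳ-≤ w₁ (m≤n+m (w₁ * d) T) ⟩
        w₁ * (T + w₁ * d) ∎
        where
        open ≤-Reasoning
        open +-*-Solver
        bound : J * (J * J) * n ≤ (u + 2) * d
        bound = begin
          J * (J * J) * n                        ≤⟨ *-monoʳ-≤ (J * (J * J)) (≤-trans (n≤2⌈n/2⌉ n) (*-monoʳ-≤ 2 (<⇒≤ d>))) ⟩
          J * (J * J) * (2 * (suc J * d))        ≡⟨ solve 3 (λ c s d → c :* (con 2 :* (s :* d)) := con 2 :* (c :* s) :* d) refl (J * (J * J)) (suc J) d ⟩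
          2 * (J * (J * J) * suc J) * d          ≤⟨ *-monoˡ-≤ d (≤-trans (*-monoˡ-≤ (J * (J * J) * suc J) 2≤256) (≤-trans u≥ (m≤m+n u 2))) ⟩
          (u + 2) * d                            ∎

      -- As in `middle-step`, but with `δ = 1 / (n J)`, so that `(u + 2) d` must reach `n³ J³`. The
      -- bounds `n ≤ 2 K`, `K³ ≤ 16 (K C 3)` and `K C 3 < 2 d` give `n³ ≤ 8 * 16 * 2 * d`, the
      -- origin of 256.
      large-step : ∀ d → 4 ≤ ⌈ n /2⌉ → ⌈ n /2⌉ C 3 < 2 * d → w₀ * T ≤ w₂ * (T + w₂ * d)
      large-step d 4≤ d> = begin
        w₀ * T
          ≡⟨ solve 4 (λ v n J s → v :* n :* J :* s :* (n :* n :* (J :* J) :* s)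
               := v :* s :* s :* (J :* (J :* J) :* (n :* (n :* n)))) refl (u + 2) n J (suc J) ⟩
        w₂ * suc J * (J * (J * J) * (n * (n * n)))
          ≤⟨ *-monoʳ-≤ (w₂ * suc J) bound ⟩
        w₂ * suc J * ((u + 2) * d)
          ≡⟨ solve 3 (λ v s d → v :* s :* s :* (v :* d) := v :* s :* (v :* s :* d)) refl (u + 2) (suc J) d ⟩
        w₂ * (w₂ * d)
          ≤⟨ *-monoʳ-≤ w₂ (m≤n+m (w₂ * d) T) ⟩
        w₂ * (T + w₂ * d) ∎
        where
        open ≤-Reasoning
        open +-*-Solver
        K = ⌈ n /2⌉
        bound : J * (J * J) * (n * (n * n)) ≤ (u + 2) * d
        bound = begin
          J * (J * J) * (n * (n * n))
            ≤⟨ *-monoʳ-≤ (J * (J * J)) (*-mono-≤ (n≤2⌈n/2⌉ n) (*-mono-≤ (n≤2⌈n/2⌉ n) (n≤2⌈n/2⌉ n))) ⟩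
          J * (J * J) * (2 * K * (2 * K * (2 * K)))
            ≡⟨ solve 2 (λ c k → c :* (con 2 :* k :* (con 2 :* k :* (con 2 :* k))) := c :* con 8 :* (k :* (k :* k))) refl (J * (J * J)) K ⟩
          J * (J * J) * 8 * (K * (K * K))
            ≤⟨ *-monoʳ-≤ (J * (J * J) * 8) (≤-trans (cube≤C3 K 4≤) (*-monoʳ-≤ 16 (<⇒≤ d>))) ⟩
          J * (J * J) * 8 * (16 * (2 * d))
            ≡⟨ solve 2 (λ c d → c :* con 8 :* (con 16 :* (con 2 :* d)) := con 256 :* c :* d) refl (J * (J * J)) d ⟩
          256 * (J * (J * J)) * d
            ≤⟨ *-monoˡ-≤ d J³≤ ⟩
          (u + 2) * d ∎

      -- By `2J≤u`, `J (u + 2)` is at most `(J + 1) u`. After multiplication by `J` the terms below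
      -- the leading one are `u (14 J² + 23 J + 11)`, and `14 + 23 + 11 = 48`.
      exponent-polynomial : (u + 2) * suc J * (J + 11) + u * J ≤ J * ((J + 48) * u)
      exponent-polynomial = *-cancelˡ-≤ J (begin
        J * ((u + 2) * suc J * (J + 11) + u * J)
          ≡⟨ solve 2 (λ J u → J :* ((u :+ con 2) :* (con 1 :+ J) :* (J :+ con 11) :+ u :* J)
               := (con 2 :* J :+ u :* J) :* ((con 1 :+ J) :* (J :+ con 11)) :+ u :* (J :* J)) refl J u ⟩
        (2 * J + u * J) * (suc J * (J + 11)) + u * (J * J)
          ≤⟨ +-monoˡ-≤ (u * (J * J)) (*-monoˡ-≤ (suc J * (J + 11)) (+-monoˡ-≤ (u * J) 2J≤u)) ⟩
        (u + u * J) * (suc J * (J + 11)) + u * (J * J)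
          ≡⟨ solve 2 (λ J u → (u :+ u :* J) :* ((con 1 :+ J) :* (J :+ con 11)) :+ u :* (J :* J)
               := u :* (J :* (J :* J) :+ con 14 :* (J :* J) :+ (con 23 :* J :+ con 11))) refl J u ⟩
        u * (J * (J * J) + 14 * (J * J) + (23 * J + 11))
          ≤⟨ *-monoʳ-≤ u (+-monoʳ-≤ (J * (J * J) + 14 * (J * J))
               (+-mono-≤ (*-monoʳ-≤ 23 (m≤m*n J J)) (*-monoʳ-≤ 11 (>-nonZero⁻¹ (J * J) {{m*n≢0 J J}})))) ⟩
        u * (J * (J * J) + 14 * (J * J) + (23 * (J * J) + 11 * (J * J)))
          ≡⟨ solve 2 (λ J u → u :* (J :* (J :* J) :+ con 14 :* (J :* J) :+ (con 23 :* (J :* J) :+ con 11 :* (J :* J)))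
               := J :* (J :* ((J :+ con 48) :* u))) refl J u ⟩
        J * (J * ((J + 48) * u)) ∎)
        where
        open ≤-Reasoning
        open +-*-Solver

open Combinatorics

open import Algebra.Bundles using (module CommutativeRing)
open import Data.Bool using (Bool; true; false; if_then_else_)
open import Data.Empty using (⊥-elim)
open import Data.Fin as Fin using (Fin; zero; suc; funToFin; finToFun; combine)
open import Data.Fin.Properties using (2↔Bool; funToFin-finToFin)
open import Data.Fin.Subset using (Subset; inside; outside; ∣_∣; _∈_; _∉_; _⊆_; ∁; ⊤; ⊥)
open import Data.Fin.Subset.Properties
import Data.Integer as ℤ
import Data.Integer.Properties as ℤₚ
open import Data.List using (List; []; _∷_; _++_; map; filter; filterᵇ; foldr)
open import Data.List.Extrema.Nat using (argmax-sel)
open import Data.List.Membership.Propositional.Properties using (∈-map⁻; ∈-filter⁻)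
open import Data.Nat as ℕ using (zero; suc; z≤n; s≤s; ⌈_/2⌉; NonZero)
open import Data.Nat.Combinatorics using (nC1≡n)
import Data.Nat.DivMod as ℕ
import Data.Nat.Properties as ℕₚ
import Data.Nat.Solver as ℕSolver
open import Data.Product using (_,_; proj₁; proj₂)
open import Data.Rational as ℚ using (ℚ; mkℚ; 0ℚ; 1ℚ; _+_; _*_; _≤_; _<_; _-_; toℚᵘ; _/_)
open import Data.Rational.Properties
open import Data.Rational.Solver using (module +-*-Solver)
import Data.Rational.Unnormalised as ℚᵘ
import Data.Rational.Unnormalised.Properties as ℚᵘₚ
open import Data.Sum using (_⊎_; inj₁; inj₂)
open import Data.Vec using ([]; _∷_; here; there; _[_]≔_; tabulate)
open import Data.Vec.Properties using ([]=⇒lookup; lookup⇒[]=; lookup∘tabulate)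
open import Function using (_∘_; id; Inverse)
open import Relation.Binary.PropositionalEquality hiding (J)
open import Relation.Nullary using (Dec; yes; no; ¬_; does; contradiction)
open import Relation.Nullary.Decidable using (_×-dec_; ¬?; dec-true)
open import Algebra.Properties.Semiring.Exp (CommutativeRing.semiring +-*-commutativeRing)
  using (_^_; ^-homo-*; ^-assocʳ)
open import Algebra.Properties.Semiring.Sum ℕₚ.+-*-semiring using (sum; sum-cong-≗; ∑-distrib-+)

-- Rational arithmetic and Bernoulli's inequality.

0≤1 : 0ℚ ≤ 1ℚ
0≤1 = nonNegative⁻¹ 1ℚ

mulˡ : ∀ {p q r} → 0ℚ ≤ p → q ≤ r → p * q ≤ p * r
mulˡ {p} 0≤p = *-monoˡ-≤-nonNeg p {{ℚ.nonNegative 0≤p}}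

mulʳ : ∀ {p q r} → 0ℚ ≤ p → q ≤ r → q * p ≤ r * p
mulʳ {p} 0≤p = *-monoʳ-≤-nonNeg p {{ℚ.nonNegative 0≤p}}

mul-mono : ∀ {p q r s} → 0ℚ ≤ q → 0ℚ ≤ r → p ≤ q → r ≤ s → p * r ≤ q * s
mul-mono 0≤q 0≤r p≤q r≤s = ≤-trans (mulʳ 0≤r p≤q) (mulˡ 0≤q r≤s)

0≤* : ∀ {p q} → 0ℚ ≤ p → 0ℚ ≤ q → 0ℚ ≤ p * q
0≤* {p} {q} 0≤p 0≤q = subst (_≤ p * q) (*-zeroʳ p) (mulˡ 0≤p 0≤q)

0≤+ : ∀ {p q} → 0ℚ ≤ p → 0ℚ ≤ q → 0ℚ ≤ p + q
0≤+ 0≤p 0≤q = +-mono-≤ 0≤p 0≤q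

≤+ʳ : ∀ {p q} → 0ℚ ≤ q → p ≤ p + q
≤+ʳ {p} {q} 0≤q = subst (_≤ p + q) (+-identityʳ p) (+-monoʳ-≤ p 0≤q)

ι : ℕ → ℚ
ι k = ℤ.+ k / 1

toℚᵘ-ι : ∀ k → toℚᵘ (ι k) ℚᵘ.≃ ℚᵘ.mkℚᵘ (ℤ.+ k) 0
toℚᵘ-ι k = toℚᵘ-fromℚᵘ (ℚᵘ.mkℚᵘ (ℤ.+ k) 0)

ι-+ : ∀ j k → ι (j ℕ.+ k) ≡ ι j + ι k
ι-+ j k = toℚᵘ-injective (begin
  toℚᵘ (ι (j ℕ.+ k))                           ≈⟨ toℚᵘ-ι (j ℕ.+ k) ⟩
  ℚᵘ.mkℚᵘ (ℤ.+ (j ℕ.+ k)) 0                      ≈⟨ ℚᵘ.*≡* (cong (ℤ._* ℤ.+ 1) (sym (cong₂ ℤ._+_ (ℤₚ.*-identityʳ (ℤ.+ j)) (ℤₚ.*-identityʳ (ℤ.+ k))))) ⟩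
  ℚᵘ.mkℚᵘ (ℤ.+ j) 0 ℚᵘ.+ ℚᵘ.mkℚᵘ (ℤ.+ k) 0         ≈⟨ ℚᵘₚ.+-cong (toℚᵘ-ι j) (toℚᵘ-ι k) ⟨
  toℚᵘ (ι j) ℚᵘ.+ toℚᵘ (ι k)                   ≈⟨ toℚᵘ-homo-+ (ι j) (ι k) ⟨
  toℚᵘ (ι j + ι k)                             ∎)
  where
  open ℚᵘₚ.≃-Reasoning

ι-* : ∀ j k → ι (j ℕ.* k) ≡ ι j * ι k
ι-* j k = toℚᵘ-injective (begin
  toℚᵘ (ι (j ℕ.* k))                           ≈⟨ toℚᵘ-ι (j ℕ.* k) ⟩
  ℚᵘ.mkℚᵘ (ℤ.+ (j ℕ.* k)) 0                      ≈⟨ ℚᵘ.*≡* (cong (ℤ._* ℤ.+ 1) (ℤₚ.pos-* j k)) ⟩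
  ℚᵘ.mkℚᵘ (ℤ.+ j) 0 ℚᵘ.* ℚᵘ.mkℚᵘ (ℤ.+ k) 0         ≈⟨ ℚᵘₚ.*-cong (toℚᵘ-ι j) (toℚᵘ-ι k) ⟨
  toℚᵘ (ι j) ℚᵘ.* toℚᵘ (ι k)                   ≈⟨ toℚᵘ-homo-* (ι j) (ι k) ⟨
  toℚᵘ (ι j * ι k)                             ∎)
  where
  open ℚᵘₚ.≃-Reasoning

0≤ι : ∀ k → 0ℚ ≤ ι k
0≤ι k = nonNegative⁻¹ (ι k) {{normalize-nonNeg k 1}}

ι-mono : ∀ {j k} → j ℕ.≤ k → ι j ≤ ι k
ι-mono {j} {k} j≤k = subst (λ k → ι j ≤ ι k) (ℕₚ.m+[n∸m]≡n j≤k)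
  (subst (ι j ≤_) (sym (ι-+ j (k ℕ.∸ j))) (≤+ʳ (0≤ι (k ℕ.∸ j))))

0≤^ : ∀ {p} → 0ℚ ≤ p → ∀ k → 0ℚ ≤ p ^ k
0≤^ 0≤p zero    = 0≤1
0≤^ 0≤p (suc k) = 0≤* 0≤p (0≤^ 0≤p k)

^-mono : ∀ {p q} → 0ℚ ≤ p → p ≤ q → ∀ k → p ^ k ≤ q ^ k
^-mono 0≤p p≤q zero    = ≤-refl
^-mono 0≤p p≤q (suc k) = mul-mono (≤-trans 0≤p p≤q) (0≤^ 0≤p k) p≤q (^-mono 0≤p p≤q k)

^-* : ∀ p q k → (p * q) ^ k ≡ p ^ k * q ^ k
^-* p q zero    = refl
^-* p q (suc k) = trans (cong (p * q *_) (^-* p q k))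
  (solve 4 (λ p q a b → p :* q :* (a :* b) := p :* a :* (q :* b)) refl p q (p ^ k) (q ^ k))
  where
  open +-*-Solver

1≤^ : ∀ {p} → 1ℚ ≤ p → ∀ k → 1ℚ ≤ p ^ k
1≤^ 1≤p zero    = ≤-refl
1≤^ {p} 1≤p (suc k) = ≤-trans (1≤^ 1≤p k) (subst (_≤ p * p ^ k) (*-identityˡ (p ^ k))
  (mulʳ (0≤^ (≤-trans 0≤1 1≤p) k) 1≤p))

^-monoʳ : ∀ {p} → 1ℚ ≤ p → ∀ {j k} → j ℕ.≤ k → p ^ j ≤ p ^ k
^-monoʳ {p} 1≤p {j} {k} j≤k = begin
  p ^ j                    ≡⟨ *-identityʳ (p ^ j) ⟨
  p ^ j * 1ℚ               ≤⟨ mulˡ (0≤^ (≤-trans 0≤1 1≤p) j) (1≤^ 1≤p (k ℕ.∸ j)) ⟩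
  p ^ j * p ^ (k ℕ.∸ j)    ≡⟨ ^-homo-* p j (k ℕ.∸ j) ⟨
  p ^ (j ℕ.+ (k ℕ.∸ j))    ≡⟨ cong (p ^_) (ℕₚ.m+[n∸m]≡n j≤k) ⟩
  p ^ k                    ∎
  where
  open ≤-Reasoning

bernoulli : ∀ {x} → 0ℚ ≤ x → ∀ k → 1ℚ + ι k * x ≤ (1ℚ + x) ^ k
bernoulli {x} 0≤x zero = ≤-reflexive (trans (cong (1ℚ +_) (*-zeroˡ x)) (+-identityʳ 1ℚ))
bernoulli {x} 0≤x (suc k) = begin
  1ℚ + ι (1 ℕ.+ k) * x                   ≡⟨ cong (λ c → 1ℚ + c * x) (ι-+ 1 k) ⟩
  1ℚ + (1ℚ + ι k) * x                    ≤⟨ ≤+ʳ (0≤* (0≤ι k) (0≤* 0≤x 0≤x)) ⟩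
  1ℚ + (1ℚ + ι k) * x + ι k * (x * x)    ≡⟨ solve 2 (λ x c → con 1ℚ :+ (con 1ℚ :+ c) :* x :+ c :* (x :* x) := (con 1ℚ :+ x) :* (con 1ℚ :+ c :* x)) refl x (ι k) ⟩
  (1ℚ + x) * (1ℚ + ι k * x)              ≤⟨ mulˡ (0≤+ 0≤1 0≤x) (bernoulli 0≤x k) ⟩
  (1ℚ + x) * (1ℚ + x) ^ k                ∎
  where
  open ≤-Reasoning
  open +-*-Solver

-- Serves as the upper bound `1 / (1 - k x)` for powers. The product form remains true when
-- `1 - k x` is negative, so the induction carries no bound on `k x`.
bernoulli⁻ : ∀ {x} → 0ℚ ≤ x → ∀ k → (1ℚ + x) ^ k * (1ℚ - ι k * x) ≤ 1ℚ
bernoulli⁻ {x} 0≤x zero = ≤-reflexive (solve 1 (λ x → con 1ℚ :* (con 1ℚ :- con 0ℚ :* x) := con 1ℚ) refl x)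
  where
  open +-*-Solver
bernoulli⁻ {x} 0≤x (suc k) = begin
  (1ℚ + x) * (1ℚ + x) ^ k * (1ℚ - ι (1 ℕ.+ k) * x)
    ≡⟨ cong (λ c → (1ℚ + x) * (1ℚ + x) ^ k * (1ℚ - c * x)) (ι-+ 1 k) ⟩
  (1ℚ + x) * (1ℚ + x) ^ k * (1ℚ - (1ℚ + ι k) * x)
    ≤⟨ ≤+ʳ (0≤* (0≤^ (0≤+ 0≤1 0≤x) k) (0≤* (0≤+ 0≤1 (0≤ι k)) (0≤* 0≤x 0≤x))) ⟩
  (1ℚ + x) * (1ℚ + x) ^ k * (1ℚ - (1ℚ + ι k) * x) + (1ℚ + x) ^ k * ((1ℚ + ι k) * (x * x))
    ≡⟨ solve 3 (λ x c y → (con 1ℚ :+ x) :* y :* (con 1ℚ :- (con 1ℚ :+ c) :* x) :+ y :* ((con 1ℚ :+ c) :* (x :* x))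
         := y :* (con 1ℚ :- c :* x)) refl x (ι k) ((1ℚ + x) ^ k) ⟩
  (1ℚ + x) ^ k * (1ℚ - ι k * x)
    ≤⟨ bernoulli⁻ 0≤x k ⟩
  1ℚ ∎
  where
  open ≤-Reasoning
  open +-*-Solver

-- Sums over all subsets of a finite set.

when : {P : Set} → Dec P → ℚ → ℚ
when (yes _) q = q
when (no _)  q = 0ℚ

0≤when : {P : Set} (P? : Dec P) {q : ℚ} → 0ℚ ≤ q → 0ℚ ≤ when P? q
0≤when (yes _) 0≤q = 0≤q
0≤when (no _)  0≤q = ≤-refl

when-mono : {P Q : Set} (P? : Dec P) (Q? : Dec Q) {p q : ℚ} → (P → Q) → 0ℚ ≤ q → p ≤ q → when P? p ≤ when Q? q
when-mono (no _)  Q?      f 0≤q p≤q = 0≤when Q? 0≤q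
when-mono (yes p) (yes _) f 0≤q p≤q = p≤q
when-mono (yes p) (no ¬q) f 0≤q p≤q = contradiction (f p) ¬q

when-⇔ : {P Q : Set} (P? : Dec P) (Q? : Dec Q) → (P → Q) → (Q → P) → ∀ q → when P? q ≡ when Q? q
when-⇔ (yes p) (yes _)  f g q = refl
when-⇔ (yes p) (no ¬q)  f g q = contradiction (f p) ¬q
when-⇔ (no ¬p) (yes q′) f g q = contradiction (g q′) ¬p
when-⇔ (no _)  (no _)   f g q = refl

when-true : {P : Set} → P → (P? : Dec P) → ∀ q → when P? q ≡ q
when-true p (yes _) q = refl
when-true p (no ¬p) q = contradiction p ¬p

when-* : {P : Set} (P? : Dec P) (p q : ℚ) → when P? (p * q) ≡ p * when P? q
when-* (yes _) p q = refl
when-* (no _)  p q = sym (*-zeroʳ p)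

∑ˢ : ∀ {N} → (Subset N → ℚ) → ℚ
∑ˢ {zero}  f = f []
∑ˢ {suc N} f = ∑ˢ (f ∘ (inside ∷_)) + ∑ˢ (f ∘ (outside ∷_))

∑ˢ-mono : ∀ {N} {f g : Subset N → ℚ} → (∀ I → f I ≤ g I) → ∑ˢ f ≤ ∑ˢ g
∑ˢ-mono {zero}  f≤g = f≤g []
∑ˢ-mono {suc N} f≤g = +-mono-≤ (∑ˢ-mono (f≤g ∘ (inside ∷_))) (∑ˢ-mono (f≤g ∘ (outside ∷_)))

∑ˢ-cong : ∀ {N} {f g : Subset N → ℚ} → (∀ I → f I ≡ g I) → ∑ˢ f ≡ ∑ˢ g
∑ˢ-cong {zero}  f≡g = f≡g []
∑ˢ-cong {suc N} f≡g = cong₂ _+_ (∑ˢ-cong (f≡g ∘ (inside ∷_))) (∑ˢ-cong (f≡g ∘ (outside ∷_)))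

∑ˢ-zero : ∀ {N} {f : Subset N → ℚ} → (∀ I → f I ≡ 0ℚ) → ∑ˢ f ≡ 0ℚ
∑ˢ-zero {zero}  f≡0 = f≡0 []
∑ˢ-zero {suc N} f≡0 = cong₂ _+_ (∑ˢ-zero (f≡0 ∘ (inside ∷_))) (∑ˢ-zero (f≡0 ∘ (outside ∷_)))

∑ˢ-* : ∀ {N} c (f : Subset N → ℚ) → ∑ˢ (λ I → c * f I) ≡ c * ∑ˢ f
∑ˢ-* {zero}  c f = refl
∑ˢ-* {suc N} c f = trans (cong₂ _+_ (∑ˢ-* c (f ∘ (inside ∷_))) (∑ˢ-* c (f ∘ (outside ∷_)))) (sym (*-distribˡ-+ c _ _))

∑ˢ-+ : ∀ {N} (f g : Subset N → ℚ) → ∑ˢ (λ I → f I + g I) ≡ ∑ˢ f + ∑ˢ g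
∑ˢ-+ {zero}  f g = refl
∑ˢ-+ {suc N} f g = trans (cong₂ _+_ (∑ˢ-+ (f ∘ (inside ∷_)) (g ∘ (inside ∷_))) (∑ˢ-+ (f ∘ (outside ∷_)) (g ∘ (outside ∷_))))
  (solve 4 (λ a b c d → a :+ b :+ (c :+ d) := a :+ c :+ (b :+ d)) refl
    (∑ˢ (f ∘ (inside ∷_))) (∑ˢ (g ∘ (inside ∷_))) (∑ˢ (f ∘ (outside ∷_))) (∑ˢ (g ∘ (outside ∷_))))
  where
  open +-*-Solver

∑ˢ-comm : ∀ {M N} (f : Subset M → Subset N → ℚ) → ∑ˢ (λ I → ∑ˢ (f I)) ≡ ∑ˢ (λ J → ∑ˢ (λ I → f I J))
∑ˢ-comm {zero}  f = refl
∑ˢ-comm {suc M} f = trans (cong₂ _+_ (∑ˢ-comm (f ∘ (inside ∷_))) (∑ˢ-comm (f ∘ (outside ∷_))))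
  (sym (∑ˢ-+ (λ J → ∑ˢ (λ I → f (inside ∷ I) J)) (λ J → ∑ˢ (λ I → f (outside ∷ I) J))))

0≤∑ˢ : ∀ {N} {f : Subset N → ℚ} → (∀ I → 0ℚ ≤ f I) → 0ℚ ≤ ∑ˢ f
0≤∑ˢ {zero}  0≤f = 0≤f []
0≤∑ˢ {suc N} 0≤f = 0≤+ (0≤∑ˢ (0≤f ∘ (inside ∷_))) (0≤∑ˢ (0≤f ∘ (outside ∷_)))

-- Each set containing `v` is `I [ v ]≔ inside` for a unique `I` without `v`. The sums on the right
-- also run over sets that contain `v`; those terms are nonnegative, and keeping them avoids sums
-- restricted to the sets without `v`.
∑ˢ-split : ∀ {N} (v : Fin N) {f g h : Subset N → ℚ} → (∀ I → 0ℚ ≤ g I) → (∀ I → 0ℚ ≤ h I) →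
  (∀ I → v ∉ I → f I ≤ g I) → (∀ I → v ∉ I → f (I [ v ]≔ inside) ≤ h I) → ∑ˢ f ≤ ∑ˢ g + ∑ˢ h
∑ˢ-split zero {f} {g} {h} 0≤g 0≤h f≤g f≤h = begin
  ∑ˢ (f ∘ (inside ∷_)) + ∑ˢ (f ∘ (outside ∷_))
    ≤⟨ +-mono-≤ (∑ˢ-mono λ I → f≤h (outside ∷ I) λ ()) (∑ˢ-mono λ I → f≤g (outside ∷ I) λ ()) ⟩
  ∑ˢ (h ∘ (outside ∷_)) + ∑ˢ (g ∘ (outside ∷_))
    ≤⟨ ≤+ʳ (0≤+ (0≤∑ˢ (0≤h ∘ (inside ∷_))) (0≤∑ˢ (0≤g ∘ (inside ∷_)))) ⟩
  ∑ˢ (h ∘ (outside ∷_)) + ∑ˢ (g ∘ (outside ∷_)) + (∑ˢ (h ∘ (inside ∷_)) + ∑ˢ (g ∘ (inside ∷_)))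
    ≡⟨ solve 4 (λ a b c d → a :+ b :+ (c :+ d) := d :+ b :+ (c :+ a)) refl
         (∑ˢ (h ∘ (outside ∷_))) (∑ˢ (g ∘ (outside ∷_))) (∑ˢ (h ∘ (inside ∷_))) (∑ˢ (g ∘ (inside ∷_))) ⟩
  ∑ˢ g + ∑ˢ h ∎
  where
  open ≤-Reasoning
  open +-*-Solver
∑ˢ-split (suc v) {f} {g} {h} 0≤g 0≤h f≤g f≤h = begin
  ∑ˢ (f ∘ (inside ∷_)) + ∑ˢ (f ∘ (outside ∷_))
    ≤⟨ +-mono-≤ (half inside) (half outside) ⟩
  (∑ˢ (g ∘ (inside ∷_)) + ∑ˢ (h ∘ (inside ∷_))) + (∑ˢ (g ∘ (outside ∷_)) + ∑ˢ (h ∘ (outside ∷_)))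
    ≡⟨ solve 4 (λ a b c d → a :+ b :+ (c :+ d) := a :+ c :+ (b :+ d)) refl
         (∑ˢ (g ∘ (inside ∷_))) (∑ˢ (h ∘ (inside ∷_))) (∑ˢ (g ∘ (outside ∷_))) (∑ˢ (h ∘ (outside ∷_))) ⟩
  ∑ˢ g + ∑ˢ h ∎
  where
  open ≤-Reasoning
  open +-*-Solver
  half : ∀ b → ∑ˢ (f ∘ (b ∷_)) ≤ ∑ˢ (g ∘ (b ∷_)) + ∑ˢ (h ∘ (b ∷_))
  half b = ∑ˢ-split v (0≤g ∘ (b ∷_)) (0≤h ∘ (b ∷_))
    (λ I v∉ → f≤g (b ∷ I) λ { (there v∈) → v∉ v∈ }) (λ I v∉ → f≤h (b ∷ I) λ { (there v∈) → v∉ v∈ })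

∑ˢ-⊆ : ∀ {N} λ′ (B : Subset N) → ∑ˢ (λ I → when (I ⊆? B) (λ′ ^ ∣ I ∣)) ≡ (1ℚ + λ′) ^ ∣ B ∣
∑ˢ-⊆ λ′ [] = refl
∑ˢ-⊆ λ′ (inside ∷ B) = begin
  ∑ˢ (λ I → when (inside ∷ I ⊆? inside ∷ B) (λ′ * λ′ ^ ∣ I ∣)) + ∑ˢ (λ I → when (outside ∷ I ⊆? inside ∷ B) (λ′ ^ ∣ I ∣))
    ≡⟨ cong₂ _+_ (trans (∑ˢ-cong λ I → trans (when-⇔ (inside ∷ I ⊆? inside ∷ B) (I ⊆? B) drop-∷-⊆ s⊆s _) (when-* (I ⊆? B) λ′ _))
                        (∑ˢ-* λ′ (λ I → when (I ⊆? B) (λ′ ^ ∣ I ∣))))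
                 (∑ˢ-cong λ I → when-⇔ (outside ∷ I ⊆? inside ∷ B) (I ⊆? B) drop-∷-⊆ out⊆ _) ⟩
  λ′ * ∑ˢ (λ I → when (I ⊆? B) (λ′ ^ ∣ I ∣)) + ∑ˢ (λ I → when (I ⊆? B) (λ′ ^ ∣ I ∣))
    ≡⟨ cong (λ z → λ′ * z + z) (∑ˢ-⊆ λ′ B) ⟩
  λ′ * (1ℚ + λ′) ^ ∣ B ∣ + (1ℚ + λ′) ^ ∣ B ∣
    ≡⟨ solve 2 (λ l z → l :* z :+ z := (con 1ℚ :+ l) :* z) refl λ′ ((1ℚ + λ′) ^ ∣ B ∣) ⟩
  (1ℚ + λ′) ^ suc ∣ B ∣ ∎
  where
  open ≡-Reasoning
  open +-*-Solver
∑ˢ-⊆ λ′ (outside ∷ B) = begin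
  ∑ˢ (λ I → when (inside ∷ I ⊆? outside ∷ B) (λ′ * λ′ ^ ∣ I ∣)) + ∑ˢ (λ I → when (outside ∷ I ⊆? outside ∷ B) (λ′ ^ ∣ I ∣))
    ≡⟨ cong₂ _+_ (∑ˢ-zero λ I → when-⇔ (inside ∷ I ⊆? outside ∷ B) (no λ ()) no-in (λ ()) (λ′ * λ′ ^ ∣ I ∣))
                 (∑ˢ-cong λ I → when-⇔ (outside ∷ I ⊆? outside ∷ B) (I ⊆? B) drop-∷-⊆ out⊆ _) ⟩
  0ℚ + ∑ˢ (λ I → when (I ⊆? B) (λ′ ^ ∣ I ∣))
    ≡⟨ trans (+-identityˡ _) (∑ˢ-⊆ λ′ B) ⟩
  (1ℚ + λ′) ^ ∣ B ∣ ∎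
  where
  open ≡-Reasoning
  no-in : ∀ {I} → ¬ (inside ∷ I ⊆ outside ∷ B)
  no-in s with s here
  ... | ()

∣∣≡sum : ∀ {N} (B : Subset N) → ∣ B ∣ ≡ sum (λ i → 𝟙 (i ∈? B))
∣∣≡sum [] = refl
∣∣≡sum {suc N} (b ∷ B) = trans (head b) (cong (𝟙 (zero ∈? b ∷ B) ℕ.+_) (trans (∣∣≡sum B)
  (sum-cong-≗ {N} λ i → ℕₚ.≤-antisym (𝟙-mono there (i ∈? B) (suc i ∈? b ∷ B)) (𝟙-mono drop-there (suc i ∈? b ∷ B) (i ∈? B)))))
  where
  head : ∀ b → ∣ b ∷ B ∣ ≡ 𝟙 (zero ∈? b ∷ B) ℕ.+ ∣ B ∣
  head inside  = refl
  head outside = refl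

module _ {N} {P : Fin N → Set} (P? : ∀ i → Dec (P i)) where

  comprehension : Subset N
  comprehension = tabulate (does ∘ P?)

  ∈-comprehension⁺ : ∀ {i} → P i → i ∈ comprehension
  ∈-comprehension⁺ {i} p = lookup⇒[]= i comprehension (trans (lookup∘tabulate (does ∘ P?) i) (dec-true (P? i) p))

  ∈-comprehension⁻ : ∀ {i} → i ∈ comprehension → P i
  ∈-comprehension⁻ {i} i∈ with P? i | trans (sym (lookup∘tabulate (does ∘ P?) i)) ([]=⇒lookup i∈)
  ... | yes p | _ = p

-- The recursion for the hard-core partition function.

-- The partition function of the hard-core model.  Independence is any hereditary
-- property under which adjacent vertices exclude each other.
module HardCore {N : ℕ}
  {Adj : Fin N → Fin N → Set} (adj? : ∀ i j → Dec (Adj i j)) (irreflexive : ∀ i → ¬ Adj i i)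
  {Ind : Subset N → Set} (ind? : ∀ I → Dec (Ind I))
  (hereditary : ∀ {I J} → I ⊆ J → Ind J → Ind I)
  (exclusive : ∀ {J i j} → Ind J → i ∈ J → j ∈ J → ¬ Adj i j) where

  degreeIn : Subset N → Fin N → ℕ
  degreeIn B v = sum λ j → 𝟙 (j ∈? B ×-dec adj? v j)

  Z : ℚ → Subset N → ℚ
  Z λ′ B = ∑ˢ λ I → when (ind? I ×-dec I ⊆? B) (λ′ ^ ∣ I ∣)

  deleteVertex? : (B : Subset N) → ∀ v i → Dec (i ∈ B × v ≢ i)
  deleteVertex? B v i = i ∈? B ×-dec ¬? (v Fin.≟ i)

  deleteStar? : (B : Subset N) → ∀ v i → Dec (i ∈ B × v ≢ i × ¬ Adj v i)
  deleteStar? B v i = i ∈? B ×-dec ¬? (v Fin.≟ i) ×-dec ¬? (adj? v i)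

  deleteVertex : Subset N → Fin N → Subset N
  deleteVertex B v = comprehension (deleteVertex? B v)

  deleteStar : Subset N → Fin N → Subset N
  deleteStar B v = comprehension (deleteStar? B v)

  sum-≟ : ∀ {M} (v : Fin M) → 1 ℕ.≤ sum (λ i → 𝟙 (v Fin.≟ i))
  sum-≟ v = ℕₚ.≤-trans (ℕₚ.≤-reflexive (sym (𝟙-true refl (v Fin.≟ v)))) (term≤sum (λ i → 𝟙 (v Fin.≟ i)) v)

  ∣deleteVertex∣ : ∀ {B v} → v ∈ B → suc (∣ deleteVertex B v ∣) ℕ.≤ ∣ B ∣
  ∣deleteVertex∣ {B} {v} v∈B = begin
    suc (∣ U ∣)
      ≤⟨ ℕₚ.+-monoˡ-≤ (∣ U ∣) (sum-≟ v) ⟩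
    sum (λ i → 𝟙 (v Fin.≟ i)) ℕ.+ ∣ U ∣
      ≡⟨ cong (sum (λ i → 𝟙 (v Fin.≟ i)) ℕ.+_) (∣∣≡sum U) ⟩
    sum (λ i → 𝟙 (v Fin.≟ i)) ℕ.+ sum (λ i → 𝟙 (i ∈? U))
      ≡⟨ ∑-distrib-+ (λ i → 𝟙 (v Fin.≟ i)) (λ i → 𝟙 (i ∈? U)) ⟨
    sum (λ i → 𝟙 (v Fin.≟ i) ℕ.+ 𝟙 (i ∈? U))
      ≤⟨ sum-mono (λ i → pointwise i (v Fin.≟ i)) ⟩
    sum (λ i → 𝟙 (i ∈? B))
      ≡⟨ ∣∣≡sum B ⟨
    ∣ B ∣ ∎
    where
    open ℕₚ.≤-Reasoning
    U = deleteVertex B v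
    U? = deleteVertex? B v
    pointwise : ∀ i (e? : Dec (v ≡ i)) → 𝟙 e? ℕ.+ 𝟙 (i ∈? U) ℕ.≤ 𝟙 (i ∈? B)
    pointwise i (yes refl) = ℕₚ.≤-reflexive (trans
      (cong suc (𝟙-false (λ i∈ → proj₂ (∈-comprehension⁻ U? i∈) refl) (i ∈? U))) (sym (𝟙-true v∈B (i ∈? B))))
    pointwise i (no _) = 𝟙-mono (proj₁ ∘ ∈-comprehension⁻ U?) (i ∈? U) (i ∈? B)

  ∣deleteStar∣ : ∀ {B v} → v ∈ B → suc (degreeIn B v ℕ.+ ∣ deleteStar B v ∣) ℕ.≤ ∣ B ∣
  ∣deleteStar∣ {B} {v} v∈B = begin
    suc (degreeIn B v ℕ.+ ∣ U ∣)
      ≤⟨ ℕₚ.+-monoˡ-≤ (degreeIn B v ℕ.+ ∣ U ∣) (sum-≟ v) ⟩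
    sum (λ i → 𝟙 (v Fin.≟ i)) ℕ.+ (degreeIn B v ℕ.+ ∣ U ∣)
      ≡⟨ cong (λ c → sum (λ i → 𝟙 (v Fin.≟ i)) ℕ.+ (degreeIn B v ℕ.+ c)) (∣∣≡sum U) ⟩
    sum (λ i → 𝟙 (v Fin.≟ i)) ℕ.+ (degreeIn B v ℕ.+ sum (λ i → 𝟙 (i ∈? U)))
      ≡⟨ trans (∑-distrib-+ (λ i → 𝟙 (v Fin.≟ i)) _) (cong (sum (λ i → 𝟙 (v Fin.≟ i)) ℕ.+_)
           (∑-distrib-+ (λ j → 𝟙 (j ∈? B ×-dec adj? v j)) (λ i → 𝟙 (i ∈? U)))) ⟨
    sum (λ i → 𝟙 (v Fin.≟ i) ℕ.+ (𝟙 (i ∈? B ×-dec adj? v i) ℕ.+ 𝟙 (i ∈? U)))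
      ≤⟨ sum-mono (λ i → pointwise i (v Fin.≟ i) (i ∈? B ×-dec adj? v i)) ⟩
    sum (λ i → 𝟙 (i ∈? B))
      ≡⟨ ∣∣≡sum B ⟨
    ∣ B ∣ ∎
    where
    open ℕₚ.≤-Reasoning
    U = deleteStar B v
    U? = deleteStar? B v
    pointwise : ∀ i (e? : Dec (v ≡ i)) (a? : Dec (i ∈ B × Adj v i)) →
      𝟙 e? ℕ.+ (𝟙 a? ℕ.+ 𝟙 (i ∈? U)) ℕ.≤ 𝟙 (i ∈? B)
    pointwise i (yes refl) (yes (_ , a)) = contradiction a (irreflexive v)
    pointwise i (yes refl) (no _) = ℕₚ.≤-reflexive (trans
      (cong suc (𝟙-false (λ i∈ → proj₁ (proj₂ (∈-comprehension⁻ U? i∈)) refl) (i ∈? U))) (sym (𝟙-true v∈B (i ∈? B))))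
    pointwise i (no _) (yes (i∈B , a)) = ℕₚ.≤-reflexive (trans
      (cong suc (𝟙-false (λ i∈ → proj₂ (proj₂ (∈-comprehension⁻ U? i∈)) a) (i ∈? U))) (sym (𝟙-true i∈B (i ∈? B))))
    pointwise i (no _) (no _) = 𝟙-mono (proj₁ ∘ ∈-comprehension⁻ U?) (i ∈? U) (i ∈? B)

  ∣[]≔inside∣ : ∀ {M} (I : Subset M) v → v ∉ I → ∣ I [ v ]≔ inside ∣ ≡ suc (∣ I ∣)
  ∣[]≔inside∣ (inside ∷ I)  zero    v∉ = contradiction here v∉
  ∣[]≔inside∣ (outside ∷ I) zero    v∉ = refl
  ∣[]≔inside∣ (inside ∷ I)  (suc v) v∉ = cong suc (∣[]≔inside∣ I v (v∉ ∘ there))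
  ∣[]≔inside∣ (outside ∷ I) (suc v) v∉ = ∣[]≔inside∣ I v (v∉ ∘ there)

  v∈[v]≔inside : ∀ {M} (I : Subset M) v → v ∈ I [ v ]≔ inside
  v∈[v]≔inside (_ ∷ I) zero    = here
  v∈[v]≔inside (_ ∷ I) (suc v) = there (v∈[v]≔inside I v)

  ⊆[]≔inside : ∀ {M} (I : Subset M) v → I ⊆ I [ v ]≔ inside
  ⊆[]≔inside (b ∷ I) zero    here       = here
  ⊆[]≔inside (b ∷ I) zero    (there i∈) = there i∈
  ⊆[]≔inside (b ∷ I) (suc v) here       = here
  ⊆[]≔inside (b ∷ I) (suc v) (there i∈) = there (⊆[]≔inside I v i∈)

  module _ {λ′ : ℚ} (0≤λ : 0ℚ ≤ λ′) where

    -- Taking `v` out of an independent set that contains it costs the factor `λ′`, and `exclusive`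
    -- keeps the rest away from the neighbours of `v`.
    Z-step : ∀ {B v} → Z λ′ B ≤ Z λ′ (deleteVertex B v) + λ′ * Z λ′ (deleteStar B v)
    Z-step {B} {v} = subst (Z λ′ B ≤_) (cong (Z λ′ (deleteVertex B v) +_) (∑ˢ-* λ′ (term (deleteStar B v))))
      (∑ˢ-split v (0≤term (deleteVertex B v)) (λ I → 0≤* 0≤λ (0≤term (deleteStar B v) I)) avoid contain)
      where
      term : Subset N → Subset N → ℚ
      term U I = when (ind? I ×-dec I ⊆? U) (λ′ ^ ∣ I ∣)
      0≤term : ∀ U I → 0ℚ ≤ term U I
      0≤term U I = 0≤when (ind? I ×-dec I ⊆? U) (0≤^ 0≤λ ∣ I ∣)
      avoid : ∀ I → v ∉ I → term B I ≤ term (deleteVertex B v) I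
      avoid I v∉I = when-mono (ind? I ×-dec I ⊆? B) (ind? I ×-dec I ⊆? deleteVertex B v)
        (λ (ind , I⊆B) → ind , λ i∈I → ∈-comprehension⁺ (deleteVertex? B v) (I⊆B i∈I , λ { refl → v∉I i∈I }))
        (0≤^ 0≤λ ∣ I ∣) ≤-refl
      contain : ∀ I → v ∉ I → term B (I [ v ]≔ inside) ≤ λ′ * term (deleteStar B v) I
      contain I v∉I = subst (term B J ≤_) (when-* (ind? I ×-dec I ⊆? deleteStar B v) λ′ (λ′ ^ ∣ I ∣))
        (when-mono (ind? J ×-dec J ⊆? B) (ind? I ×-dec I ⊆? deleteStar B v)
          (λ (ind , J⊆B) → hereditary (⊆[]≔inside I v) ind , λ i∈I → ∈-comprehension⁺ (deleteStar? B v)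
            (J⊆B (⊆[]≔inside I v i∈I) , (λ { refl → v∉I i∈I }) , exclusive ind (v∈[v]≔inside I v) (⊆[]≔inside I v i∈I)))
          (0≤* 0≤λ (0≤^ 0≤λ ∣ I ∣)) (≤-reflexive (cong (λ′ ^_) (∣[]≔inside∣ I v v∉I))))
        where J = I [ v ]≔ inside

    Z-empty : ∀ {B} → ∣ B ∣ ≡ 0 → Z λ′ B ≤ 1ℚ
    Z-empty {B} e = begin
      Z λ′ B                                   ≤⟨ ∑ˢ-mono (λ I → when-mono (ind? I ×-dec I ⊆? B) (I ⊆? B) proj₂ (0≤^ 0≤λ ∣ I ∣) ≤-refl) ⟩
      ∑ˢ (λ I → when (I ⊆? B) (λ′ ^ ∣ I ∣))    ≡⟨ ∑ˢ-⊆ λ′ B ⟩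
      (1ℚ + λ′) ^ ∣ B ∣                        ≡⟨ cong ((1ℚ + λ′) ^_) e ⟩
      1ℚ                                       ∎
      where
      open ≤-Reasoning

  -- Bounding the partition function by a potential.

  module Potential (inc : ℕ → ℕ) (antitone : ∀ {i j} → i ℕ.≤ j → inc j ℕ.≤ inc i) where

    -- The bound aimed at is `Z λ′ B ≤ β ^ Φ b` for sets of `b` vertices; `inc b` is the exponent
    -- spent on passing from `b - 1` to `b` vertices.
    Φ : ℕ → ℕ
    Φ zero    = 0
    Φ (suc b) = inc (suc b) ℕ.+ Φ b

    Φ-mono : ∀ {i j} → i ℕ.≤ j → Φ i ℕ.≤ Φ j
    Φ-mono {j = zero} ℕ.z≤n = ℕ.z≤n
    Φ-mono {j = suc j} ℕ.z≤n = ℕ.z≤n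
    Φ-mono {suc i} {suc j} i<j with i ℕ.≟ j
    ... | yes refl = ℕₚ.≤-refl
    ... | no i≢j   = ℕₚ.≤-trans (Φ-mono (ℕₚ.≤∧≢⇒< (ℕ.s≤s⁻¹ i<j) i≢j)) (ℕₚ.m≤n+m (Φ j) (inc (suc j)))

    -- Because `inc` is antitone, dropping `d` vertices saves at least `d` times the increment that
    -- belongs to a larger set.
    Φ-gap : ∀ d i {k} → d ℕ.+ i ℕ.≤ k → inc (suc k) ℕ.* d ℕ.+ Φ i ℕ.≤ Φ (d ℕ.+ i)
    Φ-gap zero    i {k} _ = ℕₚ.≤-reflexive (cong (ℕ._+ Φ i) (ℕₚ.*-zeroʳ (inc (suc k))))
    Φ-gap (suc d) i {k} le = begin
      inc (suc k) ℕ.* suc d ℕ.+ Φ i                 ≡⟨ cong (ℕ._+ Φ i) (ℕₚ.*-suc (inc (suc k)) d) ⟩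
      inc (suc k) ℕ.+ inc (suc k) ℕ.* d ℕ.+ Φ i     ≡⟨ ℕₚ.+-assoc (inc (suc k)) _ _ ⟩
      inc (suc k) ℕ.+ (inc (suc k) ℕ.* d ℕ.+ Φ i)   ≤⟨ ℕₚ.+-mono-≤ (antitone (ℕₚ.m≤n⇒m≤1+n le)) (Φ-gap d i (ℕₚ.≤-trans (ℕₚ.n≤1+n _) le)) ⟩
      inc (suc d ℕ.+ i) ℕ.+ Φ (d ℕ.+ i)             ∎
      where
      open ℕₚ.≤-Reasoning

    module _ (T w : ℕ) {x : ℚ} (0≤x : 0ℚ ≤ x) (xT : ι T * x ≡ 1ℚ)
      (good : ∀ B b → ∣ B ∣ ≡ suc b → ∃ λ v → v ∈ B ×
        w ℕ.* T ℕ.≤ inc (suc b) ℕ.* (T ℕ.+ inc (suc b) ℕ.* degreeIn B v)) where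

      private
        β = 1ℚ + x
        λ′ = ι w * x
        1≤β : 1ℚ ≤ β
        1≤β = ≤+ʳ 0≤x
        0≤β^ : ∀ k → 0ℚ ≤ β ^ k
        0≤β^ = 0≤^ (≤-trans 0≤1 1≤β)
        0≤λ′ : 0ℚ ≤ λ′
        0≤λ′ = 0≤* (0≤ι w) 0≤x

      -- The hypothesis divided by `T²`, where `x = 1 / T`.
      fugacity≤ : ∀ g d → w ℕ.* T ℕ.≤ g ℕ.* (T ℕ.+ g ℕ.* d) → λ′ ≤ ι g * x * (1ℚ + ι (g ℕ.* d) * x)
      fugacity≤ g d le = begin
        ι w * x                                 ≡⟨ trans (sym (*-identityʳ (ι w * x))) (cong (ι w * x *_) (sym xT)) ⟩
        ι w * x * (ι T * x)                     ≡⟨ solve 3 (λ w t x → w :* x :* (t :* x) := w :* t :* (x :* x)) refl (ι w) (ι T) x ⟩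
        ι w * ι T * (x * x)                     ≡⟨ cong (_* (x * x)) (sym (ι-* w T)) ⟩
        ι (w ℕ.* T) * (x * x)                   ≤⟨ mulʳ (0≤* 0≤x 0≤x) (ι-mono le) ⟩
        ι (g ℕ.* (T ℕ.+ g ℕ.* d)) * (x * x)     ≡⟨ cong (_* (x * x)) (trans (ι-* g (T ℕ.+ g ℕ.* d)) (cong (ι g *_) (ι-+ T (g ℕ.* d)))) ⟩
        ι g * (ι T + ι (g ℕ.* d)) * (x * x)     ≡⟨ solve 4 (λ g t d x → g :* (t :+ d) :* (x :* x) := g :* x :* (t :* x :+ d :* x)) refl (ι g) (ι T) (ι (g ℕ.* d)) x ⟩
        ι g * x * (ι T * x + ι (g ℕ.* d) * x)   ≡⟨ cong (λ o → ι g * x * (o + ι (g ℕ.* d) * x)) xT ⟩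
        ι g * x * (1ℚ + ι (g ℕ.* d) * x)        ∎
        where
        open ≤-Reasoning
        open +-*-Solver

      -- Strong induction on `b`, made structural by `fuel`: deleting a star lowers the size by an
      -- amount that is not known in advance.
      Z≤fuel : ∀ fuel b → b ℕ.≤ fuel → ∀ B → ∣ B ∣ ℕ.≤ b → Z λ′ B ≤ β ^ Φ b
      Z≤fuel fuel zero _ B ∣B∣≤ = Z-empty 0≤λ′ (ℕₚ.n≤0⇒n≡0 ∣B∣≤)
      Z≤fuel (suc fuel) (suc b) (ℕ.s≤s b≤) B ∣B∣≤ with ∣ B ∣ ℕ.≟ suc b
      ... | no ≢ = ≤-trans (Z≤fuel fuel b b≤ B (ℕ.s≤s⁻¹ (ℕₚ.≤∧≢⇒< ∣B∣≤ ≢))) (^-monoʳ 1≤β (Φ-mono (ℕₚ.n≤1+n b)))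
      ... | yes e with good B b e
      ... | v , v∈B , le = begin
        Z λ′ B
          ≤⟨ Z-step 0≤λ′ ⟩
        Z λ′ (deleteVertex B v) + λ′ * Z λ′ (deleteStar B v)
          ≤⟨ +-mono-≤ (Z≤fuel fuel b b≤ _ (ℕ.s≤s⁻¹ (ℕₚ.≤-trans (∣deleteVertex∣ v∈B) (ℕₚ.≤-reflexive e))))
               (mulˡ 0≤λ′ (Z≤fuel fuel b′ (ℕₚ.≤-trans (ℕₚ.m≤n+m b′ d) (ℕₚ.≤-trans d+b′≤b b≤)) _ ℕₚ.≤-refl)) ⟩
        β ^ Φ b + λ′ * β ^ Φ b′
          ≤⟨ +-monoʳ-≤ (β ^ Φ b) (mulʳ (0≤β^ (Φ b′)) (fugacity≤ g d le)) ⟩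
        β ^ Φ b + ι g * x * (1ℚ + ι (g ℕ.* d) * x) * β ^ Φ b′
          -- The surplus `1 + g d x` becomes `β ^ (g d)`, which is exactly what the smaller
          -- potential leaves free, as `g d + Φ b′ ≤ Φ b`. So the second term is at most `g x` times
          -- the first.
          ≤⟨ +-monoʳ-≤ (β ^ Φ b) (mulʳ (0≤β^ (Φ b′)) (mulˡ (0≤* (0≤ι g) 0≤x) (bernoulli 0≤x (g ℕ.* d)))) ⟩
        β ^ Φ b + ι g * x * β ^ (g ℕ.* d) * β ^ Φ b′
          ≡⟨ cong (β ^ Φ b +_) (trans (*-assoc (ι g * x) _ _) (cong (ι g * x *_) (sym (^-homo-* β (g ℕ.* d) (Φ b′))))) ⟩
        β ^ Φ b + ι g * x * β ^ (g ℕ.* d ℕ.+ Φ b′)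
          ≤⟨ +-monoʳ-≤ (β ^ Φ b) (mulˡ (0≤* (0≤ι g) 0≤x) (^-monoʳ 1≤β (ℕₚ.≤-trans (Φ-gap d b′ d+b′≤b) (Φ-mono d+b′≤b)))) ⟩
        β ^ Φ b + ι g * x * β ^ Φ b
          ≡⟨ solve 2 (λ p y → p :+ y :* p := (con 1ℚ :+ y) :* p) refl (β ^ Φ b) (ι g * x) ⟩
        (1ℚ + ι g * x) * β ^ Φ b
          ≤⟨ mulʳ (0≤β^ (Φ b)) (bernoulli 0≤x g) ⟩
        β ^ g * β ^ Φ b
          ≡⟨ ^-homo-* β g (Φ b) ⟨
        β ^ Φ (suc b) ∎
        where
        open ≤-Reasoning
        open +-*-Solver
        g  = inc (suc b)
        d  = degreeIn B v
        b′ = ∣ deleteStar B v ∣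
        d+b′≤b : d ℕ.+ b′ ℕ.≤ b
        d+b′≤b = ℕ.s≤s⁻¹ (ℕₚ.≤-trans (∣deleteStar∣ v∈B) (ℕₚ.≤-reflexive e))

      Z≤β^Φ : ∀ B → Z λ′ B ≤ β ^ Φ ∣ B ∣
      Z≤β^Φ B = Z≤fuel ∣ B ∣ ∣ B ∣ ℕₚ.≤-refl B ℕₚ.≤-refl

-- Product weights and the moment bound.

-- The two factors are separate parameters: with `b = |1 - a|` and `a ≥ 0` all weights are
-- nonnegative, even if the rational `a` approximating a probability exceeds 1.
weight : ∀ {N} → ℚ → ℚ → Subset N → ℚ
weight a b []            = 1ℚ
weight a b (inside  ∷ S) = a * weight a b S
weight a b (outside ∷ S) = b * weight a b S

0≤weight : ∀ {N a b} → 0ℚ ≤ a → 0ℚ ≤ b → (S : Subset N) → 0ℚ ≤ weight a b S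
0≤weight 0≤a 0≤b []            = 0≤1
0≤weight 0≤a 0≤b (inside  ∷ S) = 0≤* 0≤a (0≤weight 0≤a 0≤b S)
0≤weight 0≤a 0≤b (outside ∷ S) = 0≤* 0≤b (0≤weight 0≤a 0≤b S)

∣weight∣ : ∀ {N} a b (S : Subset N) → ℚ.∣ weight a b S ∣ ≡ weight ℚ.∣ a ∣ ℚ.∣ b ∣ S
∣weight∣ a b []            = refl
∣weight∣ a b (inside  ∷ S) = trans (∣p*q∣≡∣p∣*∣q∣ a _) (cong (ℚ.∣ a ∣ *_) (∣weight∣ a b S))
∣weight∣ a b (outside ∷ S) = trans (∣p*q∣≡∣p∣*∣q∣ b _) (cong (ℚ.∣ b ∣ *_) (∣weight∣ a b S))

p≤∣p∣ : ∀ p → p ≤ ℚ.∣ p ∣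
p≤∣p∣ p with ≤-total 0ℚ p
... | inj₁ 0≤p = ≤-reflexive (sym (0≤p⇒∣p∣≡p 0≤p))
... | inj₂ p≤0 = ≤-trans p≤0 (0≤∣p∣ p)

∑ˢ-weight : ∀ {N} a b → ∑ˢ {N} (weight a b) ≡ (a + b) ^ N
∑ˢ-weight {zero}  a b = refl
∑ˢ-weight {suc N} a b = begin
  ∑ˢ {N} (λ S → a * weight a b S) + ∑ˢ {N} (λ S → b * weight a b S)
    ≡⟨ cong₂ _+_ (∑ˢ-* {N} a (weight a b)) (∑ˢ-* {N} b (weight a b)) ⟩
  a * ∑ˢ {N} (weight a b) + b * ∑ˢ {N} (weight a b)
    ≡⟨ *-distribʳ-+ (∑ˢ {N} (weight a b)) a b ⟨
  (a + b) * ∑ˢ {N} (weight a b)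
    ≡⟨ cong ((a + b) *_) (∑ˢ-weight {N} a b) ⟩
  (a + b) * (a + b) ^ N ∎
  where
  open ≡-Reasoning

∑ˢ-⊇ : ∀ {N} a b (I : Subset N) → ∑ˢ (λ S → when (I ⊆? S) (weight a b S)) ≡ a ^ ∣ I ∣ * (a + b) ^ ∣ ∁ I ∣
∑ˢ-⊇ a b [] = refl
∑ˢ-⊇ a b (inside ∷ I) = begin
  ∑ˢ (λ S → when (inside ∷ I ⊆? inside ∷ S) (a * weight a b S)) + ∑ˢ (λ S → when (inside ∷ I ⊆? outside ∷ S) (b * weight a b S))
    ≡⟨ cong₂ _+_ (trans (∑ˢ-cong λ S → trans (when-⇔ (inside ∷ I ⊆? inside ∷ S) (I ⊆? S) drop-∷-⊆ s⊆s _) (when-* (I ⊆? S) a _))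
                        (trans (∑ˢ-* a (λ S → when (I ⊆? S) (weight a b S))) (cong (a *_) (∑ˢ-⊇ a b I))))
                 (∑ˢ-zero λ S → when-⇔ (inside ∷ I ⊆? outside ∷ S) (no λ ()) no-in (λ ()) (b * weight a b S)) ⟩
  a * (a ^ ∣ I ∣ * (a + b) ^ ∣ ∁ I ∣) + 0ℚ
    ≡⟨ trans (+-identityʳ _) (sym (*-assoc a _ _)) ⟩
  a ^ suc (∣ I ∣) * (a + b) ^ ∣ ∁ I ∣ ∎
  where
  open ≡-Reasoning
  no-in : ∀ {S} → ¬ (inside ∷ I ⊆ outside ∷ S)
  no-in s with s here
  ... | ()
∑ˢ-⊇ a b (outside ∷ I) = begin
  ∑ˢ (λ S → when (outside ∷ I ⊆? inside ∷ S) (a * weight a b S)) + ∑ˢ (λ S → when (outside ∷ I ⊆? outside ∷ S) (b * weight a b S))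
    ≡⟨ cong₂ _+_ (side inside a) (side outside b) ⟩
  a * (a ^ ∣ I ∣ * (a + b) ^ ∣ ∁ I ∣) + b * (a ^ ∣ I ∣ * (a + b) ^ ∣ ∁ I ∣)
    ≡⟨ solve 4 (λ a b p q → a :* (p :* q) :+ b :* (p :* q) := p :* ((a :+ b) :* q)) refl a b (a ^ ∣ I ∣) ((a + b) ^ ∣ ∁ I ∣) ⟩
  a ^ ∣ I ∣ * (a + b) ^ suc (∣ ∁ I ∣) ∎
  where
  open ≡-Reasoning
  open +-*-Solver
  side : ∀ s c → ∑ˢ (λ S → when (outside ∷ I ⊆? s ∷ S) (c * weight a b S)) ≡ c * (a ^ ∣ I ∣ * (a + b) ^ ∣ ∁ I ∣)
  side s c = trans (∑ˢ-cong λ S → trans (when-⇔ (outside ∷ I ⊆? s ∷ S) (I ⊆? S) drop-∷-⊆ out⊆ _) (when-* (I ⊆? S) c _))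
    (trans (∑ˢ-* c (λ S → when (I ⊆? S) (weight a b S))) (cong (c *_) (∑ˢ-⊇ a b I)))

-- Markov's inequality for (1 + μ) ^ w, where w is the largest size of an independent
-- set: a set of size w has subsets of total weight (1 + μ) ^ w, so that the
-- expectation is at most that of the partition function of the random set.
module Moment {N : ℕ} {Ind : Subset N → Set} (ind? : ∀ I → Dec (Ind I))
  (hereditary : ∀ {I J} → I ⊆ J → Ind J → Ind I) where

  module _ {μ a b c κ : ℚ} (0≤μ : 0ℚ ≤ μ) (0≤a : 0ℚ ≤ a) (0≤b : 0ℚ ≤ b) (μa≤κ : μ * a ≤ κ)
    (1≤a+b : 1ℚ ≤ a + b) (total : (a + b) ^ N ≤ c) where

    private
      term : Subset N → Subset N → ℚ
      term S I = when (ind? I ×-dec I ⊆? S) (μ ^ ∣ I ∣)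
      0≤c : 0ℚ ≤ c
      0≤c = ≤-trans (0≤^ (≤-trans 0≤1 1≤a+b) N) total

    subsets-weight : ∀ {S J} → Ind J → J ⊆ S → (1ℚ + μ) ^ ∣ J ∣ ≤ ∑ˢ (term S)
    subsets-weight {S} {J} ind J⊆S = begin
      (1ℚ + μ) ^ ∣ J ∣                      ≡⟨ ∑ˢ-⊆ μ J ⟨
      ∑ˢ (λ I → when (I ⊆? J) (μ ^ ∣ I ∣))  ≤⟨ ∑ˢ-mono (λ I → when-mono (I ⊆? J) (ind? I ×-dec I ⊆? S)
                                                 (λ I⊆J → hereditary I⊆J ind , ⊆-trans I⊆J J⊆S) (0≤^ 0≤μ ∣ I ∣) ≤-refl) ⟩
      ∑ˢ (term S)                           ∎
      where
      open ≤-Reasoning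

    -- Each element of `I` contributes `μ a ≤ κ`. The others contribute `a + b ≥ 1` each, and
    -- filling up to `N` such factors bounds their product by `c`.
    expectation : ∀ I → ∑ˢ (λ S → weight a b S * term S I) ≤ c * when (ind? I ×-dec I ⊆? ⊤) (κ ^ ∣ I ∣)
    expectation I = case (ind? I)
      where
      open ≤-Reasoning
      open +-*-Solver
      case : Dec (Ind I) → ∑ˢ (λ S → weight a b S * term S I) ≤ c * when (ind? I ×-dec I ⊆? ⊤) (κ ^ ∣ I ∣)
      case (no ¬ind) = ≤-reflexive (trans
        (∑ˢ-zero λ S → trans (cong (weight a b S *_) (when-⇔ (ind? I ×-dec I ⊆? S) (no λ ()) (¬ind ∘ proj₁) (λ ()) (μ ^ ∣ I ∣))) (*-zeroʳ (weight a b S)))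
        (sym (trans (cong (c *_) (when-⇔ (ind? I ×-dec I ⊆? ⊤) (no λ ()) (¬ind ∘ proj₁) (λ ()) (κ ^ ∣ I ∣))) (*-zeroʳ c))))
      case (yes ind) = begin
        ∑ˢ (λ S → weight a b S * term S I)
          ≡⟨ ∑ˢ-cong (λ S → trans (sym (when-* (ind? I ×-dec I ⊆? S) (weight a b S) (μ ^ ∣ I ∣)))
               (trans (when-⇔ (ind? I ×-dec I ⊆? S) (I ⊆? S) proj₂ (ind ,_) _)
                 (trans (cong (when (I ⊆? S)) (*-comm (weight a b S) (μ ^ ∣ I ∣))) (when-* (I ⊆? S) (μ ^ ∣ I ∣) (weight a b S))))) ⟩
        ∑ˢ (λ S → μ ^ ∣ I ∣ * when (I ⊆? S) (weight a b S))
          ≡⟨ trans (∑ˢ-* (μ ^ ∣ I ∣) (λ S → when (I ⊆? S) (weight a b S))) (cong (μ ^ ∣ I ∣ *_) (∑ˢ-⊇ a b I)) ⟩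
        μ ^ ∣ I ∣ * (a ^ ∣ I ∣ * (a + b) ^ ∣ ∁ I ∣)
          ≡⟨ trans (sym (*-assoc (μ ^ ∣ I ∣) _ _)) (cong (_* (a + b) ^ ∣ ∁ I ∣) (sym (^-* μ a ∣ I ∣))) ⟩
        (μ * a) ^ ∣ I ∣ * (a + b) ^ ∣ ∁ I ∣
          ≤⟨ mul-mono (0≤^ 0≤κ ∣ I ∣) (0≤^ (≤-trans 0≤1 1≤a+b) ∣ ∁ I ∣) (^-mono (0≤* 0≤μ 0≤a) μa≤κ ∣ I ∣)
               (≤-trans (^-monoʳ 1≤a+b (∣p∣≤n (∁ I))) total) ⟩
        κ ^ ∣ I ∣ * c
          ≡⟨ *-comm (κ ^ ∣ I ∣) c ⟩
        c * κ ^ ∣ I ∣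
          ≡⟨ cong (c *_) (sym (when-true (ind , λ {_} → ⊆-max I) (ind? I ×-dec I ⊆? ⊤) (κ ^ ∣ I ∣))) ⟩
        c * when (ind? I ×-dec I ⊆? ⊤) (κ ^ ∣ I ∣) ∎
        where
        0≤κ : 0ℚ ≤ κ
        0≤κ = ≤-trans (0≤* 0≤μ 0≤a) μa≤κ

    moment : ∀ {R} {E : Subset N → Set} (E? : ∀ S → Dec (E S)) →
      (∀ S → E S → ∃ λ J → Ind J × J ⊆ S × R ≤ (1ℚ + μ) ^ ∣ J ∣) →
      R * ∑ˢ (λ S → when (E? S) (weight a b S)) ≤ c * ∑ˢ (λ I → when (ind? I ×-dec I ⊆? ⊤) (κ ^ ∣ I ∣))
    moment {R} E? large = begin
      R * ∑ˢ (λ S → when (E? S) (weight a b S))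
        ≡⟨ ∑ˢ-* R (λ S → when (E? S) (weight a b S)) ⟨
      ∑ˢ (λ S → R * when (E? S) (weight a b S))
        ≤⟨ ∑ˢ-mono bound ⟩
      ∑ˢ (λ S → weight a b S * ∑ˢ (term S))
        ≡⟨ ∑ˢ-cong (λ S → ∑ˢ-* (weight a b S) (term S)) ⟨
      ∑ˢ (λ S → ∑ˢ (λ I → weight a b S * term S I))
        ≡⟨ ∑ˢ-comm (λ S I → weight a b S * term S I) ⟩
      ∑ˢ (λ I → ∑ˢ (λ S → weight a b S * term S I))
        ≤⟨ ∑ˢ-mono expectation ⟩
      ∑ˢ (λ I → c * when (ind? I ×-dec I ⊆? ⊤) (κ ^ ∣ I ∣))
        ≡⟨ ∑ˢ-* c (λ I → when (ind? I ×-dec I ⊆? ⊤) (κ ^ ∣ I ∣)) ⟩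
      c * ∑ˢ (λ I → when (ind? I ×-dec I ⊆? ⊤) (κ ^ ∣ I ∣)) ∎
      where
      open ≤-Reasoning
      bound : ∀ S → R * when (E? S) (weight a b S) ≤ weight a b S * ∑ˢ (term S)
      bound S with E? S
      ... | no _  = subst (_≤ weight a b S * ∑ˢ (term S)) (sym (*-zeroʳ R))
        (0≤* (0≤weight 0≤a 0≤b S) (0≤∑ˢ λ I → 0≤when (ind? I ×-dec I ⊆? S) (0≤^ 0≤μ ∣ I ∣)))
      ... | yes e with large S e
      ... | J , ind , J⊆S , R≤ = ≤-trans (≤-reflexive (*-comm R _))
        (mulˡ (0≤weight 0≤a 0≤b S) (≤-trans R≤ (subsets-weight ind J⊆S)))

-- Evaluating probabilities along the sequence representing p

mass-seq : ∀ {N} p (S : Subset N) k → seq (mass p S) k ≡ weight (seq p k) (1ℚ - seq p k) S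
mass-seq p []            k = refl
mass-seq p (inside  ∷ S) k = cong (seq p k *_) (mass-seq p S k)
mass-seq p (outside ∷ S) k = cong ((1ℚ - seq p k) *_) (mass-seq p S k)

∑ˡ : {A : Set} → (A → ℚ) → List A → ℚ
∑ˡ f = foldr (λ a s → f a + s) 0ℚ

∑ˡ-++ : {A : Set} (f : A → ℚ) (xs ys : List A) → ∑ˡ f (xs ++ ys) ≡ ∑ˡ f xs + ∑ˡ f ys
∑ˡ-++ f []       ys = sym (+-identityˡ _)
∑ˡ-++ f (x ∷ xs) ys = trans (cong (f x +_) (∑ˡ-++ f xs ys)) (sym (+-assoc (f x) _ _))

∑ˡ-map : {A B : Set} (f : B → ℚ) (g : A → B) (xs : List A) → ∑ˡ f (map g xs) ≡ ∑ˡ (f ∘ g) xs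
∑ˡ-map f g []       = refl
∑ˡ-map f g (x ∷ xs) = cong (f (g x) +_) (∑ˡ-map f g xs)

∑ˡ-subsets : ∀ {N} (f : Subset N → ℚ) → ∑ˡ f (subsets N) ≡ ∑ˢ f
∑ˡ-subsets {zero}  f = +-identityʳ (f [])
∑ˡ-subsets {suc N} f = trans (∑ˡ-++ f (map (inside ∷_) (subsets N)) _)
  (cong₂ _+_ (trans (∑ˡ-map f (inside ∷_) (subsets N)) (∑ˡ-subsets (f ∘ (inside ∷_))))
             (trans (∑ˡ-map f (outside ∷_) (subsets N)) (∑ˡ-subsets (f ∘ (outside ∷_)))))

filterᵇ-∷ : {A : Set} (p : A → Bool) (x : A) (xs : List A) →
  filterᵇ p (x ∷ xs) ≡ (if p x then x ∷ filterᵇ p xs else filterᵇ p xs)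
filterᵇ-∷ p x xs with p x
... | true  = refl
... | false = refl

Σᴿ-filter-seq : {A : Set} {P : A → Set} (P? : ∀ a → Dec (P a)) (f : A → ℝ) (xs : List A) → ∀ k →
  seq (Σᴿ f (filterᵇ (does ∘ P?) xs)) k ≡ ∑ˡ (λ a → when (P? a) (seq (f a) k)) xs
Σᴿ-filter-seq P? f []       k = refl
Σᴿ-filter-seq {A} P? f (x ∷ xs) k =
  trans (cong (λ ys → seq (Σᴿ f ys) k) (filterᵇ-∷ (does ∘ P?) x xs))
    (trans (step (P? x) (filterᵇ (does ∘ P?) xs)) (cong (when (P? x) (seq (f x) k) +_) (Σᴿ-filter-seq P? f xs k)))
  where
  step : {Q : Set} (Q? : Dec Q) (ys : List A) →
    seq (Σᴿ f (if does Q? then x ∷ ys else ys)) k ≡ when Q? (seq (f x) k) + seq (Σᴿ f ys) k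
  step (yes _) ys = refl
  step (no _)  ys = sym (+-identityˡ (seq (Σᴿ f ys) k))

Pr-seq : ∀ {N} p {P : Subset N → Set} (P? : ∀ S → Dec (P S)) k →
  seq (Pr p (does ∘ P?)) k ≡ ∑ˢ (λ S → when (P? S) (weight (seq p k) (1ℚ - seq p k) S))
Pr-seq {N} p P? k = trans (Σᴿ-filter-seq P? (mass p) (subsets N) k)
  (trans (∑ˡ-subsets (λ S → when (P? S) (seq (mass p S) k))) (∑ˢ-cong λ S → cong (when (P? S)) (mass-seq p S k)))

when-¬ : {P : Set} (P? : Dec P) → ∀ q → when P? q + when (¬? P?) q ≡ q
when-¬ (yes _) q = +-identityʳ q
when-¬ (no _)  q = +-identityˡ q

-- The signed weights for `a` and `1 - a` sum to exactly 1. Only the part outside `P` is enlarged to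
-- absolute values, so that the other part is still `Pr`.
Pr-complement : ∀ {N} p {P : Subset N → Set} (P? : ∀ S → Dec (P S)) k → 0ℚ ≤ seq p k →
  1ℚ ≤ seq (Pr p (does ∘ P?)) k + ∑ˢ (λ S → when (¬? (P? S)) (weight (seq p k) ℚ.∣ 1ℚ - seq p k ∣ S))
Pr-complement {N} p P? k 0≤a = begin
  1ℚ
    ≡⟨ trans (sym (one^ N)) (cong (_^ N) (solve 1 (λ a → con 1ℚ := a :+ (con 1ℚ :- a)) refl a)) ⟩
  (a + (1ℚ - a)) ^ N
    ≡⟨ ∑ˢ-weight {N} a (1ℚ - a) ⟨
  ∑ˢ {N} (weight a (1ℚ - a))
    ≡⟨ trans (∑ˢ-cong λ S → sym (when-¬ (P? S) (weight a (1ℚ - a) S)))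
         (∑ˢ-+ (λ S → when (P? S) (weight a (1ℚ - a) S)) (λ S → when (¬? (P? S)) (weight a (1ℚ - a) S))) ⟩
  ∑ˢ (λ S → when (P? S) (weight a (1ℚ - a) S)) + ∑ˢ (λ S → when (¬? (P? S)) (weight a (1ℚ - a) S))
    ≤⟨ +-mono-≤ (≤-reflexive (sym (Pr-seq p P? k))) (∑ˢ-mono λ S → when-mono (¬? (P? S)) (¬? (P? S)) (λ x → x)
         (0≤weight 0≤a (0≤∣p∣ (1ℚ - a)) S) (abs S)) ⟩
  seq (Pr p (does ∘ P?)) k + ∑ˢ (λ S → when (¬? (P? S)) (weight a ℚ.∣ 1ℚ - a ∣ S)) ∎
  where
  open ≤-Reasoning
  open +-*-Solver
  a = seq p k
  one^ : ∀ N → 1ℚ ^ N ≡ 1ℚ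
  one^ zero    = refl
  one^ (suc N) = trans (*-identityˡ (1ℚ ^ N)) (one^ N)
  abs : ∀ S → weight a (1ℚ - a) S ≤ weight a ℚ.∣ 1ℚ - a ∣ S
  abs S = ≤-trans (p≤∣p∣ (weight a (1ℚ - a) S)) (≤-reflexive (trans (∣weight∣ a (1ℚ - a) S)
    (cong (λ c → weight c ℚ.∣ 1ℚ - a ∣ S) (0≤p⇒∣p∣≡p 0≤a))))

-- Indices of sets, and antichains of maximum size.

funToFin-cong : ∀ {k l} {f g : Fin k → Fin l} → (∀ i → f i ≡ g i) → funToFin f ≡ funToFin g
funToFin-cong {zero}  f≗g = refl
funToFin-cong {suc k} f≗g = cong₂ combine (f≗g zero) (funToFin-cong (f≗g ∘ suc))

decode : ∀ {n} → Fin (2 ℕ.^ n) → Subset n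
decode {n} i = tabulate (Inverse.to 2↔Bool ∘ finToFun {2} {n} i)

index-decode : ∀ {n} (i : Fin (2 ℕ.^ n)) → index (decode {n} i) ≡ i
index-decode {n} i = trans
  (funToFin-cong λ j → trans (cong (Inverse.from 2↔Bool) (lookup∘tabulate (Inverse.to 2↔Bool ∘ finToFun {2} {n} i) j))
                             (Inverse.strictlyInverseʳ 2↔Bool (finToFun {2} {n} i j)))
  (funToFin-finToFin {n} {2} i)

decode-injective : ∀ {n} {i j : Fin (2 ℕ.^ n)} → decode {n} i ≡ decode j → i ≡ j
decode-injective {n} {i} {j} e = trans (sym (index-decode {n} i)) (trans (cong index e) (index-decode {n} j))

antichain-hereditary : ∀ n {I J : Family n} → I ⊆ J → IsAntichain n J → IsAntichain n I
antichain-hereditary n I⊆J anti A B A∈ B∈ = anti A B (I⊆J A∈) (I⊆J B∈)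

largest-attained : ∀ n (ℱ : Family n) → ∃ λ A → IsAntichain n A × A ⊆ ℱ × largestAntichain n ℱ ℕ.≤ ∣ A ∣
largest-attained n ℱ with argmax-sel id 0 (map ∣_∣ (filter (λ A → isAntichain? n A ×-dec A ⊆? ℱ) (subsets (2 ℕ.^ n))))
... | inj₁ L≡0 = ⊥ , (λ A B A∈ → ⊥-elim (∉⊥ A∈)) , ⊥⊆ , ℕₚ.≤-trans (ℕₚ.≤-reflexive L≡0) z≤n
... | inj₂ L∈ with ∈-map⁻ ∣_∣ L∈
... | A , A∈ , L≡ with ∈-filter⁻ (λ A → isAntichain? n A ×-dec A ⊆? ℱ) {xs = subsets (2 ℕ.^ n)} A∈
... | _ , anti , A⊆ = A , anti , A⊆ , ℕₚ.≤-reflexive L≡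

recip : ∀ k .{{_ : NonZero k}} → ℚ
recip k = ℤ.+ 1 / k

ι*recip : ∀ k .{{_ : NonZero k}} → ι k * recip k ≡ 1ℚ
ι*recip k@(suc l) = toℚᵘ-injective (begin
  toℚᵘ (ι k * recip k)                               ≈⟨ toℚᵘ-homo-* (ι k) (recip k) ⟩
  toℚᵘ (ι k) ℚᵘ.* toℚᵘ (recip k)                     ≈⟨ ℚᵘₚ.*-cong (toℚᵘ-ι k) (toℚᵘ-fromℚᵘ (ℚᵘ.mkℚᵘ (ℤ.+ 1) l)) ⟩
  ℚᵘ.mkℚᵘ (ℤ.+ k) 0 ℚᵘ.* ℚᵘ.mkℚᵘ (ℤ.+ 1) l           ≈⟨ ℚᵘ.*≡* (trans (ℤₚ.*-identityʳ (ℤ.+ k ℤ.* ℤ.+ 1)) (trans (ℤₚ.*-comm (ℤ.+ k) (ℤ.+ 1)) (cong (λ c → ℤ.+ 1 ℤ.* ℤ.+ c) (sym (ℕₚ.*-identityˡ k))))) ⟩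
  toℚᵘ 1ℚ                                            ∎)
  where
  open ℚᵘₚ.≃-Reasoning

0≤recip : ∀ k .{{_ : NonZero k}} → 0ℚ ≤ recip k
0≤recip k = nonNegative⁻¹ (recip k) {{normalize-nonNeg 1 k}}

power≤ : ∀ {x c} → 0ℚ ≤ x → 0ℚ ≤ c → ∀ k → (1ℚ - ι k * x) * c ≡ 1ℚ → (1ℚ + x) ^ k ≤ c
power≤ {x} {c} 0≤x 0≤c k e = begin
  (1ℚ + x) ^ k                               ≡⟨ trans (sym (*-identityʳ _)) (cong ((1ℚ + x) ^ k *_) (sym e)) ⟩
  (1ℚ + x) ^ k * ((1ℚ - ι k * x) * c)        ≡⟨ *-assoc ((1ℚ + x) ^ k) _ c ⟨
  (1ℚ + x) ^ k * (1ℚ - ι k * x) * c          ≤⟨ mulʳ 0≤c (bernoulli⁻ 0≤x k) ⟩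
  1ℚ * c                                     ≡⟨ *-identityˡ c ⟩
  c                                          ∎
  where
  open ≤-Reasoning

quotient<⇒< : ∀ q J b .{{_ : NonZero J}} → q ℕ./ J ℕ.< b → q ℕ.< J ℕ.* b
quotient<⇒< q J b lt = begin-strict
  q                               ≡⟨ ℕ.m≡m%n+[m/n]*n q J ⟩
  q ℕ.% J ℕ.+ q ℕ./ J ℕ.* J       <⟨ ℕₚ.+-monoˡ-< (q ℕ./ J ℕ.* J) (ℕ.m%n<n q J) ⟩
  suc (q ℕ./ J) ℕ.* J             ≤⟨ ℕₚ.*-monoˡ-≤ J lt ⟩
  b ℕ.* J                         ≡⟨ ℕₚ.*-comm b J ⟩
  J ℕ.* b                         ∎
  where
  open ℕₚ.≤-Reasoning

-- The bad event in a fixed cube.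

module FixedCube (n J u : ℕ) .{{J≢0 : NonZero J}} (n≥ : 18 ℕ.* J ℕ.+ 2 ℕ.≤ n)
  (u≥ : 256 ℕ.* (J ℕ.* (J ℕ.* J) ℕ.* suc J) ℕ.≤ u) where

  open Supersaturation (decode {n}) (decode-injective {n})
  open Layers (decode {n}) (decode-injective {n})
  open Constants n J u

  exclusive : ∀ {I : Family n} {i j} → IsAntichain n I → i ∈ I → j ∈ I → ¬ Comparable i j
  exclusive {I} {i} {j} anti i∈ j∈ (i≢j , comparable) = i≢j (decode-injective {n} (case comparable))
    where
    member : ∀ {k} → k ∈ I → decode {n} k ∈ᶠ I
    member {k} k∈ = subst (_∈ I) (sym (index-decode {n} k)) k∈
    case : decode {n} i ⊆ decode j ⊎ decode {n} j ⊆ decode i → decode {n} i ≡ decode j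
    case (inj₁ sub) = anti (decode {n} i) (decode {n} j) (member i∈) (member j∈) sub
    case (inj₂ sub) = sym (anti (decode {n} j) (decode {n} i) (member j∈) (member i∈) sub)

  open HardCore comparable? (λ _ (i≢i , _) → i≢i refl) (isAntichain? n) (antichain-hereditary n) exclusive

  1≤J : 1 ℕ.≤ J
  1≤J = ℕ.>-nonZero⁻¹ J

  20≤n : 20 ℕ.≤ n
  20≤n = ℕₚ.≤-trans (ℕₚ.+-monoˡ-≤ 2 (ℕₚ.*-monoʳ-≤ 18 1≤J)) n≥

  1≤n : 1 ℕ.≤ n
  1≤n = ℕₚ.≤-trans (s≤s z≤n) 20≤n

  10≤⌈n/2⌉ : 10 ℕ.≤ ⌈ n /2⌉
  10≤⌈n/2⌉ = ℕₚ.⌈n/2⌉-mono 20≤n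

  -- The case `r = 1` of `dense⇒degree` applies beyond `(1 + 1 / J) m` plus the number of outer
  -- sets, which is at most `m / J`.
  M : ℕ
  M = (J ℕ.+ 2) ℕ.* m ℕ./ J

  step : {b : ℕ} → Dec (b ℕ.≤ M) → Dec (b ℕ.≤ 7 ℕ.* m) → ℕ
  step (yes _) _       = w₀
  step (no _)  (yes _) = w₁
  step (no _)  (no _)  = w₂

  inc : ℕ → ℕ
  inc b = step (b ℕ.≤? M) (b ℕ.≤? 7 ℕ.* m)

  inc-antitone : ∀ {i j} → i ℕ.≤ j → inc j ℕ.≤ inc i
  inc-antitone {i} {j} i≤j = go (i ℕ.≤? M) (i ℕ.≤? 7 ℕ.* m) (j ℕ.≤? M) (j ℕ.≤? 7 ℕ.* m)
    where
    go : ∀ a b c d → step {j} c d ℕ.≤ step {i} a b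
    go (yes _)  _        (yes _)  _        = ℕₚ.≤-refl
    go (yes _)  _        (no _)   (yes _)  = w₁≤w₀
    go (yes _)  _        (no _)   (no _)   = ℕₚ.≤-trans (w₂≤w₁ 1≤n) w₁≤w₀
    go (no i≰)  _        (yes j≤) _        = contradiction (ℕₚ.≤-trans i≤j j≤) i≰
    go (no _)   (yes _)  (no _)   (yes _)  = ℕₚ.≤-refl
    go (no _)   (yes _)  (no _)   (no _)   = w₂≤w₁ 1≤n
    go (no _)   (no i≰)  (no _)   (yes j≤) = contradiction (ℕₚ.≤-trans i≤j j≤) i≰
    go (no _)   (no _)   (no _)   (no _)   = ℕₚ.≤-refl

  open Potential inc inc-antitone

  J*outer≤m : J ℕ.* sum (𝟙 ∘ outer?) ℕ.≤ m
  J*outer≤m = outer-negligible n J _ n≥ (count-outer (ℕₚ.≤-trans (ℕₚ.m≤m+n 4 16) 20≤n)) 1≤J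

  high-degree : ∀ B b → ∣ B ∣ ≡ suc b → ∃ λ v → v ∈ B ×
    w₀ ℕ.* T ℕ.≤ inc (suc b) ℕ.* (T ℕ.+ inc (suc b) ℕ.* degreeIn B v)
  high-degree B b ∣B∣≡ = go (suc b ℕ.≤? M) (suc b ℕ.≤? 7 ℕ.* m)
    where
    open ℕₚ.≤-Reasoning
    open ℕSolver.+-*-Solver
    size : suc b ≡ sum (λ i → 𝟙 (i ∈? B))
    size = trans (sym ∣B∣≡) (∣∣≡sum B)
    go : ∀ c d → ∃ λ v → v ∈ B × w₀ ℕ.* T ℕ.≤ step {suc b} c d ℕ.* (T ℕ.+ step {suc b} c d ℕ.* degreeIn B v)
    -- In this range every vertex is paid for in full, so any member of `B` will do.
    go (yes _) _ with nonempty? B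
    ... | yes (v , v∈B) = v , v∈B , ℕₚ.*-monoʳ-≤ w₀ (ℕₚ.m≤m+n T _)
    ... | no empty      = contradiction (trans (sym ∣B∣≡) (trans (cong ∣_∣ (Empty-unique empty)) (∣⊥∣≡0 (2 ℕ.^ n)))) λ ()
    go (no b≰M) (yes _) =
      let v , v∈B , d> = dense⇒degree (_∈? B) 1 J (s≤s z≤n) (s≤s z≤n)
            (subst (1 ℕ.≤_) (sym (nC1≡n ⌈ n /2⌉)) (ℕₚ.≤-trans (s≤s z≤n) 10≤⌈n/2⌉)) dense
      in v , v∈B , middle-step u≥ (degreeIn B v) (subst (ℕ._< suc J ℕ.* degreeIn B v) (nC1≡n ⌈ n /2⌉) d>)
      where
      dense : suc J ℕ.* 1 ℕ.* m ℕ.+ J ℕ.* sum (𝟙 ∘ outer?) ℕ.< J ℕ.* sum (λ i → 𝟙 (i ∈? B))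
      dense = begin-strict
        suc J ℕ.* 1 ℕ.* m ℕ.+ J ℕ.* sum (𝟙 ∘ outer?) ≤⟨ ℕₚ.+-monoʳ-≤ (suc J ℕ.* 1 ℕ.* m) J*outer≤m ⟩
        suc J ℕ.* 1 ℕ.* m ℕ.+ m                      ≡⟨ solve 2 (λ J m → (con 1 :+ J) :* con 1 :* m :+ m := (J :+ con 2) :* m) refl J m ⟩
        (J ℕ.+ 2) ℕ.* m                              <⟨ quotient<⇒< _ J (suc b) (ℕₚ.≰⇒> b≰M) ⟩
        J ℕ.* suc b                                  ≡⟨ cong (J ℕ.*_) size ⟩
        J ℕ.* sum (λ i → 𝟙 (i ∈? B))                 ∎
    go (no _) (no b≰) =
      -- With 1 in place of `J`, the threshold is `2 * 3 * m` and at most `m` for the outer sets.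
      -- The factor 2 is affordable because the sets from `M` to `7 m` cost only `w₁` each.
      let v , v∈B , d> = dense⇒degree (_∈? B) 3 1 (s≤s z≤n) ℕₚ.≤-refl
            (nCk≥1 ⌈ n /2⌉ 3 (ℕₚ.≤-trans (ℕₚ.m≤m+n 3 7) 10≤⌈n/2⌉)) dense
      in v , v∈B , large-step u≥ (degreeIn B v) (ℕₚ.≤-trans (ℕₚ.m≤m+n 4 6) 10≤⌈n/2⌉) d>
      where
      dense : 2 ℕ.* 3 ℕ.* m ℕ.+ 1 ℕ.* sum (𝟙 ∘ outer?) ℕ.< 1 ℕ.* sum (λ i → 𝟙 (i ∈? B))
      dense = begin-strict
        2 ℕ.* 3 ℕ.* m ℕ.+ 1 ℕ.* sum (𝟙 ∘ outer?) ≤⟨ ℕₚ.+-monoʳ-≤ (6 ℕ.* m) (ℕₚ.≤-trans (ℕₚ.*-monoˡ-≤ (sum (𝟙 ∘ outer?)) 1≤J) J*outer≤m) ⟩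
        6 ℕ.* m ℕ.+ m                            ≡⟨ solve 1 (λ m → con 6 :* m :+ m := con 7 :* m) refl m ⟩
        7 ℕ.* m                                  <⟨ ℕₚ.≰⇒> b≰ ⟩
        suc b                                    ≡⟨ size ⟩
        sum (λ i → 𝟙 (i ∈? B))                   ≡⟨ ℕₚ.*-identityˡ _ ⟨
        1 ℕ.* sum (λ i → 𝟙 (i ∈? B))             ∎

  -- The cheaper increments are charged in the earlier ranges as well. They are small enough for
  -- that, and the bound becomes a sum without subtractions.
  Φ≤ : ∀ b → Φ b ℕ.≤ w₀ ℕ.* (b ℕ.⊓ M) ℕ.+ w₁ ℕ.* (b ℕ.⊓ (7 ℕ.* m)) ℕ.+ w₂ ℕ.* b
  Φ≤ zero    = z≤n
  Φ≤ (suc b) = ℕₚ.≤-trans (ℕₚ.+-monoʳ-≤ (inc (suc b)) (Φ≤ b)) (go (suc b ℕ.≤? M) (suc b ℕ.≤? 7 ℕ.* m))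
    where
    open ℕₚ.≤-Reasoning
    open ℕSolver.+-*-Solver
    A = w₀ ℕ.* (b ℕ.⊓ M)
    B = w₁ ℕ.* (b ℕ.⊓ (7 ℕ.* m))
    D = w₂ ℕ.* b
    low : ∀ w K → w ℕ.* (b ℕ.⊓ K) ℕ.≤ w ℕ.* (suc b ℕ.⊓ K)
    low w K = ℕₚ.*-monoʳ-≤ w (ℕₚ.⊓-monoˡ-≤ K (ℕₚ.n≤1+n b))
    grow : ∀ w K → suc b ℕ.≤ K → w ℕ.+ w ℕ.* (b ℕ.⊓ K) ℕ.≤ w ℕ.* (suc b ℕ.⊓ K)
    grow w K b<K = ℕₚ.≤-reflexive (trans (cong (λ c → w ℕ.+ w ℕ.* c) (ℕₚ.m≤n⇒m⊓n≡m (ℕₚ.<⇒≤ b<K)))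
      (trans (sym (ℕₚ.*-suc w b)) (cong (w ℕ.*_) (sym (ℕₚ.m≤n⇒m⊓n≡m b<K)))))
    go : ∀ c d → step {suc b} c d ℕ.+ (w₀ ℕ.* (b ℕ.⊓ M) ℕ.+ w₁ ℕ.* (b ℕ.⊓ (7 ℕ.* m)) ℕ.+ w₂ ℕ.* b)
      ℕ.≤ w₀ ℕ.* (suc b ℕ.⊓ M) ℕ.+ w₁ ℕ.* (suc b ℕ.⊓ (7 ℕ.* m)) ℕ.+ w₂ ℕ.* suc b
    go (yes b<M) _ = ℕₚ.≤-trans (ℕₚ.≤-reflexive (solve 4 (λ w a b c → w :+ (a :+ b :+ c) := w :+ a :+ b :+ c) refl w₀ A B D))
      (ℕₚ.+-mono-≤ (ℕₚ.+-mono-≤ (grow w₀ M b<M) (low w₁ (7 ℕ.* m))) (ℕₚ.*-monoʳ-≤ w₂ (ℕₚ.n≤1+n b)))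
    go (no _) (yes b<) = ℕₚ.≤-trans (ℕₚ.≤-reflexive (solve 4 (λ w a b c → w :+ (a :+ b :+ c) := a :+ (w :+ b) :+ c) refl w₁ A B D))
      (ℕₚ.+-mono-≤ (ℕₚ.+-mono-≤ (low w₀ M) (grow w₁ (7 ℕ.* m) b<)) (ℕₚ.*-monoʳ-≤ w₂ (ℕₚ.n≤1+n b)))
    go (no _) (no _) = ℕₚ.≤-trans (ℕₚ.≤-reflexive (solve 4 (λ w a b c → w :+ (a :+ b :+ c) := a :+ b :+ (w :+ c)) refl w₂ A B D))
      (ℕₚ.+-mono-≤ (ℕₚ.+-mono-≤ (low w₀ M) (low w₁ (7 ℕ.* m))) (ℕₚ.≤-reflexive (sym (ℕₚ.*-suc w₂ b))))

  -- In `J + 11`, the first range contributes `J + 2`, the second 7, and the last 2, by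
  -- `2 ^ n ≤ (n + 1) m ≤ 2 n m`.
  Φ-total : Φ (2 ℕ.^ n) ℕ.≤ (u ℕ.+ 2) ℕ.* suc J ℕ.* (J ℕ.+ 11) ℕ.* (n ℕ.* m)
  Φ-total = begin
    Φ (2 ℕ.^ n)
      ≤⟨ Φ≤ (2 ℕ.^ n) ⟩
    w₀ ℕ.* (2 ℕ.^ n ℕ.⊓ M) ℕ.+ w₁ ℕ.* (2 ℕ.^ n ℕ.⊓ (7 ℕ.* m)) ℕ.+ w₂ ℕ.* 2 ℕ.^ n
      ≤⟨ ℕₚ.+-mono-≤ (ℕₚ.+-mono-≤ (ℕₚ.*-monoʳ-≤ w₀ (ℕₚ.m⊓n≤n (2 ℕ.^ n) M)) (ℕₚ.*-monoʳ-≤ w₁ (ℕₚ.m⊓n≤n (2 ℕ.^ n) (7 ℕ.* m))))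
           (ℕₚ.*-monoʳ-≤ w₂ (ℕₚ.≤-trans N≤[1+n]m (ℕₚ.*-monoʳ-≤ m (ℕₚ.+-monoˡ-≤ n 1≤n)))) ⟩
    w₀ ℕ.* M ℕ.+ w₁ ℕ.* (7 ℕ.* m) ℕ.+ w₂ ℕ.* (m ℕ.* (n ℕ.+ n))
      ≡⟨ solve 6 (λ v n J s M m → v :* n :* J :* s :* M :+ v :* n :* s :* (con 7 :* m) :+ v :* s :* (m :* (n :+ n))
           := v :* n :* s :* (M :* J) :+ v :* n :* s :* (con 9 :* m)) refl (u ℕ.+ 2) n J (suc J) M m ⟩
    (u ℕ.+ 2) ℕ.* n ℕ.* suc J ℕ.* (M ℕ.* J) ℕ.+ (u ℕ.+ 2) ℕ.* n ℕ.* suc J ℕ.* (9 ℕ.* m)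
      ≤⟨ ℕₚ.+-monoˡ-≤ _ (ℕₚ.*-monoʳ-≤ ((u ℕ.+ 2) ℕ.* n ℕ.* suc J) (ℕ.m/n*n≤m ((J ℕ.+ 2) ℕ.* m) J)) ⟩
    (u ℕ.+ 2) ℕ.* n ℕ.* suc J ℕ.* ((J ℕ.+ 2) ℕ.* m) ℕ.+ (u ℕ.+ 2) ℕ.* n ℕ.* suc J ℕ.* (9 ℕ.* m)
      ≡⟨ solve 5 (λ v n J s m → v :* n :* s :* ((J :+ con 2) :* m) :+ v :* n :* s :* (con 9 :* m)
           := v :* s :* (J :+ con 11) :* (n :* m)) refl (u ℕ.+ 2) n J (suc J) m ⟩
    (u ℕ.+ 2) ℕ.* suc J ℕ.* (J ℕ.+ 11) ℕ.* (n ℕ.* m) ∎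
    where
    open ℕₚ.≤-Reasoning
    open ℕSolver.+-*-Solver

  -- An antichain of size `L` above the threshold yields `β ^ (f * L)`, which exceeds the bound
  -- `β ^ Φ` on the partition function by a further power of `β`. That surplus, `n m u J`, is the
  -- summand `u * J` in `exponent-polynomial`.
  exponent : ∀ L → (J ℕ.+ 48) ℕ.* u ℕ.* m ℕ.≤ J ℕ.* n ℕ.* L → n ℕ.* m ℕ.* u ℕ.* J ℕ.+ Φ (2 ℕ.^ n) ℕ.≤ f ℕ.* L
  exponent L large = begin
    n ℕ.* m ℕ.* u ℕ.* J ℕ.+ Φ (2 ℕ.^ n)
      ≤⟨ ℕₚ.+-monoʳ-≤ (n ℕ.* m ℕ.* u ℕ.* J) Φ-total ⟩
    n ℕ.* m ℕ.* u ℕ.* J ℕ.+ (u ℕ.+ 2) ℕ.* suc J ℕ.* (J ℕ.+ 11) ℕ.* (n ℕ.* m)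
      ≡⟨ solve 5 (λ n m u J e → n :* m :* u :* J :+ e :* (n :* m) := (e :+ u :* J) :* (n :* m)) refl n m u J ((u ℕ.+ 2) ℕ.* suc J ℕ.* (J ℕ.+ 11)) ⟩
    ((u ℕ.+ 2) ℕ.* suc J ℕ.* (J ℕ.+ 11) ℕ.+ u ℕ.* J) ℕ.* (n ℕ.* m)
      ≤⟨ ℕₚ.*-monoˡ-≤ (n ℕ.* m) (exponent-polynomial u≥) ⟩
    J ℕ.* ((J ℕ.+ 48) ℕ.* u) ℕ.* (n ℕ.* m)
      ≡⟨ solve 4 (λ n m c J → J :* c :* (n :* m) := J :* n :* (c :* m)) refl n m ((J ℕ.+ 48) ℕ.* u) J ⟩
    J ℕ.* n ℕ.* ((J ℕ.+ 48) ℕ.* u ℕ.* m)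
      ≤⟨ ℕₚ.*-monoʳ-≤ (J ℕ.* n) large ⟩
    J ℕ.* n ℕ.* (J ℕ.* n ℕ.* L)
      ≡⟨ solve 3 (λ n J L → J :* n :* (J :* n :* L) := n :* n :* (J :* J) :* L) refl n J L ⟩
    f ℕ.* L ∎
    where
    open ℕₚ.≤-Reasoning
    open ℕSolver.+-*-Solver

  module _ (Q : ℕ) (n≥Q : 2 ℕ.* (2 ℕ.* (Q ℕ.* (J ℕ.* suc J))) ℕ.+ 1 ℕ.≤ n) where

    -- A decidable event inside that of the theorem: the threshold is `(1 + 48 / J) (u / n) m`,
    -- where later `48 / J ≤ ε` and `u / n ≤ p`.
    Good : Family n → Set
    Good ℱ = J ℕ.* n ℕ.* largestAntichain n ℱ ℕ.≤ (J ℕ.+ 48) ℕ.* u ℕ.* m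

    good? : ∀ ℱ → Dec (Good ℱ)
    good? ℱ = J ℕ.* n ℕ.* largestAntichain n ℱ ℕ.≤? (J ℕ.+ 48) ℕ.* u ℕ.* m

    private instance
      n≢0 : NonZero n
      n≢0 = ℕ.>-nonZero 1≤n
      nn≢0 : NonZero (n ℕ.* n)
      nn≢0 = ℕₚ.m*n≢0 n n
      JJ≢0 : NonZero (J ℕ.* J)
      JJ≢0 = ℕₚ.m*n≢0 J J
      f≢0 : NonZero f
      f≢0 = ℕₚ.m*n≢0 (n ℕ.* n) (J ℕ.* J)
      T≢0 : NonZero T
      T≢0 = ℕₚ.m*n≢0 f (suc J)

    private
      x μ β κ : ℚ
      x = recip T
      μ = recip J
      β = 1ℚ + x
      κ = ι w₀ * x

      h : ℕ
      h = n ℕ.* m ℕ.* u ℕ.* J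

    -- Here `T` is quadratic in `n`, whereas `h` has the factor `n m` and `m` is at least `n C 2`.
    -- This yields `β ^ h ≥ 1 + h / T ≥ 2 Q`.
    2QT≤h : 2 ℕ.* Q ℕ.* T ℕ.≤ h
    2QT≤h = begin
      2 ℕ.* Q ℕ.* (n ℕ.* n ℕ.* (J ℕ.* J) ℕ.* suc J)
        ≡⟨ solve 4 (λ Q n J s → con 2 :* Q :* (n :* n :* (J :* J) :* s) := n :* (n :* (con 2 :* (Q :* (J :* s)))) :* con 1 :* J) refl Q n J (suc J) ⟩
      n ℕ.* (n ℕ.* (2 ℕ.* (Q ℕ.* (J ℕ.* suc J)))) ℕ.* 1 ℕ.* J
        ≤⟨ ℕₚ.*-monoˡ-≤ J (ℕₚ.*-mono-≤ (ℕₚ.*-monoʳ-≤ n (central-large n _ n≥Q (ℕₚ.≤-trans (ℕₚ.m≤m+n 2 18) 20≤n)))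
             (ℕₚ.≤-trans (s≤s z≤n) (ℕₚ.≤-trans (ℕₚ.*-monoʳ-≤ 2 1≤J) (2J≤u u≥)))) ⟩
      n ℕ.* m ℕ.* u ℕ.* J ∎
      where
      open ℕₚ.≤-Reasoning
      open ℕSolver.+-*-Solver

    -- This dictates `f = T / (J + 1)`: by `bernoulli⁻` the power is at most
    -- `1 / (1 - 1 / (J + 1))`, which equals `1 + 1 / J`.
    β^f≤1+μ : β ^ f ≤ 1ℚ + μ
    β^f≤1+μ = power≤ (0≤recip T) (0≤+ 0≤1 (0≤recip J)) f (begin
      (1ℚ - y) * (1ℚ + μ)                      ≡⟨ cong₂ (λ o o′ → (o - y) * (o′ + μ)) (sym sJ*y) (sym Jμ) ⟩
      ((1ℚ + ι J) * y - y) * (ι J * μ + μ)     ≡⟨ solve 3 (λ j y μ → ((con 1ℚ :+ j) :* y :- y) :* (j :* μ :+ μ) := (con 1ℚ :+ j) :* y :* (j :* μ)) refl (ι J) y μ ⟩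
      (1ℚ + ι J) * y * (ι J * μ)               ≡⟨ cong₂ _*_ sJ*y Jμ ⟩
      1ℚ * 1ℚ                                  ≡⟨ *-identityˡ 1ℚ ⟩
      1ℚ                                       ∎)
      where
      open ≡-Reasoning
      open +-*-Solver
      y = ι f * x
      Jμ : ι J * μ ≡ 1ℚ
      Jμ = ι*recip J
      sJ*y : (1ℚ + ι J) * y ≡ 1ℚ
      sJ*y = begin
        (1ℚ + ι J) * (ι f * x)  ≡⟨ cong (_* (ι f * x)) (sym (ι-+ 1 J)) ⟩
        ι (suc J) * (ι f * x)   ≡⟨ solve 3 (λ s f x → s :* (f :* x) := f :* s :* x) refl (ι (suc J)) (ι f) x ⟩
        ι f * ι (suc J) * x     ≡⟨ cong (_* x) (sym (ι-* f (suc J))) ⟩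
        ι T * x                 ≡⟨ ι*recip T ⟩
        1ℚ                      ∎

    module _ {a b : ℚ} (0≤a : 0ℚ ≤ a) (0≤b : 0ℚ ≤ b) (a≤ : ι n * a ≤ ι (u ℕ.+ 2))
      (1≤a+b : 1ℚ ≤ a + b) (total : (a + b) ^ (2 ℕ.^ n) ≤ ι 2) where

      private
        bad : ℚ
        bad = ∑ˢ (λ ℱ → when (¬? (good? ℱ)) (weight a b ℱ))
        0≤bad : 0ℚ ≤ bad
        0≤bad = 0≤∑ˢ λ ℱ → 0≤when (¬? (good? ℱ)) (0≤weight 0≤a 0≤b ℱ)

      -- In lower terms, `κ = w₀ / T` is `(u + 2) / (n J)`.
      μa≤κ : μ * a ≤ κ
      μa≤κ = begin
        μ * a                             ≡⟨ trans (sym (*-identityʳ (μ * a))) (cong (μ * a *_) (sym (ι*recip T))) ⟩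
        μ * a * (ι T * x)                 ≡⟨ cong (λ t → μ * a * (ι t * x)) (ℕ-solve 3 (λ n J s → n ⊠ n ⊠ (J ⊠ J) ⊠ s ⊜ n ⊠ J ⊠ s ⊠ (n ⊠ J)) refl n J (suc J)) ⟩
        μ * a * (ι (z ℕ.* (n ℕ.* J)) * x) ≡⟨ cong (λ t → μ * a * (t * x)) (trans (ι-* z (n ℕ.* J)) (cong (ι z *_) (ι-* n J))) ⟩
        μ * a * (ι z * (ι n * ι J) * x)   ≡⟨ solve 6 (λ μ a z n j x → μ :* a :* (z :* (n :* j) :* x) := z :* (n :* a) :* (j :* μ) :* x) refl μ a (ι z) (ι n) (ι J) x ⟩
        ι z * (ι n * a) * (ι J * μ) * x   ≡⟨ cong (λ o → ι z * (ι n * a) * o * x) (ι*recip J) ⟩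
        ι z * (ι n * a) * 1ℚ * x          ≡⟨ cong (_* x) (*-identityʳ (ι z * (ι n * a))) ⟩
        ι z * (ι n * a) * x               ≤⟨ mulʳ (0≤recip T) (mulˡ (0≤ι z) a≤) ⟩
        ι z * ι (u ℕ.+ 2) * x             ≡⟨ cong (_* x) (sym (ι-* z (u ℕ.+ 2))) ⟩
        ι (z ℕ.* (u ℕ.+ 2)) * x           ≡⟨ cong (λ t → ι t * x) (ℕ-solve 4 (λ n J s v → n ⊠ J ⊠ s ⊠ v ⊜ v ⊠ n ⊠ J ⊠ s) refl n J (suc J) (u ℕ.+ 2)) ⟩
        ι w₀ * x                          ∎
        where
        open ≤-Reasoning
        open +-*-Solver
        open ℕSolver.+-*-Solver using () renaming (solve to ℕ-solve; _:*_ to infixl 7 _⊠_; _:=_ to infix 4 _⊜_)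
        z = n ℕ.* J ℕ.* suc J

      open Moment (isAntichain? n) (antichain-hereditary n)

      bad-bound : β ^ (h ℕ.+ Φ (2 ℕ.^ n)) * bad ≤ ι 2 * β ^ Φ (2 ℕ.^ n)
      bad-bound = ≤-trans
        (moment (0≤recip J) 0≤a 0≤b μa≤κ 1≤a+b total (λ ℱ → ¬? (good? ℱ)) large)
        (mulˡ (0≤ι 2) (subst (λ k → Z κ ⊤ ≤ β ^ Φ k) (∣⊤∣≡n (2 ℕ.^ n)) (Z≤β^Φ T w₀ (0≤recip T) (ι*recip T) high-degree ⊤)))
        where
        open ≤-Reasoning
        large : ∀ ℱ → ¬ Good ℱ → ∃ λ A → IsAntichain n A × A ⊆ ℱ × β ^ (h ℕ.+ Φ (2 ℕ.^ n)) ≤ (1ℚ + μ) ^ ∣ A ∣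
        large ℱ ¬good with largest-attained n ℱ
        ... | A , anti , A⊆ℱ , L≤ = A , anti , A⊆ℱ , (begin
          β ^ (h ℕ.+ Φ (2 ℕ.^ n)) ≤⟨ ^-monoʳ (≤+ʳ (0≤recip T)) (exponent (∣ A ∣) (ℕₚ.≤-trans (ℕₚ.<⇒≤ (ℕₚ.≰⇒> ¬good)) (ℕₚ.*-monoʳ-≤ (J ℕ.* n) L≤))) ⟩
          β ^ (f ℕ.* ∣ A ∣)       ≡⟨ ^-assocʳ β f ∣ A ∣ ⟨
          (β ^ f) ^ ∣ A ∣         ≤⟨ ^-mono (0≤^ (0≤+ 0≤1 (0≤recip T)) f) β^f≤1+μ ∣ A ∣ ⟩
          (1ℚ + μ) ^ ∣ A ∣        ∎)

      -- The common factor `β ^ Φ` cancels in `bad-bound`. The remaining 2 stems from the total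
      -- mass, which may exceed 1, and is compensated by `β ^ h ≥ 2 Q`.
      bad-small : ι Q * bad ≤ 1ℚ
      bad-small = *-cancelˡ-≤-pos (ι 2) {{normalize-pos 2 1}} (*-cancelʳ-≤-pos P {{P>0}} (begin
        ι 2 * (ι Q * bad) * P               ≡⟨ cong (_* P) (trans (sym (*-assoc (ι 2) (ι Q) bad)) (cong (_* bad) (sym (ι-* 2 Q)))) ⟩
        ι (2 ℕ.* Q) * bad * P               ≤⟨ mulʳ 0≤P (mulʳ 0≤bad 2Q≤) ⟩
        β ^ h * bad * P                     ≡⟨ solve 3 (λ a b c → a :* b :* c := a :* c :* b) refl (β ^ h) bad P ⟩
        β ^ h * P * bad                     ≡⟨ cong (_* bad) (^-homo-* β h (Φ (2 ℕ.^ n))) ⟨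
        β ^ (h ℕ.+ Φ (2 ℕ.^ n)) * bad       ≤⟨ bad-bound ⟩
        ι 2 * P                             ≡⟨ cong (_* P) (*-identityʳ (ι 2)) ⟨
        ι 2 * 1ℚ * P                        ∎))
        where
        open ≤-Reasoning
        open +-*-Solver
        P = β ^ Φ (2 ℕ.^ n)
        1≤P : 1ℚ ≤ P
        1≤P = 1≤^ (≤+ʳ (0≤recip T)) (Φ (2 ℕ.^ n))
        0≤P : 0ℚ ≤ P
        0≤P = ≤-trans 0≤1 1≤P
        P>0 : ℚ.Positive P
        P>0 = ℚ.positive (<-≤-trans (positive⁻¹ 1ℚ) 1≤P)
        2Q≤ : ι (2 ℕ.* Q) ≤ β ^ h
        2Q≤ = begin
          ι (2 ℕ.* Q)                 ≡⟨ trans (sym (*-identityʳ _)) (cong (ι (2 ℕ.* Q) *_) (sym (ι*recip T))) ⟩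
          ι (2 ℕ.* Q) * (ι T * x)     ≡⟨ trans (sym (*-assoc (ι (2 ℕ.* Q)) (ι T) x)) (cong (_* x) (sym (ι-* (2 ℕ.* Q) T))) ⟩
          ι (2 ℕ.* Q ℕ.* T) * x       ≤⟨ mulʳ (0≤recip T) (ι-mono 2QT≤h) ⟩
          ι h * x                     ≤⟨ ≤+ʳ 0≤1 ⟩
          ι h * x + 1ℚ                ≡⟨ +-comm (ι h * x) 1ℚ ⟩
          1ℚ + ι h * x                ≤⟨ bernoulli (0≤recip T) h ⟩
          β ^ h                       ∎

-- Enclosing rationals and reals by integers.

does⇒ : {P : Set} (P? : Dec P) → does P? ≡ true → P
does⇒ (yes p) _ = p

ι-cancel-≤ : ∀ {j k} → ι j ≤ ι k → j ℕ.≤ k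
ι-cancel-≤ {j} {k} ιj≤ιk = ℕₚ.≮⇒≥ λ k<j → <⇒≱ (k<1+k) (≤-trans (ι-mono k<j) ιj≤ιk)
  where
  <⇒≱ : ∀ {p q} → p < q → ¬ (q ≤ p)
  <⇒≱ p<q q≤p = <-irrefl refl (<-≤-trans p<q q≤p)
  k<1+k : ι k < ι (suc k)
  k<1+k = subst₂ _<_ (+-identityˡ (ι k)) (sym (ι-+ 1 k)) (+-monoˡ-< (ι k) (positive⁻¹ 1ℚ))

-- The denominator serves as multiplier: it turns a positive fraction into its numerator.
archimedean : ∀ {η} → 0ℚ < η → ∃ λ k → 1ℚ ≤ ι (suc k) * η
archimedean {mkℚ (ℤ.+ suc a) d c} _ = d , toℚᵘ-cancel-≤ (begin
  toℚᵘ 1ℚ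
    ≤⟨ ℚᵘ.*≤* (ℤ.+≤+ (subst₂ ℕ._≤_ (sym (trans (ℕₚ.*-identityˡ (1 ℕ.* suc d)) (ℕₚ.*-identityˡ (suc d))))
         (sym (ℕₚ.*-identityʳ (suc d ℕ.* suc a))) (ℕₚ.m≤m*n (suc d) (suc a)))) ⟩
  ℚᵘ.mkℚᵘ (ℤ.+ suc d) 0 ℚᵘ.* ℚᵘ.mkℚᵘ (ℤ.+ suc a) d
    ≃⟨ ℚᵘₚ.*-cong (toℚᵘ-ι (suc d)) ℚᵘₚ.≃-refl ⟨
  toℚᵘ (ι (suc d)) ℚᵘ.* toℚᵘ (mkℚ (ℤ.+ suc a) d c)
    ≃⟨ toℚᵘ-homo-* (ι (suc d)) (mkℚ (ℤ.+ suc a) d c) ⟨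
  toℚᵘ (ι (suc d) * mkℚ (ℤ.+ suc a) d c) ∎)
  where
  open ℚᵘₚ.≤-Reasoning
archimedean {mkℚ (ℤ.+ zero) d c} 0<η with ℚ.positive 0<η
... | record { pos = () }
archimedean {mkℚ ℤ.-[1+ a ] d c} 0<η with ℚ.positive 0<η
... | record { pos = () }

floor-exists : ∀ {q} → 0ℚ ≤ q → ∃ λ u → ι u ≤ q × q ≤ ι (suc u)
floor-exists {mkℚ (ℤ.+ a) d c} _ = u , toℚᵘ-cancel-≤ lower , toℚᵘ-cancel-≤ upper
  where
  open ℚᵘₚ.≤-Reasoning
  u = a ℕ./ suc d
  lower : toℚᵘ (ι u) ℚᵘ.≤ ℚᵘ.mkℚᵘ (ℤ.+ a) d
  lower = begin
    toℚᵘ (ι u)           ≃⟨ toℚᵘ-ι u ⟩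
    ℚᵘ.mkℚᵘ (ℤ.+ u) 0    ≤⟨ ℚᵘ.*≤* (subst₂ ℤ._≤_ (ℤₚ.pos-* u (suc d)) (sym (ℤₚ.*-identityʳ (ℤ.+ a))) (ℤ.+≤+ (ℕ.m/n*n≤m a (suc d)))) ⟩
    ℚᵘ.mkℚᵘ (ℤ.+ a) d    ∎
  upper : ℚᵘ.mkℚᵘ (ℤ.+ a) d ℚᵘ.≤ toℚᵘ (ι (suc u))
  upper = begin
    ℚᵘ.mkℚᵘ (ℤ.+ a) d        ≤⟨ ℚᵘ.*≤* (subst₂ ℤ._≤_ (sym (ℤₚ.*-identityʳ (ℤ.+ a))) (ℤₚ.pos-* (suc u) (suc d)) (ℤ.+≤+ a≤)) ⟩
    ℚᵘ.mkℚᵘ (ℤ.+ suc u) 0    ≃⟨ toℚᵘ-ι (suc u) ⟨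
    toℚᵘ (ι (suc u))         ∎
    where
    a≤ : a ℕ.≤ suc u ℕ.* suc d
    a≤ = ℕₚ.≤-trans (ℕₚ.≤-reflexive (ℕ.m≡m%n+[m/n]*n a (suc d))) (ℕₚ.+-monoˡ-≤ (u ℕ.* suc d) (ℕₚ.<⇒≤ (ℕ.m%n<n a (suc d))))
floor-exists {mkℚ ℤ.-[1+ a ] d c} 0≤q with ℚ.nonNegative 0≤q
... | record { nonNeg = () }

1≤a+∣1-a∣ : ∀ a → 1ℚ ≤ a + ℚ.∣ 1ℚ - a ∣
1≤a+∣1-a∣ a = subst (_≤ a + ℚ.∣ 1ℚ - a ∣) (solve 1 (λ a → a :+ (con 1ℚ :- a) := con 1ℚ) refl a) (+-monoʳ-≤ a (p≤∣p∣ (1ℚ - a)))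
  where
  open +-*-Solver

-- A representative p of a probability may exceed 1, so 1 - p is replaced by its absolute value.
total-mass : ∀ {a} N .{{_ : NonZero N}} .{{_ : NonZero (4 ℕ.* N)}} → a ≤ 1ℚ + recip (4 ℕ.* N) → (a + ℚ.∣ 1ℚ - a ∣) ^ N ≤ ι 2
total-mass {a} N a≤ = ≤-trans (^-mono (0≤+ʳ a) a+∣1-a∣≤ (N)) (power≤ (0≤+ 0≤s 0≤s) (0≤ι 2) (N) (begin
  (1ℚ - ι (N) * (s + s)) * ι 2      ≡⟨ solve 2 (λ n s → (con 1ℚ :- n :* (s :+ s)) :* con (ι 2) := con (ι 2) :- con (ι 4) :* n :* s) refl (ι (N)) s ⟩
  ι 2 - ι 4 * ι (N) * s             ≡⟨ cong (λ c → ι 2 - c * s) (sym (ι-* 4 (N))) ⟩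
  ι 2 - ι (4 ℕ.* N) * s             ≡⟨ cong (ι 2 -_) (ι*recip (4 ℕ.* N)) ⟩
  1ℚ                                    ∎))
  where
  open ≡-Reasoning
  open +-*-Solver
  s = recip (4 ℕ.* N)
  0≤s : 0ℚ ≤ s
  0≤s = 0≤recip (4 ℕ.* N)
  0≤+ʳ : ∀ a → 0ℚ ≤ a + ℚ.∣ 1ℚ - a ∣
  0≤+ʳ a = ≤-trans 0≤1 (1≤a+∣1-a∣ a)
  a+∣1-a∣≤ : a + ℚ.∣ 1ℚ - a ∣ ≤ 1ℚ + (s + s)
  a+∣1-a∣≤ with ∣p∣≡p∨∣p∣≡-p (1ℚ - a)
  ... | inj₁ e = subst (_≤ 1ℚ + (s + s)) (sym (trans (cong (a +_) e) (solve 1 (λ a → a :+ (con 1ℚ :- a) := con 1ℚ) refl a))) (≤+ʳ (0≤+ 0≤s 0≤s))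
  ... | inj₂ e = subst₂ _≤_
    (trans (solve 1 (λ a → a :+ a :- con 1ℚ := a :+ (:- (con 1ℚ :- a))) refl a) (cong (a +_) (sym e)))
    (solve 1 (λ s → con 1ℚ :+ s :+ (con 1ℚ :+ s) :- con 1ℚ := con 1ℚ :+ (s :+ s)) refl s)
    (+-monoˡ-≤ (ℚ.- 1ℚ) (+-mono-≤ a≤ a≤))

-- Above K/n with K large, the resolution 1/n suffices to locate p.
locate : ∀ (P : ℝ) n .{{_ : NonZero n}} K → (∃ λ N → ∀ k → N ℕ.≤ k → ι (suc K) * recip n ≤ seq P k) →
  ∃ λ u → K ℕ.≤ suc u × ∃ λ N → ∀ k → N ℕ.≤ k → ι u ≤ ι n * seq P k × ι n * seq P k ≤ ι (u ℕ.+ 2)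
locate P n K (N₁ , above) = u , K≤1+u , N₁ ℕ.⊔ N₂ , λ k N≤k → lower k N≤k , upper k N≤k
  where
  open ≤-Reasoning
  open +-*-Solver
  instance
    2n≢0 : NonZero (2 ℕ.* n)
    2n≢0 = ℕₚ.m*n≢0 2 n
  r = recip (2 ℕ.* n)
  r>0 : 0ℚ < r
  r>0 = positive⁻¹ r {{normalize-pos 1 (2 ℕ.* n)}}
  nr : ι 2 * (ι n * r) ≡ 1ℚ
  nr = trans (sym (*-assoc (ι 2) (ι n) r)) (trans (cong (_* r) (sym (ι-* 2 n))) (ι*recip (2 ℕ.* n)))
  nr+nr : ι n * r + ι n * r ≡ 1ℚ
  nr+nr = trans (solve 1 (λ z → z :+ z := con (ι 2) :* z) refl (ι n * r)) nr
  N₂ = proj₁ (cauchy P r r>0)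
  close = proj₂ (cauchy P r r>0)
  N = N₁ ℕ.⊔ N₂
  a = seq P N
  y = ι n * a
  K≤y : ι (suc K) ≤ y
  K≤y = begin
    ι (suc K)                   ≡⟨ trans (sym (*-identityʳ _)) (cong (ι (suc K) *_) (sym (ι*recip n))) ⟩
    ι (suc K) * (ι n * recip n) ≡⟨ solve 3 (λ k n r → k :* (n :* r) := n :* (k :* r)) refl (ι (suc K)) (ι n) (recip n) ⟩
    ι n * (ι (suc K) * recip n) ≤⟨ mulˡ (0≤ι n) (above N (ℕₚ.m≤m⊔n N₁ N₂)) ⟩
    y                           ∎
  -- By the choice of `r`, late terms multiplied by `n` lie between `q` and `q + 1`. Rounding `q`
  -- down to `u` then encloses them between `u` and `u + 2`.
  q = y - ι n * r
  K≤q : ι K ≤ q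
  K≤q = begin
    ι K                                      ≤⟨ ≤+ʳ (0≤* (0≤ι n) (<⇒≤ r>0)) ⟩
    ι K + ι n * r                            ≡⟨ solve 2 (λ k z → k :+ z := (z :+ z) :+ k :- z) refl (ι K) (ι n * r) ⟩
    (ι n * r + ι n * r) + ι K - ι n * r      ≡⟨ cong (λ o → o + ι K - ι n * r) nr+nr ⟩
    1ℚ + ι K - ι n * r                       ≡⟨ cong (_- ι n * r) (ι-+ 1 K) ⟨
    ι (suc K) - ι n * r                      ≤⟨ +-monoˡ-≤ (ℚ.- (ι n * r)) K≤y ⟩
    q                                        ∎
  located = floor-exists {q} (≤-trans (0≤ι K) K≤q)
  u = proj₁ located
  K≤1+u : K ℕ.≤ suc u
  K≤1+u = ι-cancel-≤ (≤-trans K≤q (proj₂ (proj₂ located)))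
  ∣-∣≤⇒ : ∀ {b} → ℚ.∣ b - a ∣ ≤ r → a - r ≤ b × b ≤ a + r
  ∣-∣≤⇒ {b} le = subst₂ _≤_ (solve 3 (λ a b r → a :- b :+ (b :- r) := a :- r) refl a b r) (solve 2 (λ b r → r :+ (b :- r) := b) refl b r)
                   (+-monoˡ-≤ (b - r) (≤-trans (p≤∣p∣ (a - b)) (subst (_≤ r) flip le)))
               , subst₂ _≤_ (solve 2 (λ a b → b :- a :+ a := b) refl a b) (+-comm r a) (+-monoˡ-≤ a (≤-trans (p≤∣p∣ (b - a)) le))
    where
    flip : ℚ.∣ b - a ∣ ≡ ℚ.∣ a - b ∣
    flip = trans (sym (∣-p∣≡∣p∣ (b - a))) (cong ℚ.∣_∣ (solve 2 (λ a b → :- (b :- a) := a :- b) refl a b))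
  near : ∀ k → N ℕ.≤ k → a - r ≤ seq P k × seq P k ≤ a + r
  near k N≤k = ∣-∣≤⇒ (close k N (ℕₚ.≤-trans (ℕₚ.m≤n⊔m N₁ N₂) N≤k) (ℕₚ.m≤n⊔m N₁ N₂))
  lower : ∀ k → N ℕ.≤ k → ι u ≤ ι n * seq P k
  lower k N≤k = begin
    ι u               ≤⟨ proj₁ (proj₂ located) ⟩
    q                 ≡⟨ solve 3 (λ n a r → n :* a :- n :* r := n :* (a :- r)) refl (ι n) a r ⟩
    ι n * (a - r)     ≤⟨ mulˡ (0≤ι n) (proj₁ (near k N≤k)) ⟩
    ι n * seq P k     ∎
  upper : ∀ k → N ℕ.≤ k → ι n * seq P k ≤ ι (u ℕ.+ 2)
  upper k N≤k = begin
    ι n * seq P k                     ≤⟨ mulˡ (0≤ι n) (proj₂ (near k N≤k)) ⟩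
    ι n * (a + r)                     ≡⟨ solve 3 (λ n a r → n :* (a :+ r) := n :* a :- n :* r :+ (n :* r :+ n :* r)) refl (ι n) a r ⟩
    q + (ι n * r + ι n * r)           ≡⟨ cong (q +_) nr+nr ⟩
    q + 1ℚ                            ≤⟨ +-monoˡ-≤ 1ℚ (proj₂ (proj₂ located)) ⟩
    ι (suc u) + 1ℚ                    ≡⟨ ι-+ (suc u) 1 ⟨
    ι (suc u ℕ.+ 1)                   ≡⟨ cong ι (sym (ℕₚ.+-suc u 1)) ⟩
    ι (u ℕ.+ 2)                       ∎

-- From rational estimates to the probability statement.

module _ (ε δ P : ℝ) (n J Q u : ℕ) .{{n≢0 : NonZero n}} .{{J≢0 : NonZero J}} .{{Q≢0 : NonZero Q}}
  (n≥ : 18 ℕ.* J ℕ.+ 2 ℕ.≤ n) (n≥Q : 2 ℕ.* (2 ℕ.* (Q ℕ.* (J ℕ.* suc J))) ℕ.+ 1 ℕ.≤ n)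
  (u≥ : 256 ℕ.* (J ℕ.* (J ℕ.* J) ℕ.* suc J) ℕ.≤ u)
  (ε-bound : ∃ λ N → ∀ k → N ℕ.≤ k → ι 48 ≤ ι J * seq ε k)
  (δ-bound : ∃ λ N → ∀ k → N ℕ.≤ k → 1ℚ ≤ ι Q * seq δ k)
  (P≤1 : P ≤ᴿ 1ᴿ)
  (located : ∃ λ N → ∀ k → N ℕ.≤ k → ι u ≤ ι n * seq P k × ι n * seq P k ≤ ι (u ℕ.+ 2)) where

  private
    open FixedCube n J u n≥ u≥ using (Good; good?; bad-small)

    m = n C ⌊ n /2⌋

    E : Family n → Set
    E ℱ = fromℕ (largestAntichain n ℱ) ≤ᴿ (1ᴿ +ᴿ ε) *ᴿ P *ᴿ fromℕ m

    good : ∀ ℱ → Dec (Good Q n≥Q ℱ)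
    good = good? Q n≥Q

    instance
      N≢0 : NonZero (2 ℕ.^ n)
      N≢0 = ℕₚ.m^n≢0 2 n
      4N≢0 : NonZero (4 ℕ.* 2 ℕ.^ n)
      4N≢0 = ℕₚ.m*n≢0 4 (2 ℕ.^ n)

  good⇒E : ∀ ℱ → Good Q n≥Q ℱ → E ℱ
  good⇒E ℱ g η η>0 = proj₁ ε-bound ℕ.⊔ proj₁ located , λ k N≤k → ≤-trans
    (bound k (proj₂ ε-bound k (ℕₚ.m⊔n≤o⇒m≤o (proj₁ ε-bound) (proj₁ located) N≤k))
             (proj₁ (proj₂ located k (ℕₚ.m⊔n≤o⇒n≤o (proj₁ ε-bound) (proj₁ located) N≤k))))
    (≤+ʳ (<⇒≤ η>0))
    where
    L = largestAntichain n ℱ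
    bound : ∀ k → ι 48 ≤ ι J * seq ε k → ι u ≤ ι n * seq P k → ι L ≤ (1ℚ + seq ε k) * seq P k * ι m
    bound k 48≤ u≤ = *-cancelˡ-≤-pos (ι (J ℕ.* n)) {{normalize-pos (J ℕ.* n) 1 {{_}} {{ℕₚ.m*n≢0 J n}}}} (begin
      ι (J ℕ.* n) * ι L                              ≡⟨ ι-* (J ℕ.* n) L ⟨
      ι (J ℕ.* n ℕ.* L)                              ≤⟨ ι-mono g ⟩
      ι ((J ℕ.+ 48) ℕ.* u ℕ.* m)                     ≡⟨ trans (ι-* ((J ℕ.+ 48) ℕ.* u) m) (cong (_* ι m) (trans (ι-* (J ℕ.+ 48) u) (cong (_* ι u) (ι-+ J 48)))) ⟩
      (ι J + ι 48) * ι u * ι m                       ≤⟨ mulʳ (0≤ι m) (mul-mono (0≤+ (0≤ι J) (≤-trans (0≤ι 48) 48≤)) (0≤ι u) (+-monoʳ-≤ (ι J) 48≤) u≤) ⟩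
      (ι J + ι J * e) * (ι n * a) * ι m              ≡⟨ solve 5 (λ J e n a m → (J :+ J :* e) :* (n :* a) :* m := J :* n :* ((con 1ℚ :+ e) :* a :* m)) refl (ι J) e (ι n) a (ι m) ⟩
      ι J * ι n * ((1ℚ + e) * a * ι m)               ≡⟨ cong (_* ((1ℚ + e) * a * ι m)) (ι-* J n) ⟨
      ι (J ℕ.* n) * ((1ℚ + e) * a * ι m)             ∎)
      where
      open ≤-Reasoning
      open +-*-Solver
      e = seq ε k
      a = seq P k

  probability : 1ᴿ -ᴿ δ ≤ᴿ Pr P (does ∘ good)
  probability η η>0 = N₁ ℕ.⊔ (N₂ ℕ.⊔ N₃) , λ k N≤k → ≤-trans
    (bound k
      (proj₂ δ-bound k (ℕₚ.m⊔n≤o⇒m≤o N₁ (N₂ ℕ.⊔ N₃) N≤k))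
      (proj₂ located k (ℕₚ.m⊔n≤o⇒m≤o N₂ N₃ (ℕₚ.m⊔n≤o⇒n≤o N₁ (N₂ ℕ.⊔ N₃) N≤k)))
      (proj₂ (P≤1 s s>0) k (ℕₚ.m⊔n≤o⇒n≤o N₂ N₃ (ℕₚ.m⊔n≤o⇒n≤o N₁ (N₂ ℕ.⊔ N₃) N≤k))))
    (≤+ʳ (<⇒≤ η>0))
    where
    -- With `N = 2 ^ n`, an excess of at most `1 / (4 N)` over 1 keeps `(a + |1 - a|) ^ N` at most
    -- `1 / (1 - 2 N s) = 2`.
    s = recip (4 ℕ.* 2 ℕ.^ n)
    s>0 : 0ℚ < s
    s>0 = positive⁻¹ s {{normalize-pos 1 (4 ℕ.* 2 ℕ.^ n)}}
    N₁ = proj₁ δ-bound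
    N₂ = proj₁ located
    N₃ = proj₁ (P≤1 s s>0)
    bound : ∀ k → 1ℚ ≤ ι Q * seq δ k → ι u ≤ ι n * seq P k × ι n * seq P k ≤ ι (u ℕ.+ 2) →
      seq P k ≤ 1ℚ + s → 1ℚ - seq δ k ≤ seq (Pr P (does ∘ good)) k
    bound k 1≤Qδ (u≤ , ≤u+2) a≤1+s = begin
      1ℚ - seq δ k              ≤⟨ +-mono-≤ (Pr-complement P good k 0≤a) (neg-antimono-≤ bad≤δ) ⟩
      pr + bad - bad            ≡⟨ solve 2 (λ p b → p :+ b :- b := p) refl pr bad ⟩
      pr                        ∎
      where
      open ≤-Reasoning
      open +-*-Solver
      a = seq P k
      pr = seq (Pr P (does ∘ good)) k
      bad = ∑ˢ (λ ℱ → when (¬? (good ℱ)) (weight a ℚ.∣ 1ℚ - a ∣ ℱ))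
      0≤a : 0ℚ ≤ a
      0≤a = *-cancelˡ-≤-pos (ι n) {{normalize-pos n 1}}
        (≤-trans (≤-reflexive (*-zeroʳ (ι n))) (≤-trans (0≤ι u) u≤))
      bad≤δ : bad ≤ seq δ k
      bad≤δ = *-cancelˡ-≤-pos (ι Q) {{normalize-pos Q 1}} (≤-trans
        (bad-small Q n≥Q 0≤a (0≤∣p∣ (1ℚ - a)) ≤u+2 (1≤a+∣1-a∣ a) (total-mass (2 ℕ.^ n) a≤1+s)) 1≤Qδ)

  small-whp : ProbAtLeast P E (1ᴿ -ᴿ δ)
  small-whp = does ∘ good , (λ ℱ e → good⇒E ℱ (does⇒ (good ℱ) e)) , probability

above⇒scaled : ∀ (x : ℝ) → 0ᴿ <ᴿ x → ∃ λ d → ∃ λ N → ∀ k → N ℕ.≤ k → 1ℚ ≤ ι (suc d) * seq x k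
above⇒scaled x (η , η>0 , N , bound) = d , N , λ k N≤k → ≤-trans (proj₂ (archimedean η>0))
  (mulˡ (0≤ι (suc d)) (subst (_≤ seq x k) (+-identityˡ η) (bound k N≤k)))
  where d = proj₁ (archimedean η>0)

module _ (ε : ℝ) (J K : ℕ) .{{J≢0 : NonZero J}} (K≥ : 256 ℕ.* (J ℕ.* (J ℕ.* J) ℕ.* suc J) ℕ.≤ K)
  (ε-bound : ∃ λ N → ∀ k → N ℕ.≤ k → ι 48 ≤ ι J * seq ε k)
  (p : ℕ → ℝ) (p≤1 : ∀ n → p n ≤ᴿ 1ᴿ) (above : EventuallyAbove (fromℕ (suc (suc K))) p) where

  module _ (δ : ℝ) (Q : ℕ) .{{Q≢0 : NonZero Q}} (δ-bound : ∃ λ N → ∀ k → N ℕ.≤ k → 1ℚ ≤ ι Q * seq δ k) where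

    sufficient : ℕ
    sufficient = 18 ℕ.* J ℕ.+ 2 ℕ.+ (2 ℕ.* (2 ℕ.* (Q ℕ.* (J ℕ.* suc J))) ℕ.+ 1)

    small-whp-beyond : ∀ n → proj₁ above ℕ.+ sufficient ℕ.≤ n → ProbAtLeast (p n)
      (λ ℱ → fromℕ (largestAntichain n ℱ) ≤ᴿ (1ᴿ +ᴿ ε) *ᴿ p n *ᴿ fromℕ (n C ⌊ n /2⌋)) (1ᴿ -ᴿ δ)
    small-whp-beyond n N≤n = small-whp ε δ (p n) n J Q u
      (ℕₚ.≤-trans (ℕₚ.m≤m+n _ _) large) n≥Q (ℕₚ.≤-trans K≥ (ℕ.s≤s⁻¹ (proj₁ (proj₂ location))))
      ε-bound δ-bound (p≤1 n) (proj₂ (proj₂ location))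
      where
      large : sufficient ℕ.≤ n
      large = ℕₚ.≤-trans (ℕₚ.m≤n+m sufficient (proj₁ above)) N≤n
      n≥Q : 2 ℕ.* (2 ℕ.* (Q ℕ.* (J ℕ.* suc J))) ℕ.+ 1 ℕ.≤ n
      n≥Q = ℕₚ.≤-trans (ℕₚ.m≤n+m _ (18 ℕ.* J ℕ.+ 2)) large
      instance
        n≢0 : NonZero n
        n≢0 = ℕ.>-nonZero (ℕₚ.≤-trans (ℕₚ.m≤n+m 1 _) n≥Q)
      -- The `K + 2` in the assumption on `p` pays for the rounding: applied to `K + 1`, `locate`
      -- returns `K + 1 ≤ u + 1`.
      location = locate (p n) n (suc K)
        (let τ , τ>0 , N , bound = proj₂ above n (ℕₚ.≤-trans (ℕₚ.m≤m+n (proj₁ above) sufficient) N≤n)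
         in N , λ k N≤k → ≤-trans (≤+ʳ (<⇒≤ τ>0)) (bound k N≤k))
      u = proj₁ location

  small-antichains-whp : WithHighProbability p λ n ℱ →
    fromℕ (largestAntichain n ℱ) ≤ᴿ (1ᴿ +ᴿ ε) *ᴿ p n *ᴿ fromℕ (n C ⌊ n /2⌋)
  small-antichains-whp δ δ>0 =
    -- With `Q = q + 1`, the weight of the bad event is at most `1 / Q`, hence at most `δ`.
    let q , bound = above⇒scaled δ δ>0
    in proj₁ above ℕ.+ sufficient δ (suc q) bound , small-whp-beyond δ (suc q) bound

theorem1 : ∀ (ε : ℝ) → 0ᴿ <ᴿ ε →
    ∃ λ (K : ℝ) →
    ∀ (p : ℕ → ℝ) → (∀ n → 0ᴿ ≤ᴿ p n × p n ≤ᴿ 1ᴿ) → EventuallyAbove K p →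
    WithHighProbability p λ n ℱ →
    fromℕ (largestAntichain n ℱ) ≤ᴿ (1ᴿ +ᴿ ε) *ᴿ p n *ᴿ fromℕ (n C ⌊ n /2⌋)
theorem1 ε ε>0 =
  let d , N , bound = above⇒scaled ε ε>0
      -- As `(d + 1) ε ≥ 1`, this gives `48 / J ≤ ε`, where 48 is the constant of
      -- `exponent-polynomial`.
      J = 48 ℕ.* suc d
      K = 256 ℕ.* (J ℕ.* (J ℕ.* J) ℕ.* suc J)
  in fromℕ (suc (suc K)) , λ p 0≤p≤1 above →
    small-antichains-whp ε J K ℕₚ.≤-refl
      (N , λ k N≤k → subst₂ _≤_ (*-identityʳ (ι 48))
        (trans (sym (*-assoc (ι 48) (ι (suc d)) (seq ε k))) (cong (_* seq ε k) (sym (ι-* 48 (suc d)))))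
        (mulˡ (0≤ι 48) (bound k N≤k)))
      p (λ n → proj₂ (0≤p≤1 n)) above
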